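{- Let $p$ be a prime, let $m,n$ be positive integers, put $l=\frac{p^n-1}{p-1}$, and for $1\le j\le m$ let $N_j=\sum_{k=j}^{m} p^{(k-j)(n-1)}\phi(p^k)$ (i.e. $N_j=\phi(p^j)+p^{n-1}(\phi(p^{j+1})+p^{n-1}(\cdots+p^{n-1}\phi(p^m))\cdots)$). Then the Laplacian polynomial of the power graph $\mathcal{G}(\mathbb{Z}_{p^m}^n)$ is \[ x(x-p^{mn})(x-1)^{l-1}(x-p^m)^{l p^{(m-1)(n-1)}(\phi(p^m)-1)}\left(\prod_{i=1}^{m-1}(x-p^i)^{l p^{(i-1)(n-1)}(p^{n-1}-1)}\right)\left(\prod_{i=1}^{m-1}\bigl(x-p^i-p^{n-1}N_{i+1}\bigr)^{l p^{(i-1)(n-1)}\phi(p^i)}\right), \] where empty products equal $1$.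
   Context: $\phi$ is Euler's totient function. For a finite group $G$, the power graph $\mathcal{G}(G)$ is the simple graph with vertex set $G$ in which two distinct vertices are adjacent if and only if one is a power of the other. $\mathbb{Z}_k^n$ is the direct product of $n$ copies of the cyclic group $\mathbb{Z}_k$ of order $k$. The Laplacian polynomial of a finite simple graph $\Gamma$ is $\det(xI-L(\Gamma))$ where $L(\Gamma)=D(\Gamma)-A(\Gamma)$ is the degree diagonal matrix minus the adjacency matrix. -}

module Defs where

open import Data.Nat as ℕ using (ℕ; zero; suc; _∸_; _^_; _%_; _/_)
open import Data.Nat.GCD using (gcd)
open import Data.Integer as ℤ using (ℤ; +_)
open import Data.Fin using (Fin; zero; suc; toℕ; punchIn)
open import Data.Fin.Properties using (any?; all?)
open import Data.Bool using (Bool; true; false; if_then_else_)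
open import Data.List using (List; []; _∷_; map; length; filter; upTo)
open import Data.Product using (∃; _×_)
open import Relation.Nullary using (¬_; Dec; yes; no; _×-dec_)

open import Relation.Nullary.Decidable using (⌊_⌋; _⊎-dec_; ¬?)
open import Data.Sum using (_⊎_)
open import Relation.Binary.PropositionalEquality using (_≡_)

φ : ℕ → ℕ
φ k = length (filter (λ i → gcd (suc i) k ℕ.≟ 1) (upTo k))

-- Polynomials over ℤ as coefficient lists (lowest degree first).
-- Two polynomials are equal iff all their coefficients agree.

Poly : Set
Poly = List ℤ

coeff : Poly → ℕ → ℤ
coeff []      _       = ℤ.0ℤ
coeff (a ∷ _) zero    = a
coeff (_ ∷ p) (suc k) = coeff p k

infix 4 _≈P_
_≈P_ : Poly → Poly → Set
p ≈P q = ∀ k → coeff p k ≡ coeff q k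

infixl 6 _+P_ _-P_
infixl 7 _*P_

_+P_ : Poly → Poly → Poly
[]      +P q       = q
(a ∷ p) +P []      = a ∷ p
(a ∷ p) +P (b ∷ q) = (a ℤ.+ b) ∷ (p +P q)

scaleP : ℤ → Poly → Poly
scaleP c p = map (c ℤ.*_) p

negP : Poly → Poly
negP = scaleP (ℤ.- ℤ.1ℤ)

_-P_ : Poly → Poly → Poly
p -P q = p +P negP q

_*P_ : Poly → Poly → Poly
[]      *P q = []
(a ∷ p) *P q = scaleP a q +P (ℤ.0ℤ ∷ (p *P q))

constP : ℤ → Poly
constP a = a ∷ []

X : Poly
X = ℤ.0ℤ ∷ ℤ.1ℤ ∷ []

_^P_ : Poly → ℕ → Poly
p ^P zero  = constP ℤ.1ℤ
p ^P suc k = p *P (p ^P k)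

x-_ : ℕ → Poly
x- a = X -P constP (+ a)

sumFin : ∀ n → (Fin n → ℕ) → ℕ
sumFin zero    f = 0
sumFin (suc n) f = f zero ℕ.+ sumFin n (λ i → f (suc i))

sumFinP : ∀ n → (Fin n → Poly) → Poly
sumFinP zero    f = []
sumFinP (suc n) f = f zero +P sumFinP n (λ i → f (suc i))

-- Σ_{k=a}^{b} f k  (zero if b < a)
sumFromTo : ℕ → ℕ → (ℕ → ℕ) → ℕ
sumFromTo a b f = go (suc b ∸ a) a
  where
  go : ℕ → ℕ → ℕ
  go zero    _ = 0
  go (suc r) k = f k ℕ.+ go r (suc k)

-- Π_{i=a}^{b} f i  (empty product = 1 if b < a)
prodFromToP : ℕ → ℕ → (ℕ → Poly) → Poly
prodFromToP a b f = go (suc b ∸ a) a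
  where
  go : ℕ → ℕ → Poly
  go zero    _ = constP ℤ.1ℤ
  go (suc r) i = f i *P go r (suc i)

alt : ℕ → Poly → Poly
alt zero    p = p
alt (suc k) p = negP (alt k p)

det : ∀ n → (Fin n → Fin n → Poly) → Poly
det zero    M = constP ℤ.1ℤ
det (suc n) M =
  sumFinP (suc n) (λ j →
    alt (toℕ j) (M zero j *P det n (λ r c → M (suc r) (punchIn j c))))

Graph : ℕ → Set
Graph N = Fin N → Fin N → Bool

b2ℕ : Bool → ℕ
b2ℕ true  = 1
b2ℕ false = 0

degree : ∀ {N} → Graph N → Fin N → ℕ
degree {N} A i = sumFin N (λ j → b2ℕ (A i j))

laplacian : ∀ {N} → Graph N → Fin N → Fin N → ℤ
laplacian A i j =
  (if ⌊ i Data.Fin.≟ j ⌋ then + degree A i else ℤ.0ℤ) ℤ.- + b2ℕ (A i j)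

laplacianPoly : ∀ N → Graph N → Poly
laplacianPoly N A =
  det N (λ i j → (if ⌊ i Data.Fin.≟ j ⌋ then X else []) -P constP (laplacian A i j))

-- The group ℤ_q^n.  Its q^n elements are encoded by Fin (q ^ n): the code
-- c represents the tuple whose d-th component (d < n) is the d-th base-q
-- digit of c.  The group operation is componentwise addition mod q.

modq : ℕ → ℕ → ℕ
modq zero     x = x
modq (suc q') x = x % suc q'

divq : ℕ → ℕ → ℕ
divq zero     x = 0
divq (suc q') x = x / suc q'

digit : (q d x : ℕ) → ℕ
digit q zero    x = modq q x
digit q (suc d) x = digit q d (divq q x)

elem : ∀ q n → Fin (q ^ n) → Fin n → ℕ
elem q n c d = digit q (toℕ d) (toℕ c)

addZ : ∀ q n → (Fin n → ℕ) → (Fin n → ℕ) → (Fin n → ℕ)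
addZ q n g h d = modq q (g d ℕ.+ h d)

idZ : ∀ n → Fin n → ℕ
idZ n d = 0

powZ : ∀ q n → (Fin n → ℕ) → ℕ → (Fin n → ℕ)
powZ q n g zero    = idZ n
powZ q n g (suc k) = addZ q n g (powZ q n g k)

-- "h is a power of g": h = g^k for some k; since g^q = e it suffices
-- to take k < q.
IsPowerOf : ∀ q n → Fin (q ^ n) → Fin (q ^ n) → Set
IsPowerOf q n h g = ∃ λ (k : Fin q) → ∀ (d : Fin n) → elem q n h d ≡ powZ q n (elem q n g) (toℕ k) d

isPowerOf? : ∀ q n h g → Dec (IsPowerOf q n h g)
isPowerOf? q n h g = any? (λ k → all? (λ d → elem q n h d ℕ.≟ powZ q n (elem q n g) (toℕ k) d))

powerGraphZ : ∀ q n → Graph (q ^ n)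
powerGraphZ q n g h =
  ⌊ ¬? (g Data.Fin.≟ h) ×-dec (isPowerOf? q n g h ⊎-dec isPowerOf? q n h g) ⌋

-- l = (p^n - 1)/(p - 1)   (only used for primes p, where p - 1 ≠ 0)
ell : ℕ → ℕ → ℕ
ell (suc (suc k)) n = (suc (suc k) ^ n ∸ 1) / suc k
ell _             n = 0

Nj : (p m n j : ℕ) → ℕ
Nj p m n j = sumFromTo j m (λ k → p ^ ((k ∸ j) ℕ.* (n ∸ 1)) ℕ.* φ (p ^ k))

rhs : (p m n : ℕ) → Poly
rhs p m n =
  X
  *P (x- (p ^ (m ℕ.* n)))
  *P ((x- 1) ^P (ell p n ∸ 1))
  *P ((x- (p ^ m)) ^P (ell p n ℕ.* p ^ ((m ∸ 1) ℕ.* (n ∸ 1)) ℕ.* (φ (p ^ m) ∸ 1)))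
  *P prodFromToP 1 (m ∸ 1) (λ i →
       (x- (p ^ i)) ^P (ell p n ℕ.* p ^ ((i ∸ 1) ℕ.* (n ∸ 1)) ℕ.* (p ^ (n ∸ 1) ∸ 1)))
  *P prodFromToP 1 (m ∸ 1) (λ i →
       (x- (p ^ i ℕ.+ p ^ (n ∸ 1) ℕ.* Nj p m n (suc i)))
         ^P (ell p n ℕ.* p ^ ((i ∸ 1) ℕ.* (n ∸ 1)) ℕ.* φ (p ^ i)))

{-# OPTIONS --safe #-}

-- Evaluating at integers x reduces the claim to det (x I − L) over ℤ.
-- Comparability of cyclic subgroups makes the power graph the comparability
-- graph of a tree whose nodes, the cyclic subgroups of order p^i, are blown up
-- to their φ(p^i) generators. If A and B are disjoint blocks of vertices that
-- see every vertex outside both of them alike, then, after adding up the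
-- columns of each block, the difference of their rows is λ(e_A − e_B); hence
-- merging A into B splits off the factor λ. Working down from the leaves, the
-- generators of a subgroup of order p^i are merged into the block above it
-- (λ = x − p^i − p^(n−1) N_(i+1)), and then the blocks over a common parent of
-- order p^i are merged with each other (λ = x − p^i). A single block with row
-- sum x remains. Counting the merges gives the exponents.
module Submission where

open import Defs
open import Data.Bool using (if_then_else_)
open import Data.Empty using (⊥-elim)
open import Data.Fin using (Fin; zero; suc; toℕ; fromℕ; fromℕ<; punchIn; _≟_)
open import Data.Fin.Properties using (suc-injective; 0≢1+n; any?; all?; toℕ-injective; toℕ<n; toℕ-fromℕ; toℕ-fromℕ<)
open import Data.Integer as ℤ using (ℤ; +_; 0ℤ; 1ℤ; -1ℤ)
import Data.Integer.Properties as ℤₚ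
open import Data.Integer.Tactic.RingSolver using (solve-∀)
open import Data.List using ([]; _∷_; length; filter; applyUpTo)
open import Data.Nat as ℕ using (ℕ; zero; suc; _+_; _*_; _∸_; _^_; _%_; _/_; _≤_; _<_; z≤n; s≤s; NonZero)
open import Data.Nat.Coprimality using (Coprime; coprime-divisor; coprime-Bézout; gcd≡1⇒coprime; coprime⇒gcd≡1)
open import Data.Nat.DivMod
open import Data.Nat.Divisibility using (_∣_; _∣?_; divides; 1∣_; ∣-trans; ∣⇒≤; ∣1⇒≡1; m∣m*n; n∣m*n; *-monoʳ-∣; *-cancelˡ-∣; m%n≡0⇒n∣m; n∣m⇒m%n≡0)
open import Data.Nat.GCD using (gcd; module Bézout)
open import Data.Nat.Primality using (Prime; prime⇒irreducible; prime⇒nonZero; prime⇒nonTrivial)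
import Data.Nat.Properties as ℕₚ
open import Data.Nat.Tactic.RingSolver using () renaming (solve-∀ to solve-∀ₙ)
open import Data.Product using (∃; _×_; _,_; proj₁; proj₂)
open import Data.Sum using (_⊎_; inj₁; inj₂; [_,_]′)
open import Data.Unit using (tt)
open import Function using (flip; _∘_; id)
open import Relation.Binary.Definitions using (tri<; tri≈; tri>)
open import Relation.Binary.PropositionalEquality
open import Relation.Nullary using (¬_; Dec; yes; no; _×-dec_)
open import Relation.Nullary.Decidable using (⌊_⌋; ¬?; map′; _⊎-dec_)
import Algebra.Properties.Semiring.Sum ℤₚ.+-*-semiring as Sumℤ
import Algebra.Properties.Semiring.Sum ℕₚ.+-*-semiring as Sumℕ

-- Determinants over ℤ

-- The matrix keeps its size throughout: an absorbed vertex is not deleted, its row becomes one of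
-- the identity. Thus the vertices are never renumbered, and a merge is a chain of row and column
-- operations on matrices over one index set. Counting the merges requires representatives that
-- survive from stage to stage. A block is named by the least element of order p^m over its class; a
-- name at level i is then still a name at level i + 1, so the number of merges between siblings is
-- a difference of numbers of cyclic subgroups. All factors of a stage agree because the two numbers
-- behind them depend on the level alone. Absorbing a generator gives x minus the number of elements
-- comparable to it, itself included; joining siblings gives x minus the number of elements below
-- their parent. The isolated factors come from the two ends of the tree. The identity is comparable
-- to everything, whence x - p^(mn), and it is the parent of l subgroups of order p, whence (x -
-- 1)^(l-1). At level m nothing lies above a class, so one of its generators has to serve as the
-- block for the others, whence the exponent φ(p^m) - 1 per class.

if-yes : ∀ {a p} {A : Set a} {P : Set p} (d : Dec P) {x y : A} → P → (if ⌊ d ⌋ then x else y) ≡ x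
if-yes (yes _) p = refl
if-yes (no ¬p) p = ⊥-elim (¬p p)

if-no : ∀ {a p} {A : Set a} {P : Set p} (d : Dec P) {x y : A} → ¬ P → (if ⌊ d ⌋ then x else y) ≡ y
if-no (yes p) ¬p = ⊥-elim (¬p p)
if-no (no _)  ¬p = refl

-- Sealed, so that a sum over Fin (suc n) does not unfold during unification.
opaque
  ∑ : ∀ {n} → (Fin n → ℤ) → ℤ
  ∑ = Sumℤ.sum

  ∑-empty : ∀ (f : Fin 0 → ℤ) → ∑ f ≡ 0ℤ
  ∑-empty f = refl

  ∑-suc : ∀ {n} (f : Fin (suc n) → ℤ) → ∑ f ≡ f zero ℤ.+ ∑ (f ∘ suc)
  ∑-suc f = refl

  ∑-cong : ∀ {n} {f g : Fin n → ℤ} → (∀ i → f i ≡ g i) → ∑ f ≡ ∑ g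
  ∑-cong = Sumℤ.sum-cong-≗

  ∑-+ : ∀ {n} (f g : Fin n → ℤ) → ∑ (λ i → f i ℤ.+ g i) ≡ ∑ f ℤ.+ ∑ g
  ∑-+ = Sumℤ.∑-distrib-+

  ∑-swap : ∀ {m n} (f : Fin m → Fin n → ℤ) → ∑ (λ i → ∑ (λ j → f i j)) ≡ ∑ (λ j → ∑ (λ i → f i j))
  ∑-swap = Sumℤ.∑-comm

  ∑-*ˡ : ∀ {n} k (f : Fin n → ℤ) → k ℤ.* ∑ f ≡ ∑ (λ i → k ℤ.* f i)
  ∑-*ˡ = Sumℤ.*-distribˡ-sum

  ∑-zero : ∀ {n} {f : Fin n → ℤ} → (∀ i → f i ≡ 0ℤ) → ∑ f ≡ 0ℤ
  ∑-zero {n} f≡0 = trans (∑-cong f≡0) (Sumℤ.sum-replicate-zero n)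

Matrix : ℕ → Set
Matrix n = Fin n → Fin n → ℤ

sgn : ∀ {n} → Fin n → ℤ
sgn zero    = 1ℤ
sgn (suc j) = ℤ.- sgn j

minor : ∀ {n} → Fin (suc n) → Matrix (suc n) → Matrix n
minor j M r c = M (suc r) (punchIn j c)

detℤ : ∀ n → Matrix n → ℤ
detℤ zero    M = 1ℤ
detℤ (suc n) M = ∑ λ j → sgn j ℤ.* (M zero j ℤ.* detℤ n (minor j M))

det-cong : ∀ n {M M′ : Matrix n} → (∀ r c → M r c ≡ M′ r c) → detℤ n M ≡ detℤ n M′
det-cong zero    eq = refl
det-cong (suc n) eq = ∑-cong λ j →
  cong (sgn j ℤ.*_) (cong₂ ℤ._*_ (eq zero j) (det-cong n (λ r c → eq (suc r) (punchIn j c))))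

minor₂ : ∀ {n} → Matrix (suc (suc n)) → Fin (suc n) → Fin (suc n) → Matrix n
minor₂ M i j r c = M (suc (punchIn i r)) (suc (punchIn j c))

-- Expanding the minors of the first row along their first column makes the
-- expansion symmetric in rows and columns.
det-border : ∀ n →
  (∀ (M : Matrix (suc n)) → detℤ (suc n) (flip M) ≡ detℤ (suc n) M) →
  (∀ (M : Matrix n) → detℤ n (flip M) ≡ detℤ n M) →
  ∀ (M : Matrix (suc (suc n))) → detℤ (suc (suc n)) M ≡
  1ℤ ℤ.* (M zero zero ℤ.* detℤ (suc n) (minor zero M)) ℤ.+
  ∑ λ j → ∑ λ i → ℤ.- sgn j ℤ.* (M zero (suc j) ℤ.* (sgn i ℤ.* (M (suc i) zero ℤ.* detℤ n (minor₂ M i j))))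
det-border n ih₁ ih₀ M = trans (∑-suc _) (cong (ℤ._+_ (1ℤ ℤ.* (M zero zero ℤ.* detℤ (suc n) (minor zero M)))) (∑-cong λ j →
  trans (cong (λ z → ℤ.- sgn j ℤ.* (M zero (suc j) ℤ.* z)) (column j))
        (trans (cong (ℤ.- sgn j ℤ.*_) (∑-*ˡ (M zero (suc j)) _))
               (∑-*ˡ (ℤ.- sgn j) _))))
  where
  column : ∀ j → detℤ (suc n) (minor (suc j) M) ≡
                 ∑ λ i → sgn i ℤ.* (M (suc i) zero ℤ.* detℤ n (minor₂ M i j))
  column j = trans (sym (ih₁ (minor (suc j) M)))
    (∑-cong λ i → cong (λ z → sgn i ℤ.* (M (suc i) zero ℤ.* z)) (ih₀ (minor₂ M i j)))

-- The induction covers two sizes at once, as `det-border` uses both. Swapping its double sum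
-- exchanges the roles of first row and first column, up to transposing the minors of size `n`.
det-transpose : ∀ n (M : Matrix n) → detℤ n (flip M) ≡ detℤ n M
det-transpose zero          M = refl
det-transpose (suc zero)    M = ∑-cong λ { zero → refl }
det-transpose (suc (suc n)) M = begin
  detℤ (suc (suc n)) (flip M)
    ≡⟨ det-border n (det-transpose (suc n)) (det-transpose n) (flip M) ⟩
  _ ≡⟨ cong₂ ℤ._+_
         (cong (λ z → 1ℤ ℤ.* (M zero zero ℤ.* z)) (det-transpose (suc n) (minor zero M)))
         (trans (∑-swap (λ j i → ℤ.- sgn j ℤ.* (M (suc j) zero ℤ.* (sgn i ℤ.* (M zero (suc i) ℤ.* detℤ n (minor₂ (flip M) i j))))))
                (∑-cong λ i → ∑-cong λ j →
                  trans (rearrange (sgn j) (M (suc j) zero) (sgn i) (M zero (suc i)) _)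
                        (cong (λ z → ℤ.- sgn i ℤ.* (M zero (suc i) ℤ.* (sgn j ℤ.* (M (suc j) zero ℤ.* z))))
                              (det-transpose n (minor₂ M j i))))) ⟩
  _ ≡⟨ det-border n (det-transpose (suc n)) (det-transpose n) M ⟨
  detℤ (suc (suc n)) M ∎
  where
  open ≡-Reasoning
  rearrange : ∀ s a t b z → ℤ.- s ℤ.* (a ℤ.* (t ℤ.* (b ℤ.* z))) ≡ ℤ.- t ℤ.* (b ℤ.* (s ℤ.* (a ℤ.* z)))
  rearrange = solve-∀

-- Additivity and homogeneity are combined so that zero rows, scaled rows and row additions are all
-- instances.
det-row-linear : ∀ n (a : Fin n) k {M M′ M″ : Matrix n} →
  (∀ c → M a c ≡ M′ a c ℤ.+ k ℤ.* M″ a c) →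
  (∀ r c → r ≢ a → M r c ≡ M′ r c) → (∀ r c → r ≢ a → M r c ≡ M″ r c) →
  detℤ n M ≡ detℤ n M′ ℤ.+ k ℤ.* detℤ n M″
det-row-linear (suc n) a k {M} {M′} {M″} row eq′ eq″ =
  trans (∑-cong (term a row eq′ eq″))
        (trans (∑-+ _ _) (cong (ℤ._+_ (detℤ (suc n) M′)) (sym (∑-*ˡ k _))))
  where
  term : ∀ a →
    (∀ c → M a c ≡ M′ a c ℤ.+ k ℤ.* M″ a c) →
    (∀ r c → r ≢ a → M r c ≡ M′ r c) → (∀ r c → r ≢ a → M r c ≡ M″ r c) → ∀ j →
    sgn j ℤ.* (M zero j ℤ.* detℤ n (minor j M)) ≡
    sgn j ℤ.* (M′ zero j ℤ.* detℤ n (minor j M′)) ℤ.+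
    k ℤ.* (sgn j ℤ.* (M″ zero j ℤ.* detℤ n (minor j M″)))
  term zero row eq′ eq″ j
    rewrite row j
          | sym (det-cong n {minor j M} {minor j M′} (λ r c → eq′ (suc r) (punchIn j c) (λ ())))
          | sym (det-cong n {minor j M} {minor j M″} (λ r c → eq″ (suc r) (punchIn j c) (λ ())))
    = distrib (sgn j) (M′ zero j) (M″ zero j) k _
    where
    distrib : ∀ s x y k z → s ℤ.* ((x ℤ.+ k ℤ.* y) ℤ.* z) ≡ s ℤ.* (x ℤ.* z) ℤ.+ k ℤ.* (s ℤ.* (y ℤ.* z))
    distrib = solve-∀
  term (suc a) row eq′ eq″ j
    rewrite sym (eq′ zero j (λ ())) | sym (eq″ zero j (λ ()))
          | det-row-linear n a k {minor j M} {minor j M′} {minor j M″} (λ c → row (punchIn j c))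
              (λ r c r≢a → eq′ (suc r) (punchIn j c) (r≢a ∘ suc-injective))
              (λ r c r≢a → eq″ (suc r) (punchIn j c) (r≢a ∘ suc-injective))
    = distrib (sgn j) (M zero j) k _ _
    where
    distrib : ∀ s x k y z → s ℤ.* (x ℤ.* (y ℤ.+ k ℤ.* z)) ≡ s ℤ.* (x ℤ.* y) ℤ.+ k ℤ.* (s ℤ.* (x ℤ.* z))
    distrib = solve-∀

det-zero-row : ∀ n (a : Fin n) {M : Matrix n} → (∀ c → M a c ≡ 0ℤ) → detℤ n M ≡ 0ℤ
-- A zero row equals itself plus -1 times itself, so det M = det M - det M.
det-zero-row n a {M} row = trans (det-row-linear n a -1ℤ {M} {M} {M}
    (λ c → trans (row c) (sym (cong (λ z → z ℤ.+ -1ℤ ℤ.* z) (row c)))) (λ _ _ _ → refl) (λ _ _ _ → refl))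
  (cancel (detℤ n M))
  where
  cancel : ∀ z → z ℤ.+ -1ℤ ℤ.* z ≡ 0ℤ
  cancel = solve-∀

det-scale-row : ∀ n (a : Fin n) k {M M″ : Matrix n} →
  (∀ c → M a c ≡ k ℤ.* M″ a c) → (∀ r c → r ≢ a → M r c ≡ M″ r c) →
  detℤ n M ≡ k ℤ.* detℤ n M″
det-scale-row n a k {M} {M″} row eq =
  trans (det-row-linear n a k {M} {M₀} {M″} row₀ eq₀ eq)
        (trans (cong (ℤ._+ k ℤ.* detℤ n M″) (det-zero-row n a {M₀} zero-row)) (ℤₚ.+-identityˡ _))
  where
  M₀ : Matrix n
  M₀ r c = if ⌊ r ≟ a ⌋ then 0ℤ else M r c
  zero-row : ∀ c → M₀ a c ≡ 0ℤ
  zero-row c = if-yes (a ≟ a) refl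
  row₀ : ∀ c → M a c ≡ M₀ a c ℤ.+ k ℤ.* M″ a c
  row₀ c rewrite zero-row c = trans (row c) (sym (ℤₚ.+-identityˡ _))
  eq₀ : ∀ r c → r ≢ a → M r c ≡ M₀ r c
  eq₀ r c r≢a = sym (if-no (r ≟ a) r≢a)

-- The first two terms of the expansion have equal minors and opposite signs. In every later term
-- the minor retains both equal columns, again in positions 0 and 1.
det-equal-columns₀₁ : ∀ n {M : Matrix (suc (suc n))} →
  (∀ r → M r zero ≡ M r (suc zero)) → detℤ (suc (suc n)) M ≡ 0ℤ
det-equal-columns₀₁ n {M} eq =
  trans (trans (∑-suc _) (cong (ℤ._+_ (1ℤ ℤ.* (M zero zero ℤ.* D))) (∑-suc _))) (trans (cong₂ (λ u v → 1ℤ ℤ.* (M zero zero ℤ.* detℤ (suc n) (minor zero M)) ℤ.+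
                        (ℤ.- 1ℤ ℤ.* (u ℤ.* v) ℤ.+
                         ∑ λ j → ℤ.- (ℤ.- sgn j) ℤ.* (M zero (suc (suc j)) ℤ.* detℤ (suc n) (minor (suc (suc j)) M))))
               (sym (eq zero)) (det-cong (suc n) {minor (suc zero) M} {minor zero M} same))
        (trans (cong (λ z → 1ℤ ℤ.* (M zero zero ℤ.* D) ℤ.+ (ℤ.- 1ℤ ℤ.* (M zero zero ℤ.* D) ℤ.+ z)) (∑-zero (rest n {M} eq))) (cancel (M zero zero) D)))
  where
  D = detℤ (suc n) (minor zero M)
  same : ∀ r c → minor (suc zero) M r c ≡ minor zero M r c
  same r zero    = eq (suc r)
  same r (suc c) = refl
  rest : ∀ n {M : Matrix (suc (suc n))} → (∀ r → M r zero ≡ M r (suc zero)) → ∀ j →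
    ℤ.- (ℤ.- sgn j) ℤ.* (M zero (suc (suc j)) ℤ.* detℤ (suc n) (minor (suc (suc j)) M)) ≡ 0ℤ
  rest (suc n) {M} eq j =
    trans (cong (λ z → ℤ.- (ℤ.- sgn j) ℤ.* (M zero (suc (suc j)) ℤ.* z))
                (det-equal-columns₀₁ n {minor (suc (suc j)) M} (λ r → eq (suc r))))
          (annihilate (sgn j) (M zero (suc (suc j))))
    where
    annihilate : ∀ s x → ℤ.- (ℤ.- s) ℤ.* (x ℤ.* 0ℤ) ≡ 0ℤ
    annihilate = solve-∀
  cancel : ∀ x y → 1ℤ ℤ.* (x ℤ.* y) ℤ.+ (ℤ.- 1ℤ ℤ.* (x ℤ.* y) ℤ.+ 0ℤ) ≡ 0ℤ
  cancel = solve-∀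

det-equal-rows₀₁ : ∀ n {M : Matrix (suc (suc n))} →
  (∀ c → M zero c ≡ M (suc zero) c) → detℤ (suc (suc n)) M ≡ 0ℤ
det-equal-rows₀₁ n {M} eq = trans (sym (det-transpose (suc (suc n)) M)) (det-equal-columns₀₁ n {flip M} eq)

EqualRowsVanish : ℕ → Set
EqualRowsVanish n = ∀ (a b : Fin n) {M : Matrix n} → a ≢ b → (∀ c → M a c ≡ M b c) → detℤ n M ≡ 0ℤ

det-equal-rows-suc : ∀ n → EqualRowsVanish n → ∀ (a b : Fin n) {M : Matrix (suc n)} → a ≢ b →
  (∀ c → M (suc a) c ≡ M (suc b) c) → detℤ (suc n) M ≡ 0ℤ
det-equal-rows-suc n ih a b {M} a≢b eq = ∑-zero λ j →
  trans (cong (λ z → sgn j ℤ.* (M zero j ℤ.* z))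
              (ih a b {minor j M} a≢b (λ c → eq (punchIn j c))))
        (annihilate (sgn j) (M zero j))
  where
  annihilate : ∀ s x → s ℤ.* (x ℤ.* 0ℤ) ≡ 0ℤ
  annihilate = solve-∀

-- If rows 0 and b ≥ 2 agree with u, put v for row 1: the value g u v is
-- additive in both arguments, vanishes on the diagonal and on g v u.
det-equal-rows₀ : ∀ n → EqualRowsVanish n → ∀ (b : Fin n) {M : Matrix (suc n)} →
  (∀ c → M zero c ≡ M (suc b) c) → detℤ (suc n) M ≡ 0ℤ
det-equal-rows₀ (suc n) ih zero    {M} eq = det-equal-rows₀₁ n {M} eq
det-equal-rows₀ (suc n) ih (suc b) {M} eq = begin
  detℤ N M                                     ≡⟨ det-cong N {M} {R u v} R-uv ⟩
  g u v                                        ≡⟨ pad (g u v) ⟩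
  0ℤ ℤ.+ 1ℤ ℤ.* g u v ℤ.+ 1ℤ ℤ.* (0ℤ ℤ.+ 1ℤ ℤ.* 0ℤ)
    ≡⟨ cong₂ (λ x y → x ℤ.+ 1ℤ ℤ.* g u v ℤ.+ 1ℤ ℤ.* y) (sym (diag u))
             (cong₂ (λ x y → x ℤ.+ 1ℤ ℤ.* y) (sym g-vu) (sym (diag v))) ⟩
  g u u ℤ.+ 1ℤ ℤ.* g u v ℤ.+ 1ℤ ℤ.* (g v u ℤ.+ 1ℤ ℤ.* g v v)
    ≡⟨ cong₂ (λ x y → x ℤ.+ 1ℤ ℤ.* y) (sym (addʳ u)) (sym (addʳ v)) ⟩
  g u w ℤ.+ 1ℤ ℤ.* g v w                       ≡⟨ addˡ w ⟨
  g w w                                        ≡⟨ diag w ⟩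
  0ℤ ∎
  where
  open ≡-Reasoning
  N = suc (suc n)
  R : (Fin N → ℤ) → (Fin N → ℤ) → Matrix N
  R u v zero          = u
  R u v (suc zero)    = v
  R u v (suc (suc r)) = M (suc (suc r))
  g : (Fin N → ℤ) → (Fin N → ℤ) → ℤ
  g u v = detℤ N (R u v)
  u = M zero
  v = M (suc zero)
  w : Fin N → ℤ
  w c = u c ℤ.+ 1ℤ ℤ.* v c
  R-uv : ∀ r c → M r c ≡ R u v r c
  R-uv zero          c = refl
  R-uv (suc zero)    c = refl
  R-uv (suc (suc r)) c = refl
  pad : ∀ z → z ≡ 0ℤ ℤ.+ 1ℤ ℤ.* z ℤ.+ 1ℤ ℤ.* (0ℤ ℤ.+ 1ℤ ℤ.* 0ℤ)
  pad = solve-∀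
  diag : ∀ y → g y y ≡ 0ℤ
  diag y = det-equal-rows₀₁ n {R y y} (λ c → refl)
  g-vu : g v u ≡ 0ℤ
  g-vu = det-equal-rows-suc (suc n) ih zero (suc b) {R v u} (λ ()) eq
  addʳ : ∀ y → g y w ≡ g y u ℤ.+ 1ℤ ℤ.* g y v
  addʳ y = det-row-linear N (suc zero) 1ℤ {R y w} {R y u} {R y v} (λ c → refl) (other u) (other v)
    where
    other : ∀ z r c → r ≢ suc zero → R y w r c ≡ R y z r c
    other z zero          c _   = refl
    other z (suc zero)    c r≢1 = ⊥-elim (r≢1 refl)
    other z (suc (suc r)) c _   = refl
  addˡ : ∀ y → g w y ≡ g u y ℤ.+ 1ℤ ℤ.* g v y
  addˡ y = det-row-linear N zero 1ℤ {R w y} {R u y} {R v y} (λ c → refl) (other u) (other v)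
    where
    other : ∀ z r c → r ≢ zero → R w y r c ≡ R z y r c
    other z zero          c r≢0 = ⊥-elim (r≢0 refl)
    other z (suc zero)    c _   = refl
    other z (suc (suc r)) c _   = refl

det-equal-rows : ∀ n → EqualRowsVanish n
det-equal-rows (suc n) zero    zero    a≢b eq = ⊥-elim (a≢b refl)
det-equal-rows (suc n) zero    (suc b) {M} a≢b eq = det-equal-rows₀ n (det-equal-rows n) b {M} eq
det-equal-rows (suc n) (suc a) zero    {M} a≢b eq = det-equal-rows₀ n (det-equal-rows n) a {M} (sym ∘ eq)
det-equal-rows (suc n) (suc a) (suc b) {M} a≢b eq =
  det-equal-rows-suc n (det-equal-rows n) a b {M} (a≢b ∘ cong suc) eq

det-add-row : ∀ n (a b : Fin n) k {M M′ : Matrix n} → a ≢ b →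
  (∀ c → M′ a c ≡ M a c ℤ.+ k ℤ.* M b c) → (∀ r c → r ≢ a → M′ r c ≡ M r c) →
  detℤ n M′ ≡ detℤ n M
det-add-row n a b k {M} {M′} a≢b row eq =
  trans (det-row-linear n a k {M′} {M} {M″} row₁ eq eq₁)
        (trans (cong (λ z → detℤ n M ℤ.+ k ℤ.* z) (det-equal-rows n a b {M″} a≢b rows)) (absorb _ k))
  where
  M″ : Matrix n
  M″ r c = if ⌊ r ≟ a ⌋ then M b c else M r c
  at-a : ∀ c → M″ a c ≡ M b c
  at-a c = if-yes (a ≟ a) refl
  off-a : ∀ r c → r ≢ a → M″ r c ≡ M r c
  off-a r c r≢a = if-no (r ≟ a) r≢a
  rows : ∀ c → M″ a c ≡ M″ b c
  rows c = trans (at-a c) (sym (off-a b c (a≢b ∘ sym)))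
  row₁ : ∀ c → M′ a c ≡ M a c ℤ.+ k ℤ.* M″ a c
  row₁ c = trans (row c) (cong (λ z → M a c ℤ.+ k ℤ.* z) (sym (at-a c)))
  eq₁ : ∀ r c → r ≢ a → M′ r c ≡ M″ r c
  eq₁ r c r≢a = trans (eq r c r≢a) (sym (off-a r c r≢a))
  absorb : ∀ z k → z ℤ.+ k ℤ.* 0ℤ ≡ z
  absorb = solve-∀

det-add-column : ∀ n (a b : Fin n) k {M M′ : Matrix n} → a ≢ b →
  (∀ r → M′ r a ≡ M r a ℤ.+ k ℤ.* M r b) → (∀ r c → c ≢ a → M′ r c ≡ M r c) →
  detℤ n M′ ≡ detℤ n M
det-add-column n a b k {M} {M′} a≢b column eq =
  trans (sym (det-transpose n M′))
        (trans (det-add-row n a b k {flip M} {flip M′} a≢b column (λ c r → eq r c)) (det-transpose n M))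

-- The difference of the two matrices, in column a only, has a zero row.
det-clear-column : ∀ n (a : Fin n) {M M′ : Matrix n} →
  (∀ c → c ≢ a → M a c ≡ 0ℤ) → M a a ≡ M′ a a → (∀ r c → c ≢ a → M r c ≡ M′ r c) →
  detℤ n M ≡ detℤ n M′
det-clear-column n a {M} {M′} row aa eq =
  trans (sym (det-transpose n M))
    (trans (det-row-linear n a 1ℤ {flip M} {flip M′} {flip D} column (λ c r → eq r c) (λ c r → off r c))
      (trans (cong₂ (λ x y → x ℤ.+ 1ℤ ℤ.* y) (det-transpose n M′)
                    (trans (det-transpose n D) (det-zero-row n a {D} zero-row)))
             (absorb _)))
  where
  D : Matrix n
  D r c = if ⌊ c ≟ a ⌋ then M r c ℤ.- M′ r c else M r c
  on : ∀ r → D r a ≡ M r a ℤ.- M′ r a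
  on r = if-yes (a ≟ a) refl
  off : ∀ r c → c ≢ a → M r c ≡ D r c
  off r c c≢a = sym (if-no (c ≟ a) c≢a)
  column : ∀ r → M r a ≡ M′ r a ℤ.+ 1ℤ ℤ.* D r a
  column r rewrite on r = split (M r a) (M′ r a)
    where
    split : ∀ x y → x ≡ y ℤ.+ 1ℤ ℤ.* (x ℤ.- y)
    split = solve-∀
  zero-row : ∀ c → D a c ≡ 0ℤ
  zero-row c with c ≟ a
  ... | yes refl rewrite aa = ℤₚ.+-inverseʳ (M′ a a)
  ... | no c≢a = row c c≢a
  absorb : ∀ z → z ℤ.+ 1ℤ ℤ.* 0ℤ ≡ z
  absorb = solve-∀

δ : ∀ {n} → Matrix n
δ i j = if ⌊ i ≟ j ⌋ then 1ℤ else 0ℤ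

δ-suc : ∀ {n} (i j : Fin n) → δ (suc i) (suc j) ≡ δ i j
δ-suc i j with i ≟ j
... | yes _ = refl
... | no _ = refl

det-identity : ∀ n → detℤ n δ ≡ 1ℤ
det-identity zero    = refl
det-identity (suc n) = trans (∑-suc _) (cong₂ (λ x y → 1ℤ ℤ.* (1ℤ ℤ.* x) ℤ.+ y)
  (trans (det-cong n δ-suc) (det-identity n))
  (∑-zero λ j → ℤₚ.*-zeroʳ (ℤ.- sgn j)))

-- Quotients of a matrix by a partition of the indices

opaque
  ∑ₙ : ∀ {n} → (Fin n → ℕ) → ℕ
  ∑ₙ = Sumℕ.sum

  ∑ₙ-empty : ∀ (f : Fin 0 → ℕ) → ∑ₙ f ≡ 0
  ∑ₙ-empty f = refl

  ∑ₙ-suc : ∀ {n} (f : Fin (suc n) → ℕ) → ∑ₙ f ≡ f zero ℕ.+ ∑ₙ (f ∘ suc)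
  ∑ₙ-suc f = refl

  ∑ₙ-cong : ∀ {n} {f g : Fin n → ℕ} → (∀ i → f i ≡ g i) → ∑ₙ f ≡ ∑ₙ g
  ∑ₙ-cong = Sumℕ.sum-cong-≗

  ∑ₙ-+ : ∀ {n} (f g : Fin n → ℕ) → ∑ₙ (λ i → f i ℕ.+ g i) ≡ ∑ₙ f ℕ.+ ∑ₙ g
  ∑ₙ-+ = Sumℕ.∑-distrib-+

  ∑ₙ-swap : ∀ {m n} (f : Fin m → Fin n → ℕ) → ∑ₙ (λ i → ∑ₙ (λ j → f i j)) ≡ ∑ₙ (λ j → ∑ₙ (λ i → f i j))
  ∑ₙ-swap = Sumℕ.∑-comm

  ∑ₙ-*ˡ : ∀ {n} k (f : Fin n → ℕ) → k ℕ.* ∑ₙ f ≡ ∑ₙ (λ i → k ℕ.* f i)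
  ∑ₙ-*ˡ = Sumℕ.*-distribˡ-sum

  ∑ₙ-*ʳ : ∀ {n} k (f : Fin n → ℕ) → ∑ₙ f ℕ.* k ≡ ∑ₙ (λ i → f i ℕ.* k)
  ∑ₙ-*ʳ = Sumℕ.*-distribʳ-sum

𝟙 : ∀ {p} {P : Set p} → Dec P → ℕ
𝟙 d = b2ℕ ⌊ d ⌋

δ-refl : ∀ {n} (i : Fin n) → δ i i ≡ 1ℤ
δ-refl i = if-yes (i ≟ i) refl

δ-≢ : ∀ {n} {i j : Fin n} → i ≢ j → δ i j ≡ 0ℤ
δ-≢ {i = i} {j} i≢j = if-no (i ≟ j) i≢j

∑-δ : ∀ {n} (a : Fin n) (f : Fin n → ℤ) → ∑ (λ c → δ a c ℤ.* f c) ≡ f a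
∑-δ zero f = trans (∑-suc _) (trans (cong₂ ℤ._+_ (ℤₚ.*-identityˡ (f zero)) (∑-zero λ i → ℤₚ.*-zeroˡ (f (suc i)))) (ℤₚ.+-identityʳ _))
∑-δ (suc a) f = trans (∑-suc _) (trans (cong₂ ℤ._+_ (ℤₚ.*-zeroˡ (f zero))
  (trans (∑-cong λ i → cong (ℤ._* f (suc i)) (δ-suc a i)) (∑-δ a (f ∘ suc)))) (ℤₚ.+-identityˡ _))

∑-neg : ∀ {n} (f : Fin n → ℤ) → ∑ (λ i → ℤ.- f i) ≡ ℤ.- ∑ f
∑-neg f = trans (∑-cong λ i → sym (ℤₚ.-1*i≡-i (f i))) (trans (sym (∑-*ˡ -1ℤ f)) (ℤₚ.-1*i≡-i (∑ f)))

∑-- : ∀ {n} (f g : Fin n → ℤ) → ∑ (λ i → f i ℤ.- g i) ≡ ∑ f ℤ.- ∑ g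
∑-- f g = trans (∑-+ f (λ i → ℤ.- g i)) (cong (ℤ._+_ (∑ f)) (∑-neg g))

-- A family of disjoint blocks of vertices is given by the idempotent map o
-- sending a vertex to the representative of its block. In the matrix
-- `quotient M o` the columns of each block are added up and only the rows of
-- representatives are kept; all other rows are those of the identity.
collapse : ∀ {N} → Matrix N → (Fin N → Fin N) → Matrix N
collapse M o r c = ∑ λ u → δ (o u) c ℤ.* M r u

quotient : ∀ {N} → Matrix N → (Fin N → Fin N) → Matrix N
quotient M o r c = if ⌊ o r ≟ r ⌋ then collapse M o r c else δ r c

collapse-cong : ∀ {N} {M : Matrix N} {o o′ : Fin N → Fin N} r c →
  (∀ u → δ (o u) c ≡ δ (o′ u) c) → collapse M o r c ≡ collapse M o′ r c
collapse-cong {M = M} r c eq = ∑-cong λ u → cong (ℤ._* M r u) (eq u)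

quotient-cong : ∀ {N} {M : Matrix N} {o o′ : Fin N → Fin N} → (∀ u → o u ≡ o′ u) →
  ∀ r c → quotient M o r c ≡ quotient M o′ r c
quotient-cong {M = M} {o} {o′} eq r c =
  cong₂ (λ v z → if ⌊ v ≟ r ⌋ then z else δ r c) (eq r) (collapse-cong {M = M} {o} {o′} r c (λ u → cong (λ v → δ v c) (eq u)))

quotient-id : ∀ {N} (M : Matrix N) r c → quotient M id r c ≡ M r c
quotient-id M r c = trans (if-yes (r ≟ r) refl)
  (trans (∑-cong λ u → cong (ℤ._* M r u) (δ-sym u c)) (∑-δ c (M r)))
  where
  δ-sym : ∀ i j → δ i j ≡ δ j i
  δ-sym i j with i ≟ j
  ... | yes refl = sym (δ-refl i)
  ... | no i≢j = sym (δ-≢ (i≢j ∘ sym))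

-- Subtracting row `B` from row `A` leaves k(e_A - e_B). Adding column `A` to column `B` turns this
-- into k e_A and makes column `B` the sum over the merged block in the other rows. Then column `A`
-- can be cleared and `k` taken out of row `A`, which leaves an identity row.
det-merge : ∀ {N} (M : Matrix N) (o o′ : Fin N → Fin N) (A B : Fin N) k →
  A ≢ B → o A ≡ A → o B ≡ B →
  (∀ u → o u ≡ A → o′ u ≡ B) → (∀ u → o u ≢ A → o′ u ≡ o u) →
  (∀ c → collapse M o A c ℤ.- collapse M o B c ≡ k ℤ.* (δ A c ℤ.- δ B c)) →
  detℤ N (quotient M o) ≡ k ℤ.* detℤ N (quotient M o′)
det-merge {N} M o o′ A B k A≢B oA oB moved fixed rows = begin
  detℤ N T  ≡⟨ det-add-row N A B -1ℤ {T} {T₁} A≢B row₁ (λ r c r≢A → if-no (r ≟ A) r≢A) ⟨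
  detℤ N T₁ ≡⟨ det-add-column N B A 1ℤ {T₁} {T₂} (A≢B ∘ sym) (λ r → if-yes (B ≟ B) refl) (λ r c c≢B → if-no (c ≟ B) c≢B) ⟨
  detℤ N T₂ ≡⟨ det-clear-column N A {T₂} {T₃} row₂ T₂AA T₂≡T₃ ⟩
  detℤ N T₃ ≡⟨ det-scale-row N A k {T₃} {T₄} row₃ T₃≡T₄ ⟩
  k ℤ.* detℤ N T₄ ∎
  where
  open ≡-Reasoning
  T = quotient M o
  T₄ = quotient M o′
  T₁ : Matrix N
  T₁ r c = if ⌊ r ≟ A ⌋ then k ℤ.* (δ A c ℤ.- δ B c) else T r c
  T₂ : Matrix N
  T₂ r c = if ⌊ c ≟ B ⌋ then T₁ r B ℤ.+ 1ℤ ℤ.* T₁ r A else T₁ r c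
  T₃ : Matrix N
  T₃ r c = if ⌊ r ≟ A ⌋ then k ℤ.* δ A c else (if ⌊ c ≟ A ⌋ then 0ℤ else T₂ r c)

  T₁A : ∀ c → T₁ A c ≡ k ℤ.* (δ A c ℤ.- δ B c)
  T₁A c = if-yes (A ≟ A) refl
  row₁ : ∀ c → T₁ A c ≡ T A c ℤ.+ -1ℤ ℤ.* T B c
  row₁ c = trans (T₁A c) (trans (sym (rows c))
    (trans (cong₂ ℤ._-_ (sym (if-yes (o A ≟ A) oA)) (sym (if-yes (o B ≟ B) oB))) (minus (T A c) (T B c))))
    where
    minus : ∀ x y → x ℤ.- y ≡ x ℤ.+ -1ℤ ℤ.* y
    minus = solve-∀
  row₂ : ∀ c → c ≢ A → T₂ A c ≡ 0ℤ
  row₂ c c≢A with c ≟ B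
  ... | yes refl rewrite T₁A B | T₁A A | δ-refl A | δ-refl B | δ-≢ A≢B | δ-≢ (A≢B ∘ sym) = cancel k
    where
    cancel : ∀ k → k ℤ.* (0ℤ ℤ.- 1ℤ) ℤ.+ 1ℤ ℤ.* (k ℤ.* (1ℤ ℤ.- 0ℤ)) ≡ 0ℤ
    cancel = solve-∀
  ... | no c≢B rewrite T₁A c | δ-≢ (c≢A ∘ sym) | δ-≢ (c≢B ∘ sym) = ℤₚ.*-zeroʳ k
  T₂AA : T₂ A A ≡ T₃ A A
  T₂AA = trans (if-no (A ≟ B) A≢B) (trans (T₁A A) (trans
    (cong (k ℤ.*_) (trans (cong (ℤ._-_ (δ A A)) (δ-≢ (A≢B ∘ sym))) (ℤₚ.+-identityʳ (δ A A)))) (sym (if-yes (A ≟ A) refl))))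
  T₂≡T₃ : ∀ r c → c ≢ A → T₂ r c ≡ T₃ r c
  T₂≡T₃ r c c≢A = by-row (r ≟ A)
    where
    by-row : Dec (r ≡ A) → T₂ r c ≡ T₃ r c
    by-row (yes refl) = trans (row₂ c c≢A) (sym (trans (if-yes (A ≟ A) refl)
      (trans (cong (k ℤ.*_) (δ-≢ (c≢A ∘ sym))) (ℤₚ.*-zeroʳ k))))
    by-row (no r≢A) = sym (trans (if-no (r ≟ A) r≢A) (if-no (c ≟ A) c≢A))
  row₃ : ∀ c → T₃ A c ≡ k ℤ.* T₄ A c
  row₃ c = trans (if-yes (A ≟ A) refl) (cong (k ℤ.*_) (sym (if-no (o′ A ≟ A) λ o′A → A≢B (trans (sym o′A) (moved A oA)))))

  o′≢A : ∀ u → o′ u ≢ A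
  o′≢A u o′u with o u ≟ A
  ... | yes ou = A≢B (trans (sym o′u) (moved u ou))
  ... | no ou = ou (trans (sym (fixed u ou)) o′u)
  alive : ∀ {r} → r ≢ A → o r ≡ r → o′ r ≡ r
  alive r≢A or = trans (fixed _ (λ e → r≢A (trans (sym or) e))) or
  dead : ∀ {r} → o r ≢ r → o′ r ≢ r
  dead {r} or o′r with o r ≟ A
  ... | yes e = or (subst (λ v → o v ≡ v) (trans (sym (moved r e)) o′r) oB)
  ... | no e = or (trans (sym (fixed r e)) o′r)
  δ-B : ∀ u → δ (o u) B ℤ.+ δ (o u) A ≡ δ (o′ u) B
  δ-B u with o u ≟ A
  ... | yes e rewrite e | moved u e | δ-≢ A≢B | δ-refl B = refl
  ... | no e rewrite fixed u e = ℤₚ.+-identityʳ _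
  δ-other : ∀ c → c ≢ A → c ≢ B → ∀ u → δ (o u) c ≡ δ (o′ u) c
  δ-other c c≢A c≢B u with o u ≟ A
  ... | yes e rewrite e | moved u e | δ-≢ (c≢A ∘ sym) | δ-≢ (c≢B ∘ sym) = refl
  ... | no e rewrite fixed u e = refl
  collapse-B : ∀ r → collapse M o r B ℤ.+ collapse M o r A ≡ collapse M o′ r B
  collapse-B r = trans (sym (∑-+ _ _)) (∑-cong λ u →
    trans (sym (ℤₚ.*-distribʳ-+ (M r u) (δ (o u) B) (δ (o u) A))) (cong (ℤ._* M r u) (δ-B u)))
  TB : ∀ r → r ≢ A → T r B ℤ.+ T r A ≡ T₄ r B
  TB r r≢A with o r ≟ r
  ... | yes or = trans (collapse-B r) (sym (if-yes (o′ r ≟ r) (alive r≢A or)))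
  ... | no or = trans (cong (ℤ._+_ (δ r B)) (δ-≢ r≢A)) (trans (ℤₚ.+-identityʳ _) (sym (if-no (o′ r ≟ r) (dead or))))
  Tc : ∀ r c → r ≢ A → c ≢ A → c ≢ B → T r c ≡ T₄ r c
  Tc r c r≢A c≢A c≢B with o r ≟ r
  ... | yes or = trans (collapse-cong {M = M} {o} {o′} r c (δ-other c c≢A c≢B)) (sym (if-yes (o′ r ≟ r) (alive r≢A or)))
  ... | no or = sym (if-no (o′ r ≟ r) (dead or))
  TA : ∀ r → r ≢ A → 0ℤ ≡ T₄ r A
  TA r r≢A with o′ r ≟ r
  ... | yes _ = sym (∑-zero λ u → trans (cong (ℤ._* M r u) (δ-≢ (o′≢A u))) (ℤₚ.*-zeroˡ (M r u)))
  ... | no _ = sym (δ-≢ r≢A)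
  T₃≡T₄ : ∀ r c → r ≢ A → T₃ r c ≡ T₄ r c
  T₃≡T₄ r c r≢A = trans (if-no (r ≟ A) r≢A) (inner c)
    where
    T₁r : ∀ c → T₁ r c ≡ T r c
    T₁r c = if-no (r ≟ A) r≢A
    inner : ∀ c → (if ⌊ c ≟ A ⌋ then 0ℤ else T₂ r c) ≡ T₄ r c
    inner c with c ≟ A
    ... | yes refl = TA r r≢A
    ... | no c≢A with c ≟ B
    ...   | yes refl = trans (cong₂ (λ x y → x ℤ.+ y) (T₁r B) (trans (ℤₚ.*-identityˡ (T₁ r A)) (T₁r A))) (TB r r≢A)
    ...   | no c≢B = trans (T₁r c) (Tc r c r≢A c≢A c≢B)

-- Only the rows of the two representatives are compared, since `quotient` retains no other row of
-- their blocks.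
record Mergeable {N} (M : Matrix N) (o : Fin N → Fin N) (k : ℤ) (A B : Fin N) : Set where
  field
    agree : ∀ u → o u ≢ A → o u ≢ B → M A u ≡ M B u
    gap   : ∑ (λ u → δ (o u) A ℤ.* (M A u ℤ.- M B u)) ≡ k

-- The entry in column B follows from those in the other columns, because
-- both rows have the same sum.
collapse-rows : ∀ {N} (M : Matrix N) x → (∀ r → ∑ (M r) ≡ x) → ∀ (o : Fin N → Fin N) k A B →
  A ≢ B → Mergeable M o k A B →
  ∀ c → collapse M o A c ℤ.- collapse M o B c ≡ k ℤ.* (δ A c ℤ.- δ B c)
collapse-rows {N} M x sums o k A B A≢B mergeable = conclusion
  where
  open Mergeable mergeable
  D : Fin N → ℤ
  D u = M A u ℤ.- M B u
  E : Fin N → ℤ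
  E c = ∑ λ u → δ (o u) c ℤ.* D u
  E≡ : ∀ c → collapse M o A c ℤ.- collapse M o B c ≡ E c
  E≡ c = trans (sym (∑-- _ _)) (∑-cong λ u → factor (δ (o u) c) (M A u) (M B u))
    where
    factor : ∀ d x y → d ℤ.* x ℤ.- d ℤ.* y ≡ d ℤ.* (x ℤ.- y)
    factor = solve-∀
  E-other : ∀ c → c ≢ A → c ≢ B → E c ≡ 0ℤ
  E-other c c≢A c≢B = ∑-zero term
    where
    term : ∀ u → δ (o u) c ℤ.* D u ≡ 0ℤ
    term u with o u ≟ c
    ... | yes e rewrite agree u (λ e′ → c≢A (trans (sym e) e′)) (λ e′ → c≢B (trans (sym e) e′)) =
      trans (ℤₚ.*-identityˡ _) (ℤₚ.+-inverseʳ (M B u))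
    ... | no _ = ℤₚ.*-zeroˡ (D u)
  E-total : ∑ E ≡ 0ℤ
  E-total = trans (∑-swap (λ c u → δ (o u) c ℤ.* D u))
    (trans (∑-cong λ u → ∑-δ (o u) (λ _ → D u))
      (trans (∑-- (M A) (M B)) (trans (cong₂ ℤ._-_ (sums A) (sums B)) (ℤₚ.+-inverseʳ x))))
  E-split : ∀ c → E c ≡ δ A c ℤ.* E c ℤ.+ δ B c ℤ.* E c
  E-split c with A ≟ c | B ≟ c
  ... | yes refl | yes refl = ⊥-elim (A≢B refl)
  ... | yes refl | no _     = sym (left (E c))
    where
    left : ∀ z → 1ℤ ℤ.* z ℤ.+ 0ℤ ℤ.* z ≡ z
    left = solve-∀
  ... | no _     | yes refl = sym (right (E c))
    where
    right : ∀ z → 0ℤ ℤ.* z ℤ.+ 1ℤ ℤ.* z ≡ z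
    right = solve-∀
  ... | no A≢c   | no B≢c   = trans (E-other c (A≢c ∘ sym) (B≢c ∘ sym)) (sym (none (E c)))
    where
    none : ∀ z → 0ℤ ℤ.* z ℤ.+ 0ℤ ℤ.* z ≡ 0ℤ
    none = solve-∀
  E-AB : E A ℤ.+ E B ≡ 0ℤ
  E-AB = trans (sym (cong₂ ℤ._+_ (∑-δ A E) (∑-δ B E)))
    (trans (sym (∑-+ _ _)) (trans (∑-cong λ c → sym (E-split c)) E-total))
  E-B : E B ≡ ℤ.- k
  E-B = trans (isolate (E A) (E B)) (trans (cong₂ ℤ._-_ E-AB gap) (ℤₚ.+-identityˡ (ℤ.- k)))
    where
    isolate : ∀ a b → b ≡ (a ℤ.+ b) ℤ.- a
    isolate = solve-∀
  conclusion : ∀ c → collapse M o A c ℤ.- collapse M o B c ≡ k ℤ.* (δ A c ℤ.- δ B c)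
  conclusion c with A ≟ c | B ≟ c
  ... | yes refl | yes refl = ⊥-elim (A≢B refl)
  ... | yes refl | no _     = trans (E≡ A) (trans gap (sym (ℤₚ.*-identityʳ k)))
  ... | no _     | yes refl = trans (E≡ B) (trans E-B (neg k))
    where
    neg : ∀ k → ℤ.- k ≡ k ℤ.* (0ℤ ℤ.- 1ℤ)
    neg = solve-∀
  ... | no A≢c   | no B≢c   = trans (E≡ c) (trans (E-other c (A≢c ∘ sym) (B≢c ∘ sym)) (sym (ℤₚ.*-zeroʳ k)))

moved? : ∀ {N} (o t : Fin N → Fin N) v → Dec (o v ≡ v × t v ≢ v)
moved? o t v = (o v ≟ v) ×-dec ¬? (t v ≟ v)

-- A stage carries out all merges of `A` into `t A`, each with the same factor. They can be done one
-- by one: targets are never moved themselves, and the block of a pending `A` does not change, so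
-- `mergeable`, stated for the initial partition, persists.
module Stage {N} (M : Matrix N) (x : ℤ) (sums : ∀ r → ∑ (M r) ≡ x)
  (o t : Fin N → Fin N) (k : ℤ)
  (o-idem : ∀ u → o (o u) ≡ o u)
  (t-alive : ∀ v → o v ≡ v → o (t v) ≡ t v)
  (t-idem : ∀ v → o v ≡ v → t (t v) ≡ t v)
  (mergeable : ∀ A → o A ≡ A → t A ≢ A → Mergeable M o k A (t A)) where

  -- The merges of the stage carried out for the vertices in the image of f.
  partial : ∀ {n} → (Fin n → Fin N) → Fin N → Fin N
  partial f v = if ⌊ any? (λ i → f i ≟ v) ⌋ then t v else v

  -- The induction is over an injective enumeration whose head is treated last; injectivity ensures
  -- that the head has not been moved before (`partial-A`).
  det-partial : ∀ n (f : Fin n → Fin N) → (∀ {i j} → f i ≡ f j → i ≡ j) →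
    detℤ N (quotient M o) ≡ k ℤ.^ ∑ₙ (λ i → 𝟙 (moved? o t (f i))) ℤ.* detℤ N (quotient M (partial f ∘ o))
  det-partial zero f inj = trans (sym (ℤₚ.*-identityˡ _))
    (cong (λ e → k ℤ.^ e ℤ.* detℤ N (quotient M o)) (sym (∑ₙ-empty _)))
  det-partial (suc n) f inj = trans (det-partial n f′ (suc-injective ∘ inj))
    (trans (step (moved? o t A))
      (cong (λ e → k ℤ.^ e ℤ.* detℤ N (quotient M o″)) (sym (∑ₙ-suc (λ i → 𝟙 (moved? o t (f i)))))))
    where
    f′ : Fin n → Fin N
    f′ = f ∘ suc
    A = f zero
    o′ o″ : Fin N → Fin N
    o′ = partial f′ ∘ o
    o″ = partial f ∘ o
    e = ∑ₙ λ i → 𝟙 (moved? o t (f′ i))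
    partial-A : partial f′ A ≡ A
    partial-A = if-no (any? (λ i → f′ i ≟ A)) λ { (i , fi) → 0≢1+n (sym (inj fi)) }
    partial-fixed : ∀ {v} → t v ≡ v → partial f′ v ≡ v
    partial-fixed {v} tv with any? (λ i → f′ i ≟ v)
    ... | yes _ = tv
    ... | no _ = refl
    partial-≢ : ∀ v → v ≢ A → partial f v ≡ partial f′ v
    partial-≢ v v≢A = by-cases (any? (λ i → f′ i ≟ v))
      where
      by-cases : Dec (∃ λ i → f′ i ≡ v) → partial f v ≡ partial f′ v
      by-cases (yes (i , fi)) = trans (if-yes (any? (λ i → f i ≟ v)) (suc i , fi))
        (sym (if-yes (any? (λ i → f′ i ≟ v)) (i , fi)))
      by-cases (no ¬f′) = trans (if-no (any? (λ i → f i ≟ v))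
          λ { (zero , fi) → v≢A (sym fi) ; (suc i , fi) → ¬f′ (i , fi) })
        (sym (if-no (any? (λ i → f′ i ≟ v)) ¬f′))
    step : (d : Dec (o A ≡ A × t A ≢ A)) →
      k ℤ.^ e ℤ.* detℤ N (quotient M o′) ≡ k ℤ.^ (𝟙 d ℕ.+ e) ℤ.* detℤ N (quotient M o″)
    step (no stay) = cong (k ℤ.^ e ℤ.*_) (det-cong N (quotient-cong {M = M} same))
      where
      same : ∀ u → o′ u ≡ o″ u
      same u with o u ≟ A
      ... | no ou = sym (partial-≢ (o u) ou)
      ... | yes ou with t A ≟ A
      ...   | no tA = ⊥-elim (stay (trans (cong o (sym ou)) (trans (o-idem u) ou) , tA))
      ...   | yes tA rewrite ou = trans partial-A (sym (trans (if-yes (any? (λ i → f i ≟ A)) (zero , refl)) tA))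
    step (yes (oA , tA)) =
      trans (cong (k ℤ.^ e ℤ.*_)
               (det-merge M o′ o″ A (t A) k (tA ∘ sym) o′A o′tA moved fixed
                 (collapse-rows M x sums o′ k A (t A) (tA ∘ sym) mergeable′)))
            (shuffle k (k ℤ.^ e) _)
      where
      shuffle : ∀ k p z → p ℤ.* (k ℤ.* z) ≡ k ℤ.* p ℤ.* z
      shuffle = solve-∀
      from-A : ∀ u → o u ≡ A → o′ u ≡ A
      from-A u ou = trans (cong (partial f′) ou) partial-A
      to-A : ∀ u → o′ u ≡ A → o u ≡ A
      to-A u o′u with any? (λ i → f′ i ≟ o u)
      -- Had `o u` been moved onto `A`, then `A` would lie in the image of `t` and be fixed by it.
      ... | yes _ = ⊥-elim (tA (trans (cong t (sym o′u)) (trans (t-idem (o u) (o-idem u)) o′u)))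
      ... | no _ = o′u
      o′A = from-A A oA
      o′tA : o′ (t A) ≡ t A
      o′tA = trans (cong (partial f′) (t-alive A oA)) (partial-fixed (t-idem A oA))
      moved : ∀ u → o′ u ≡ A → o″ u ≡ t A
      moved u o′u rewrite to-A u o′u = if-yes (any? (λ i → f i ≟ A)) (zero , refl)
      fixed : ∀ u → o′ u ≢ A → o″ u ≡ o′ u
      fixed u o′u = partial-≢ (o u) (o′u ∘ from-A u)
      open Mergeable (mergeable A oA tA)
      mergeable′ : Mergeable M o′ k A (t A)
      mergeable′ = record
        { agree = λ u ¬A ¬B → agree u (¬A ∘ from-A u)
                    (λ ou → ¬B (trans (cong (partial f′) ou) (partial-fixed (t-idem A oA))))
        ; gap = trans (∑-cong λ u → cong (ℤ._* (M A u ℤ.- M (t A) u)) (δ-A u)) gap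
        }
        where
        δ-A : ∀ u → δ (o′ u) A ≡ δ (o u) A
        δ-A u with o u ≟ A
        ... | yes ou = trans (cong (λ v → δ v A) (from-A u ou)) (δ-refl A)
        ... | no ou = δ-≢ (ou ∘ to-A u)

  det-stage : ∀ (o′ : Fin N → Fin N) → (∀ u → t (o u) ≡ o′ u) →
    detℤ N (quotient M o) ≡ k ℤ.^ ∑ₙ (λ v → 𝟙 (moved? o t v)) ℤ.* detℤ N (quotient M o′)
  det-stage o′ eq = trans (det-partial N id id)
    (cong (k ℤ.^ ∑ₙ (λ v → 𝟙 (moved? o t v)) ℤ.*_) (det-cong N (quotient-cong {M = M}
      λ u → trans (if-yes (any? (λ i → i ≟ o u)) (o u , refl)) (eq u))))

det-quotient-const : ∀ {N} (M : Matrix N) x → (∀ r → ∑ (M r) ≡ x) → ∀ (o : Fin N → Fin N) g → (∀ u → o u ≡ g) →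
  detℤ N (quotient M o) ≡ x
det-quotient-const {N} M x sums o g og =
  trans (det-scale-row N g x {quotient M o} {δ} row rest) (trans (cong (x ℤ.*_) (det-identity N)) (ℤₚ.*-identityʳ x))
  where
  row : ∀ c → quotient M o g c ≡ x ℤ.* δ g c
  row c = trans (if-yes (o g ≟ g) (og g))
    (trans (∑-cong λ u → cong (λ v → δ v c ℤ.* M g u) (og u))
      (trans (sym (∑-*ˡ (δ g c) (M g))) (trans (cong (δ g c ℤ.*_) (sums g)) (ℤₚ.*-comm (δ g c) x))))
  rest : ∀ r c → r ≢ g → quotient M o r c ≡ δ r c
  rest r c r≢g = if-no (o r ≟ r) (λ or → r≢g (trans (sym or) (og r)))

-- Tree-like preorders

𝟙-yes : ∀ {p} {P : Set p} (d : Dec P) → P → 𝟙 d ≡ 1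
𝟙-yes (yes _) p = refl
𝟙-yes (no ¬p) p = ⊥-elim (¬p p)

𝟙-no : ∀ {p} {P : Set p} (d : Dec P) → ¬ P → 𝟙 d ≡ 0
𝟙-no (yes p) ¬p = ⊥-elim (¬p p)
𝟙-no (no _)  ¬p = refl

𝟙-cong : ∀ {p q} {P : Set p} {Q : Set q} (d : Dec P) (e : Dec Q) → (P → Q) → (Q → P) → 𝟙 d ≡ 𝟙 e
𝟙-cong (yes p) e f g = sym (𝟙-yes e (f p))
𝟙-cong (no ¬p) e f g = sym (𝟙-no e (¬p ∘ g))

𝟙-⊎ : ∀ {p q r} {P : Set p} {Q : Set q} {R : Set r} (d : Dec P) (e : Dec Q) (f : Dec R) →
  (P → R) → (Q → R) → (R → P ⊎ Q) → (P → ¬ Q) → 𝟙 d ℕ.+ 𝟙 e ≡ 𝟙 f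
𝟙-⊎ (yes p) (yes q) f PR QR RPQ PQ = ⊥-elim (PQ p q)
𝟙-⊎ (yes p) (no ¬q) f PR QR RPQ PQ = sym (𝟙-yes f (PR p))
𝟙-⊎ (no ¬p) (yes q) f PR QR RPQ PQ = sym (𝟙-yes f (QR q))
𝟙-⊎ (no ¬p) (no ¬q) f PR QR RPQ PQ = sym (𝟙-no f ([ ¬p , ¬q ]′ ∘ RPQ))

𝟙-* : ∀ {p q} {P : Set p} {Q : Set q} (d : Dec P) (e : Dec Q) → 𝟙 d ℕ.* 𝟙 e ≡ 𝟙 (d ×-dec e)
𝟙-* (yes p) (yes q) = refl
𝟙-* (yes p) (no ¬q) = refl
𝟙-* (no ¬p) e       = sym (𝟙-no (no ¬p ×-dec e) (¬p ∘ proj₁))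

∑ₙ-zero : ∀ {n} {f : Fin n → ℕ} → (∀ i → f i ≡ 0) → ∑ₙ f ≡ 0
∑ₙ-zero {f = f} f≡0 = trans (∑ₙ-cong f≡0) (sym (∑ₙ-*ˡ 0 f))

∑ₙ-≟ : ∀ {n} (a : Fin n) → ∑ₙ (λ i → 𝟙 (a ≟ i)) ≡ 1
∑ₙ-≟ zero    = trans (∑ₙ-suc _) (cong suc (∑ₙ-zero λ i → refl))
∑ₙ-≟ (suc a) = trans (∑ₙ-suc _) (trans (∑ₙ-cong λ i → 𝟙-cong (suc a ≟ suc i) (a ≟ i) suc-injective (cong suc)) (∑ₙ-≟ a))

∑-cast : ∀ {n} (f : Fin n → ℕ) → ∑ (λ i → + f i) ≡ + ∑ₙ f
∑-cast {zero}  f = trans (∑-empty _) (cong +_ (sym (∑ₙ-empty f)))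
∑-cast {suc n} f = trans (∑-suc _) (trans (cong (ℤ._+_ (+ f zero)) (∑-cast (f ∘ suc)))
  (trans (sym (ℤₚ.pos-+ (f zero) (∑ₙ (f ∘ suc)))) (cong +_ (sym (∑ₙ-suc f)))))

Least : ∀ {n} → (Fin n → Set) → Fin n → Set
Least P i = P i × (∀ j → P j → toℕ i ≤ toℕ j)

least : ∀ {n} {P : Fin n → Set} → (∀ i → Dec (P i)) → ∃ P → ∃ (Least P)
least {suc n} P? (i , p) with P? zero
... | yes p₀ = zero , p₀ , λ _ _ → z≤n
least {suc n} P? (zero  , p) | no ¬p₀ = ⊥-elim (¬p₀ p)
least {suc n} {P} P? (suc i , p) | no ¬p₀ with least {P = P ∘ suc} (P? ∘ suc) (i , p)
... | j , q , minimal = suc j , q , λ { zero p → ⊥-elim (¬p₀ p) ; (suc k) p → s≤s (minimal k p) }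

-- In the application h ≼ g means that h is a power of g, lev g = i that g has
-- order p^i, and anc i g generates the subgroup of order p^i of ⟨g⟩.
record Tree (N m : ℕ) : Set₁ where
  field
    _≼_     : Fin N → Fin N → Set
    _≼?_    : ∀ h g → Dec (h ≼ g)
    lev     : Fin N → ℕ
    anc     : ℕ → Fin N → Fin N
    ≼-refl  : ∀ {g} → g ≼ g
    ≼-trans : ∀ {f g h} → f ≼ g → g ≼ h → f ≼ h
    ≼-lev   : ∀ {h g} → h ≼ g → lev h ≤ lev g
    ≼-chain : ∀ {g h h′} → h ≼ g → h′ ≼ g → lev h ≤ lev h′ → h ≼ h′
    lev≤m   : ∀ g → lev g ≤ m
    anc-≼   : ∀ i g → i ≤ lev g → anc i g ≼ g
    anc-lev : ∀ i g → i ≤ lev g → lev (anc i g) ≡ i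
    root    : ∀ {h} g → lev h ≡ 0 → h ≼ g
    top     : ∀ h → ∃ λ g → lev g ≡ m × h ≼ g

  Comparable : Fin N → Fin N → Set
  Comparable g h = g ≼ h ⊎ h ≼ g

  comparable? : ∀ g h → Dec (Comparable g h)
  comparable? g h = (g ≼? h) ⊎-dec (h ≼? g)

  SameClass : Fin N → Fin N → Set
  SameClass g h = h ≼ g × lev h ≡ lev g

  sameClass? : ∀ g h → Dec (SameClass g h)
  sameClass? g h = (h ≼? g) ×-dec (lev h ℕ.≟ lev g)

  -- Taking the least index makes the choice invariant on classes (`rep-cong`), which an arbitrary
  -- witness of `top` need not be.
  leaf : ∀ h → ∃ (Least (λ g → lev g ≡ m × h ≼ g))
  leaf h = least (λ g → (lev g ℕ.≟ m) ×-dec (h ≼? g)) (top h)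

  rep : Fin N → Fin N
  rep = proj₁ ∘ leaf

  rep-lev : ∀ h → lev (rep h) ≡ m
  rep-lev h = proj₁ (proj₁ (proj₂ (leaf h)))

  rep-≼ : ∀ h → h ≼ rep h
  rep-≼ h = proj₂ (proj₁ (proj₂ (leaf h)))

  rep-min : ∀ h g → lev g ≡ m → h ≼ g → toℕ (rep h) ≤ toℕ g
  rep-min h g lg hg = proj₂ (proj₂ (leaf h)) g (lg , hg)

  rep-cong : ∀ {h h′} → h ≼ h′ → h′ ≼ h → rep h ≡ rep h′
  rep-cong {h} {h′} p q = toℕ-injective (ℕₚ.≤-antisym
    (rep-min h (rep h′) (rep-lev h′) (≼-trans p (rep-≼ h′)))
    (rep-min h′ (rep h) (rep-lev h) (≼-trans q (rep-≼ h))))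

  -- Names the block of everything over the level-`i` class below `u`; used for `i` ≤ `lev u`.
  rp : ℕ → Fin N → Fin N
  rp i u = rep (anc i u)

  -- Both ancestors lie below `v` at the same level, so by `≼-chain` each lies below the other.
  rp-≼ : ∀ {i u v} → u ≼ v → i ≤ lev u → rp i u ≡ rp i v
  rp-≼ {i} {u} {v} uv iu = rep-cong
    (≼-chain below-u below-v (ℕₚ.≤-reflexive (trans lu (sym lv))))
    (≼-chain below-v below-u (ℕₚ.≤-reflexive (trans lv (sym lu))))
    where
    iv = ℕₚ.≤-trans iu (≼-lev uv)
    lu = anc-lev i u iu
    lv = anc-lev i v iv
    below-u = ≼-trans (anc-≼ i u iu) uv
    below-v = anc-≼ i v iv

  rp-comparable : ∀ {i u v} → Comparable u v → i ≤ lev u → i ≤ lev v → rp i u ≡ rp i v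
  rp-comparable (inj₁ uv) iu iv = rp-≼ uv iu
  rp-comparable (inj₂ vu) iu iv = sym (rp-≼ vu iv)

  rp-rp : ∀ {i j u} → i ≤ j → j ≤ lev u → rp i (rp j u) ≡ rp i u
  rp-rp {i} {j} {u} ij ju = trans (sym (rp-≼ (rep-≼ (anc j u)) i≤)) (rp-≼ (anc-≼ j u ju) i≤)
    where
    i≤ : i ≤ lev (anc j u)
    i≤ = subst (i ≤_) (sym (anc-lev j u ju)) ij

  rp-self : ∀ {i u} → lev u ≡ i → rp i u ≡ rep u
  rp-self {i} {u} refl = rep-cong (anc-≼ i u ℕₚ.≤-refl)
    (≼-chain ≼-refl (anc-≼ i u ℕₚ.≤-refl) (ℕₚ.≤-reflexive (sym (anc-lev i u ℕₚ.≤-refl))))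

  anc-mono : ∀ {i j} g → i ≤ j → j ≤ lev g → anc i g ≼ anc j g
  anc-mono {i} {j} g ij jg = ≼-chain (anc-≼ i g ig) (anc-≼ j g jg)
    (subst₂ _≤_ (sym (anc-lev i g ig)) (sym (anc-lev j g jg)) ij)
    where ig = ℕₚ.≤-trans ij jg

  Rep : ℕ → Fin N → Set
  Rep i g = lev g ≡ m × rp i g ≡ g

  Rep? : ∀ i g → Dec (Rep i g)
  Rep? i g = (lev g ℕ.≟ m) ×-dec (rp i g ≟ g)

  -- The leaves over the ancestor at level `j` are among those over the ancestor at level `i`; a
  -- member of the smaller set that is least in the larger one is least in the smaller.
  Rep-mono : ∀ {i j g} → i ≤ j → j ≤ m → Rep i g → Rep j g
  Rep-mono {i} {j} {g} ij jm (lg , e) = lg , toℕ-injective (ℕₚ.≤-antisym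
    (rep-min (anc j g) g lg (anc-≼ j g jg))
    (subst (λ v → toℕ v ≤ toℕ (rp j g)) e
      (rep-min (anc i g) (rp j g) (rep-lev (anc j g)) (≼-trans (anc-mono g ij jg) (rep-≼ (anc j g))))))
    where
    jg : j ≤ lev g
    jg = subst (j ≤_) (sym lg) jm

  Rep-rp : ∀ {i j u} → i ≤ j → j ≤ m → i ≤ lev u → Rep j (rp i u)
  Rep-rp {i} {u = u} ij jm iu = Rep-mono ij jm (rep-lev (anc i u) , rp-rp ℕₚ.≤-refl iu)

  level-size rep-size : ℕ → ℕ
  level-size i = ∑ₙ λ v → 𝟙 (lev v ℕ.≟ i)
  rep-size i = ∑ₙ λ v → 𝟙 (Rep? i v)

  -- Double counting of pairs of a representative and a member of its class: a vertex `u` of level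
  -- `i` is paired with `rep u` alone. Thus `rep-size i` is the number of classes of level `i`.
  rep-size-class : ∀ i ρ → i ≤ m →
    (∀ g → lev g ≡ i → ∑ₙ (λ h → 𝟙 (sameClass? g h)) ≡ ρ) → rep-size i ℕ.* ρ ≡ level-size i
  rep-size-class i ρ im class = begin
    rep-size i ℕ.* ρ
      ≡⟨ ∑ₙ-*ʳ ρ _ ⟩
    ∑ₙ (λ g → 𝟙 (Rep? i g) ℕ.* ρ)
      ≡⟨ ∑ₙ-cong fibre ⟩
    ∑ₙ (λ g → ∑ₙ λ u → 𝟙 (Rep? i g ×-dec sameClass? (anc i g) u))
      ≡⟨ ∑ₙ-swap _ ⟩
    ∑ₙ (λ u → ∑ₙ λ g → 𝟙 (Rep? i g ×-dec sameClass? (anc i g) u))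
      ≡⟨ ∑ₙ-cong unique ⟩
    level-size i ∎
    where
    open ≡-Reasoning
    i≤lev : ∀ {g} → Rep i g → i ≤ lev g
    i≤lev (lg , _) = subst (i ≤_) (sym lg) im
    fibre : ∀ g → 𝟙 (Rep? i g) ℕ.* ρ ≡ ∑ₙ λ u → 𝟙 (Rep? i g ×-dec sameClass? (anc i g) u)
    fibre g = by-cases (Rep? i g)
      where
      by-cases : (d : Dec (Rep i g)) → 𝟙 d ℕ.* ρ ≡ ∑ₙ λ u → 𝟙 (d ×-dec sameClass? (anc i g) u)
      by-cases (yes R) = trans (ℕₚ.*-identityˡ ρ) (trans (sym (class (anc i g) (anc-lev i g (i≤lev R))))
        (∑ₙ-cong λ u → sym (trans (sym (𝟙-* (yes R) (sameClass? (anc i g) u))) (ℕₚ.*-identityˡ _))))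
      by-cases (no ¬R) = sym (∑ₙ-zero λ u → 𝟙-no (no ¬R ×-dec sameClass? (anc i g) u) (¬R ∘ proj₁))
    unique : ∀ u → ∑ₙ (λ g → 𝟙 (Rep? i g ×-dec sameClass? (anc i g) u)) ≡ 𝟙 (lev u ℕ.≟ i)
    unique u = by-cases (lev u ℕ.≟ i)
      where
      by-cases : (d : Dec (lev u ≡ i)) → ∑ₙ (λ g → 𝟙 (Rep? i g ×-dec sameClass? (anc i g) u)) ≡ 𝟙 d
      by-cases (no lu≢i) = ∑ₙ-zero λ g → 𝟙-no (Rep? i g ×-dec sameClass? (anc i g) u)
        λ { (R , _ , e) → lu≢i (trans e (anc-lev i g (i≤lev R))) }
      by-cases (yes lu) = trans (∑ₙ-cong λ g →
          𝟙-cong (Rep? i g ×-dec sameClass? (anc i g) u) (rep u ≟ g) (to g) (from g)) (∑ₙ-≟ (rep u))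
        where
        to : ∀ g → Rep i g × SameClass (anc i g) u → rep u ≡ g
        to g (R , u≼ , e) = trans (rep-cong u≼ (≼-chain ≼-refl u≼ (ℕₚ.≤-reflexive (sym e)))) (proj₂ R)
        from : ∀ g → rep u ≡ g → Rep i g × SameClass (anc i g) u
        from .(rep u) refl = R , ≼-chain (rep-≼ u) (anc-≼ i (rep u) (i≤lev R)) (ℕₚ.≤-reflexive e) , e
          where
          R : Rep i (rep u)
          R = subst (Rep i) (rp-self lu) (Rep-rp ℕₚ.≤-refl im (ℕₚ.≤-reflexive (sym lu)))
          e : lev u ≡ lev (anc i (rep u))
          e = trans lu (sym (anc-lev i (rep u) (i≤lev R)))

  -- `κ` counts the element itself and so is the degree plus one; `β` is the size of a subgroup.
  -- Their dependence on the level alone is what gives all merges of a stage the same factor.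
  module Determinant (x : ℤ) (κ β : ℕ → ℕ)
    (comparable-count : ∀ g → ∑ₙ (λ h → 𝟙 (comparable? g h)) ≡ κ (lev g))
    (below-count : ∀ g → ∑ₙ (λ h → 𝟙 (h ≼? g)) ≡ β (lev g)) where

    -- With adjacency meaning comparability of distinct vertices this is x I − L.
    M : Matrix N
    M g h = δ g h ℤ.* (x ℤ.- + κ (lev g)) ℤ.+ + 𝟙 (comparable? g h)

    sums : ∀ g → ∑ (M g) ≡ x
    sums g = trans (∑-+ _ _) (trans (cong₂ ℤ._+_ (∑-δ g (λ _ → x ℤ.- + κ (lev g)))
        (trans (∑-cast _) (cong +_ (comparable-count g)))) (cancel x (+ κ (lev g))))
      where
      cancel : ∀ x k → x ℤ.- k ℤ.+ k ≡ x
      cancel = solve-∀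

    M-≢ : ∀ {g h} → g ≢ h → M g h ≡ + 𝟙 (comparable? g h)
    M-≢ {g} {h} g≢h = trans (cong (λ d → d ℤ.* (x ℤ.- + κ (lev g)) ℤ.+ + 𝟙 (comparable? g h)) (δ-≢ g≢h))
      (trans (cong (ℤ._+ + 𝟙 (comparable? g h)) (ℤₚ.*-zeroˡ (x ℤ.- + κ (lev g)))) (ℤₚ.+-identityˡ _))

    M-incomparable : ∀ {g h} → ¬ Comparable g h → M g h ≡ 0ℤ
    M-incomparable {g} {h} g≁h = trans (M-≢ λ { refl → g≁h (inj₁ ≼-refl) }) (cong +_ (𝟙-no (comparable? g h) g≁h))

    M-agree : ∀ {g g′ h} → g ≢ h → g′ ≢ h → (Comparable g h → Comparable g′ h) → (Comparable g′ h → Comparable g h) →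
      M g h ≡ M g′ h
    M-agree {g} {g′} {h} p p′ f f′ = trans (M-≢ p) (trans (cong +_ (𝟙-cong (comparable? g h) (comparable? g′ h) f f′)) (sym (M-≢ p′)))

    -- In `above i` the elements over each class of level i form a block, the
    -- class itself excluded; in `from i` it is included.
    above from : ℕ → Fin N → Fin N
    above i u = if ⌊ i ℕ.<? lev u ⌋ then rp i u else u
    from  i u = if ⌊ i ℕ.≤? lev u ⌋ then rp i u else u

    above-> : ∀ {i u} → i < lev u → above i u ≡ rp i u
    above-> {i} {u} = if-yes (i ℕ.<? lev u)
    above-≤ : ∀ {i u} → lev u ≤ i → above i u ≡ u
    above-≤ {i} {u} le = if-no (i ℕ.<? lev u) (ℕₚ.≤⇒≯ le)
    from-≥ : ∀ {i u} → i ≤ lev u → from i u ≡ rp i u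
    from-≥ {i} {u} = if-yes (i ℕ.≤? lev u)
    from-< : ∀ {i u} → lev u < i → from i u ≡ u
    from-< {i} {u} lt = if-no (i ℕ.≤? lev u) (ℕₚ.<⇒≱ lt)

    above-Rep : ∀ {i g} → Rep i g → above i g ≡ g
    above-Rep {i} {g} (lg , e) with i ℕ.<? lev g
    ... | yes _ = e
    ... | no _ = refl

    from-Rep : ∀ {i g} → i ≤ m → Rep i g → from i g ≡ g
    from-Rep {i} {g} im (lg , e) = trans (from-≥ (subst (i ≤_) (sym lg) im)) e

    above-idem : ∀ {i} → i ≤ m → ∀ u → above i (above i u) ≡ above i u
    above-idem {i} im u = by-cases (i ℕ.<? lev u)
      where
      by-cases : Dec (i < lev u) → above i (above i u) ≡ above i u
      by-cases (yes lt) = subst (λ v → above i v ≡ v) (sym (above-> lt)) (above-Rep (Rep-rp ℕₚ.≤-refl im (ℕₚ.<⇒≤ lt)))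
      by-cases (no nlt) = cong (above i) (above-≤ (ℕₚ.≮⇒≥ nlt))

    from-idem : ∀ {i} → i ≤ m → ∀ u → from i (from i u) ≡ from i u
    from-idem {i} im u = by-cases (i ℕ.≤? lev u)
      where
      by-cases : Dec (i ≤ lev u) → from i (from i u) ≡ from i u
      by-cases (yes le) = subst (λ v → from i v ≡ v) (sym (from-≥ le)) (from-Rep im (Rep-rp ℕₚ.≤-refl im le))
      by-cases (no nle) = cong (from i) (from-< (ℕₚ.≰⇒> nle))

    -- Passes from `above i` to `from i`. For `i` = `m` there is no block above a class, and `rep v`
    -- is itself a member of the class of `v`.
    module Absorb (i : ℕ) (im : i ≤ m) where

      t : Fin N → Fin N
      t v = if ⌊ lev v ℕ.≟ i ⌋ then rep v else v

      t-≡ : ∀ {v} → lev v ≡ i → t v ≡ rep v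
      t-≡ {v} = if-yes (lev v ℕ.≟ i)
      t-≢ : ∀ {v} → lev v ≢ i → t v ≡ v
      t-≢ {v} = if-no (lev v ℕ.≟ i)

      Rep-rep : ∀ {v} → lev v ≡ i → Rep i (rep v)
      Rep-rep lv = subst (Rep i) (rp-self lv) (Rep-rp ℕₚ.≤-refl im (ℕₚ.≤-reflexive (sym lv)))

      t-Rep : ∀ {g} → Rep i g → t g ≡ g
      t-Rep {g} (lg , e) with lev g ℕ.≟ i
      ... | yes l = trans (sym (rp-self l)) e
      ... | no _ = refl

      t-alive : ∀ v → above i v ≡ v → above i (t v) ≡ t v
      t-alive v alive = by-cases (lev v ℕ.≟ i)
        where
        by-cases : Dec (lev v ≡ i) → above i (t v) ≡ t v
        by-cases (yes lv) = subst (λ w → above i w ≡ w) (sym (t-≡ lv)) (above-Rep (Rep-rep lv))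
        by-cases (no lv) = subst (λ w → above i w ≡ w) (sym (t-≢ lv)) alive

      t-idem : ∀ v → above i v ≡ v → t (t v) ≡ t v
      t-idem v _ = by-cases (lev v ℕ.≟ i)
        where
        by-cases : Dec (lev v ≡ i) → t (t v) ≡ t v
        by-cases (yes lv) = subst (λ w → t w ≡ w) (sym (t-≡ lv)) (t-Rep (Rep-rep lv))
        by-cases (no lv) = cong t (t-≢ lv)

      -- Whatever lies above level `i` and is comparable to `A` or `B` belongs to the block of `B`;
      -- at level at most `i`, both see just the elements below `A`. The block of `A` is `A` alone,
      -- so the gap is M A A - M B A, that is (x - κ + 1) - 1.
      mergeable : ∀ A → above i A ≡ A → t A ≢ A → Mergeable M (above i) (x ℤ.- + κ i) A (t A)
      mergeable A _ tA≢A = subst (Mergeable M (above i) (x ℤ.- + κ i) A) (sym tA) (record { agree = agree ; gap = gap })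
        where
        lA : lev A ≡ i
        lA with lev A ℕ.≟ i
        ... | yes e = e
        ... | no ne = ⊥-elim (tA≢A refl)
        tA : t A ≡ rep A
        tA = t-≡ lA
        B = rep A
        A≢B : A ≢ B
        A≢B e = tA≢A (trans tA (sym e))
        A≼B : A ≼ B
        A≼B = rep-≼ A
        RB : Rep i B
        RB = Rep-rep lA
        rpA : rp i A ≡ B
        rpA = rp-self lA
        agree : ∀ u → above i u ≢ A → above i u ≢ B → M A u ≡ M B u
        agree u ou≢A ou≢B = M-agree
            (λ e → ou≢A (trans (cong (above i) (sym e)) (above-≤ (ℕₚ.≤-reflexive lA))))
            (λ e → ou≢B (trans (cong (above i) (sym e)) (above-Rep RB)))
            to back
          where
          to : Comparable A u → Comparable B u
          to (inj₂ u≼A) = inj₂ (≼-trans u≼A A≼B)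
          to (inj₁ A≼u) with i ℕ.<? lev u
          ... | yes lt = ⊥-elim (ou≢B (trans (sym (rp-≼ A≼u (ℕₚ.≤-reflexive (sym lA)))) rpA))
          ... | no nlt = inj₂ (≼-trans (≼-chain ≼-refl A≼u (subst (lev u ≤_) (sym lA) (ℕₚ.≮⇒≥ nlt))) A≼B)
          back : Comparable B u → Comparable A u
          back (inj₁ B≼u) = inj₁ (≼-trans A≼B B≼u)
          back (inj₂ u≼B) with i ℕ.<? lev u
          ... | yes lt = ⊥-elim (ou≢B (trans (rp-≼ u≼B (ℕₚ.<⇒≤ lt)) (proj₂ RB)))
          ... | no nlt = inj₂ (≼-chain u≼B A≼B (subst (lev u ≤_) (sym lA) (ℕₚ.≮⇒≥ nlt)))
        block : ∀ u → δ (above i u) A ≡ δ A u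
        block u = by-cases (A ≟ u)
          where
          by-cases : Dec (A ≡ u) → δ (above i u) A ≡ δ A u
          by-cases (yes refl) = cong (λ v → δ v A) (above-≤ (ℕₚ.≤-reflexive lA))
          by-cases (no A≢u) = trans (δ-≢ (other (i ℕ.<? lev u))) (sym (δ-≢ A≢u))
            where
            other : Dec (i < lev u) → above i u ≢ A
            other (no nlt) e = A≢u (trans (sym e) (above-≤ (ℕₚ.≮⇒≥ nlt)))
            -- `above i u` is a leaf here; if it were `A`, then `i` would be `m`, and `u` would have
            -- a level above `m`.
            other (yes lt) e = ℕₚ.<⇒≱ lt (subst (lev u ≤_)
              (trans (sym (rep-lev (anc i u))) (trans (cong lev (trans (sym (above-> lt)) e)) lA)) (lev≤m u))
        gap : ∑ (λ u → δ (above i u) A ℤ.* (M A u ℤ.- M B u)) ≡ x ℤ.- + κ i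
        gap = trans (∑-cong λ u → cong (ℤ._* (M A u ℤ.- M B u)) (block u)) (trans (∑-δ A (λ u → M A u ℤ.- M B u))
          (trans (cong₂ ℤ._-_
            (cong₂ (λ d e → d ℤ.* (x ℤ.- + κ (lev A)) ℤ.+ + e) (δ-refl A) (𝟙-yes (comparable? A A) (inj₁ ≼-refl)))
            (trans (M-≢ (A≢B ∘ sym)) (cong +_ (𝟙-yes (comparable? B A) (inj₂ A≼B)))))
          (trans (simplify (x ℤ.- + κ (lev A))) (cong (λ l → x ℤ.- + κ l) lA))))
          where
          simplify : ∀ z → 1ℤ ℤ.* z ℤ.+ 1ℤ ℤ.- 1ℤ ≡ z
          simplify = solve-∀

      t∘above : ∀ u → t (above i u) ≡ from i u
      t∘above u with ℕₚ.<-cmp (lev u) i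
      ... | tri< l _ _ = trans (cong t (above-≤ (ℕₚ.<⇒≤ l))) (trans (t-≢ (ℕₚ.<⇒≢ l)) (sym (from-< l)))
      ... | tri≈ _ e _ = trans (cong t (above-≤ (ℕₚ.≤-reflexive e))) (trans (t-≡ e)
                          (trans (sym (rp-self e)) (sym (from-≥ (ℕₚ.≤-reflexive (sym e))))))
      ... | tri> _ _ g = trans (cong t (above-> g)) (trans (t-Rep (Rep-rp ℕₚ.≤-refl im (ℕₚ.<⇒≤ g))) (sym (from-≥ (ℕₚ.<⇒≤ g))))

      size : ℕ
      size = ∑ₙ λ v → 𝟙 (moved? (above i) t v)

      det-absorb : detℤ N (quotient M (above i)) ≡ (x ℤ.- + κ i) ℤ.^ size ℤ.* detℤ N (quotient M (from i))
      det-absorb = Stage.det-stage M x sums (above i) t (x ℤ.- + κ i) (above-idem im) t-alive t-idem mergeable (from i) t∘above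

    -- Below level `m` no vertex is its own representative, so the whole level is absorbed.
    absorb-size : ∀ i (i<m : i < m) → Absorb.size i (ℕₚ.<⇒≤ i<m) ≡ level-size i
    absorb-size i i<m = ∑ₙ-cong λ v → 𝟙-cong (moved? (above i) t v) (lev v ℕ.≟ i) (to v) (back v)
      where
      open Absorb i (ℕₚ.<⇒≤ i<m)
      to : ∀ v → above i v ≡ v × t v ≢ v → lev v ≡ i
      to v (_ , tv) with lev v ℕ.≟ i
      ... | yes e = e
      ... | no ne = ⊥-elim (tv refl)
      back : ∀ v → lev v ≡ i → above i v ≡ v × t v ≢ v
      back v lv = above-≤ (ℕₚ.≤-reflexive lv) ,
        λ e → ℕₚ.<⇒≢ i<m (trans (sym lv) (trans (cong lev (trans (sym e) (t-≡ lv))) (rep-lev v)))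

    -- At the top one vertex of each class stays behind as the representative.
    absorb-size-top : Absorb.size m ℕₚ.≤-refl ℕ.+ rep-size m ≡ level-size m
    absorb-size-top = trans (sym (∑ₙ-+ _ _)) (∑ₙ-cong λ v →
      𝟙-⊎ (moved? (above m) t v) (Rep? m v) (lev v ℕ.≟ m) (to v) proj₁ (split v)
        (λ { (_ , tv) R → tv (t-Rep R) }))
      where
      open Absorb m ℕₚ.≤-refl
      to : ∀ v → above m v ≡ v × t v ≢ v → lev v ≡ m
      to v (_ , tv) with lev v ℕ.≟ m
      ... | yes e = e
      ... | no ne = ⊥-elim (tv refl)
      split : ∀ v → lev v ≡ m → (above m v ≡ v × t v ≢ v) ⊎ Rep m v
      split v lv with rep v ≟ v
      ... | yes e = inj₂ (lv , trans (rp-self lv) e)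
      ... | no ne = inj₁ (above-≤ (ℕₚ.≤-reflexive lv) , λ e → ne (trans (sym (t-≡ lv)) e))

    module Join (i : ℕ) (i<m : i < m) where

      im = ℕₚ.<⇒≤ i<m

      t : Fin N → Fin N
      t = above i

      Rep-suc : ∀ {g} → Rep i g → Rep (suc i) g
      Rep-suc = Rep-mono (ℕₚ.n≤1+n i) i<m

      t-alive : ∀ v → from (suc i) v ≡ v → from (suc i) (t v) ≡ t v
      t-alive v alive = by-cases (i ℕ.<? lev v)
        where
        by-cases : Dec (i < lev v) → from (suc i) (t v) ≡ t v
        by-cases (yes lt) = subst (λ w → from (suc i) w ≡ w) (sym (above-> lt))
          (from-Rep i<m (Rep-suc (Rep-rp ℕₚ.≤-refl im (ℕₚ.<⇒≤ lt))))
        by-cases (no nlt) = subst (λ w → from (suc i) w ≡ w) (sym (above-≤ (ℕₚ.≮⇒≥ nlt))) alive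

      -- Blocks over different classes of level `suc i` are mutually incomparable. Of the elements
      -- at lower levels, `A` and `B` both see exactly those below the common ancestor `a`.
      mergeable : ∀ A → from (suc i) A ≡ A → t A ≢ A → Mergeable M (from (suc i)) (x ℤ.- + β i) A (t A)
      mergeable A oA tA≢A = subst (Mergeable M (from (suc i)) (x ℤ.- + β i) A) (sym tA) (record { agree = agree ; gap = gap })
        where
        i<A : i < lev A
        i<A with i ℕ.<? lev A
        ... | yes lt = lt
        ... | no nlt = ⊥-elim (tA≢A refl)
        tA : t A ≡ rp i A
        tA = above-> i<A
        B = rp i A
        A≢B : A ≢ B
        A≢B e = tA≢A (trans tA (sym e))
        rpA : rp (suc i) A ≡ A
        rpA = trans (sym (from-≥ i<A)) oA
        lA : lev A ≡ m
        lA = trans (cong lev (sym rpA)) (rep-lev (anc (suc i) A))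
        RB : Rep (suc i) B
        RB = Rep-suc (Rep-rp ℕₚ.≤-refl im (ℕₚ.<⇒≤ i<A))
        i<B : suc i ≤ lev B
        i<B = subst (suc i ≤_) (sym (proj₁ RB)) i<m
        a = anc i A
        la : lev a ≡ i
        la = anc-lev i A (ℕₚ.<⇒≤ i<A)
        a≼A : a ≼ A
        a≼A = anc-≼ i A (ℕₚ.<⇒≤ i<A)
        a≼B : a ≼ B
        a≼B = rep-≼ a
        ≤-a : ∀ {u} → ¬ i < lev u → lev u ≤ lev a
        ≤-a {u} nlt = subst (lev u ≤_) (sym la) (ℕₚ.≮⇒≥ nlt)
        low : ∀ {g u} → suc i ≤ lev g → ¬ i < lev u → ¬ g ≼ u
        low i<g nlt g≼u = nlt (ℕₚ.≤-trans i<g (≼-lev g≼u))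
        high : ∀ {g u} → Rep (suc i) g → i < lev u → from (suc i) u ≢ g → ¬ Comparable g u
        high {g} (lg , rg) lt ne c =
          ne (trans (from-≥ lt) (trans (sym (rp-comparable c (subst (suc i ≤_) (sym lg) i<m) lt)) rg))
        agree : ∀ u → from (suc i) u ≢ A → from (suc i) u ≢ B → M A u ≡ M B u
        agree u ou≢A ou≢B = by-cases (i ℕ.<? lev u)
          where
          by-cases : Dec (i < lev u) → M A u ≡ M B u
          by-cases (yes lt) = trans (M-incomparable (high (lA , rpA) lt ou≢A)) (sym (M-incomparable (high RB lt ou≢B)))
          by-cases (no nlt) = M-agree
            (λ e → ou≢A (trans (cong (from (suc i)) (sym e)) oA))
            (λ e → ou≢B (trans (cong (from (suc i)) (sym e)) (from-Rep i<m RB)))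
            (λ { (inj₁ A≼u) → ⊥-elim (low i<A nlt A≼u) ; (inj₂ u≼A) → inj₂ (≼-trans (≼-chain u≼A a≼A (≤-a nlt)) a≼B) })
            (λ { (inj₁ B≼u) → ⊥-elim (low i<B nlt B≼u) ; (inj₂ u≼B) → inj₂ (≼-trans (≼-chain u≼B a≼B (≤-a nlt)) a≼A) })
        -- Spreads the sum over all vertices so that the row sum applies: outside the block of `A`
        -- the entry `M A u` is the indicator of `u ≼ a`, and inside it that indicator and `M B u`
        -- both vanish.
        term : ∀ u → δ (from (suc i) u) A ℤ.* (M A u ℤ.- M B u) ≡ M A u ℤ.- + 𝟙 (u ≼? a)
        term u = by-cases (from (suc i) u ≟ A) (i ℕ.<? lev u)
          where
          by-cases : Dec (from (suc i) u ≡ A) → Dec (i < lev u) →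
            δ (from (suc i) u) A ℤ.* (M A u ℤ.- M B u) ≡ M A u ℤ.- + 𝟙 (u ≼? a)
          by-cases (yes e) (yes lt) = begin
            δ (from (suc i) u) A ℤ.* (M A u ℤ.- M B u) ≡⟨ cong (λ v → δ v A ℤ.* (M A u ℤ.- M B u)) e ⟩
            δ A A ℤ.* (M A u ℤ.- M B u) ≡⟨ cong₂ (λ d z → d ℤ.* (M A u ℤ.- z)) (δ-refl A) (M-incomparable (high RB lt (λ e′ → A≢B (trans (sym e) e′)))) ⟩
            1ℤ ℤ.* (M A u ℤ.- 0ℤ) ≡⟨ ℤₚ.*-identityˡ _ ⟩
            M A u ℤ.- 0ℤ ≡⟨ cong (λ z → M A u ℤ.- + z) (𝟙-no (u ≼? a) λ u≼a → ℕₚ.<⇒≱ lt (subst (lev u ≤_) la (≼-lev u≼a))) ⟨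
            M A u ℤ.- + 𝟙 (u ≼? a) ∎
            where open ≡-Reasoning
          by-cases (yes e) (no nlt) = ⊥-elim (nlt (subst (λ v → i < lev v) (trans (sym e) (from-< (s≤s (ℕₚ.≮⇒≥ nlt)))) i<A))
          by-cases (no ne) d = trans (cong (ℤ._* (M A u ℤ.- M B u)) (δ-≢ ne)) (trans (ℤₚ.*-zeroˡ (M A u ℤ.- M B u))
            (sym (trans (cong (ℤ._- + 𝟙 (u ≼? a)) (M≡ d)) (ℤₚ.+-inverseʳ (+ 𝟙 (u ≼? a))))))
            where
            M≡ : Dec (i < lev u) → M A u ≡ + 𝟙 (u ≼? a)
            M≡ (yes lt) = trans (M-incomparable (high (lA , rpA) lt ne))
              (cong +_ (sym (𝟙-no (u ≼? a) λ u≼a → ℕₚ.<⇒≱ lt (subst (lev u ≤_) la (≼-lev u≼a)))))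
            M≡ (no nlt) = trans (M-≢ λ e → ne (trans (cong (from (suc i)) (sym e)) oA))
              (cong +_ (𝟙-cong (comparable? A u) (u ≼? a)
                (λ { (inj₁ A≼u) → ⊥-elim (low i<A nlt A≼u) ; (inj₂ u≼A) → ≼-chain u≼A a≼A (≤-a nlt) })
                (λ u≼a → inj₂ (≼-trans u≼a a≼A))))
        gap : ∑ (λ u → δ (from (suc i) u) A ℤ.* (M A u ℤ.- M B u)) ≡ x ℤ.- + β i
        gap = trans (∑-cong term) (trans (∑-- _ _) (cong₂ ℤ._-_ (sums A)
          (trans (∑-cast _) (cong +_ (trans (below-count a) (cong β la))))))

      t∘from : ∀ u → t (from (suc i) u) ≡ above i u
      t∘from u = by-cases (i ℕ.<? lev u)
        where
        by-cases : Dec (i < lev u) → t (from (suc i) u) ≡ above i u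
        by-cases (yes lt) = trans (cong t (from-≥ lt)) (trans (above-> (subst (i <_) (sym (rep-lev (anc (suc i) u))) i<m))
          (trans (rp-rp (ℕₚ.n≤1+n i) lt) (sym (above-> lt))))
        by-cases (no nlt) = cong t (from-< (s≤s (ℕₚ.≮⇒≥ nlt)))

      size : ℕ
      size = ∑ₙ λ v → 𝟙 (moved? (from (suc i)) t v)

      det-join : detℤ N (quotient M (from (suc i))) ≡ (x ℤ.- + β i) ℤ.^ size ℤ.* detℤ N (quotient M (above i))
      det-join = Stage.det-stage M x sums (from (suc i)) t (x ℤ.- + β i) (from-idem i<m) t-alive
        (λ v _ → above-idem im v) mergeable (above i) t∘from

      -- The blocks are named by `Rep (suc i)` before the stage and by the subset `Rep i` after it;
      -- the names that drop out are the ones moved.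
      join-size : size ℕ.+ rep-size i ≡ rep-size (suc i)
      join-size = trans (sym (∑ₙ-+ _ _)) (∑ₙ-cong λ v →
        𝟙-⊎ (moved? (from (suc i)) t v) (Rep? i v) (Rep? (suc i) v) (to v) Rep-suc (split v)
          (λ { (_ , tv) R → tv (above-Rep R) }))
        where
        to : ∀ v → from (suc i) v ≡ v × t v ≢ v → Rep (suc i) v
        to v (ov , tv) = by-cases (i ℕ.<? lev v)
          where
          by-cases : Dec (i < lev v) → Rep (suc i) v
          by-cases (yes lt) = trans (cong lev (sym rpv)) (rep-lev (anc (suc i) v)) , rpv
            where rpv = trans (sym (from-≥ lt)) ov
          by-cases (no nlt) = ⊥-elim (tv (above-≤ (ℕₚ.≮⇒≥ nlt)))
        split : ∀ v → Rep (suc i) v → (from (suc i) v ≡ v × t v ≢ v) ⊎ Rep i v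
        split v R@(lv , _) with rp i v ≟ v
        ... | yes e = inj₂ (lv , e)
        ... | no ne = inj₁ (from-Rep i<m R , λ e → ne (trans (sym (above-> (subst (i <_) (sym lv) i<m))) e))

    det-from-0 : Fin N → detℤ N (quotient M (from 0)) ≡ x
    -- By `root` all elements of level 0 lie below one another, so `from 0` has a single block.
    det-from-0 g = det-quotient-const M x sums (from 0) (rp 0 g) λ u →
      trans (from-≥ z≤n) (rep-cong (root _ (anc-lev 0 u z≤n)) (root _ (anc-lev 0 g z≤n)))

    factors : ℕ → ℤ
    factors zero    = x
    factors (suc i) = (x ℤ.- + β i) ℤ.^ (rep-size (suc i) ℕ.∸ rep-size i) ℤ.*
                      ((x ℤ.- + κ i) ℤ.^ level-size i ℤ.* factors i)

    det-from : Fin N → ∀ i → i ≤ m → detℤ N (quotient M (from i)) ≡ factors i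
    det-from g zero    _   = det-from-0 g
    det-from g (suc i) i<m = trans (Join.det-join i i<m)
      (cong₂ (λ e z → (x ℤ.- + β i) ℤ.^ e ℤ.* z)
        (trans (sym (ℕₚ.m+n∸n≡m _ (rep-size i))) (cong (ℕ._∸ rep-size i) (Join.join-size i i<m)))
        (trans (Absorb.det-absorb i (ℕₚ.<⇒≤ i<m))
          (cong₂ (λ e z → (x ℤ.- + κ i) ℤ.^ e ℤ.* z) (absorb-size i i<m) (det-from g i (ℕₚ.<⇒≤ i<m)))))

    det-M : Fin N → detℤ N M ≡ (x ℤ.- + κ m) ℤ.^ (level-size m ℕ.∸ rep-size m) ℤ.* factors m
    -- No level exceeds `m`, so `above m` is the partition into singletons, and the quotient by it
    -- is `M`.
    det-M g = trans (det-cong N (λ r c → sym (trans (quotient-cong {M = M} {above m} {id} (λ u → above-≤ (lev≤m u)) r c) (quotient-id M r c))))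
      (trans (Absorb.det-absorb m ℕₚ.≤-refl)
        (cong₂ (λ e z → (x ℤ.- + κ m) ℤ.^ e ℤ.* z)
          (trans (sym (ℕₚ.m+n∸n≡m _ (rep-size m))) (cong (ℕ._∸ rep-size m) absorb-size-top))
          (det-from g m ℕₚ.≤-refl)))

-- Counting in ranges, Euler’s function and digits

range : ℕ → (ℕ → ℕ) → ℕ
range k f = ∑ₙ {k} (f ∘ toℕ)

range-suc : ∀ k f → range (suc k) f ≡ f 0 + range k (f ∘ suc)
range-suc k f = ∑ₙ-suc _

range-cong : ∀ k {f g} → (∀ i → i < k → f i ≡ g i) → range k f ≡ range k g
range-cong k eq = ∑ₙ-cong λ i → eq (toℕ i) (toℕ<n i)

range-+ : ∀ a b f → range (a + b) f ≡ range a f + range b (λ i → f (a + i))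
range-+ zero    b f = cong (_+ range b f) (sym (∑ₙ-empty _))
range-+ (suc a) b f = begin
  range (suc a + b) f                                           ≡⟨ range-suc (a + b) f ⟩
  f 0 + range (a + b) (f ∘ suc)                                 ≡⟨ cong (_+_ (f 0)) (range-+ a b (f ∘ suc)) ⟩
  f 0 + (range a (f ∘ suc) + range b (λ i → f (suc a + i)))     ≡⟨ ℕₚ.+-assoc (f 0) _ _ ⟨
  f 0 + range a (f ∘ suc) + range b (λ i → f (suc a + i))       ≡⟨ cong (_+ range b (λ i → f (suc a + i))) (range-suc a f) ⟨
  range (suc a) f + range b (λ i → f (suc a + i))               ∎
  where open ≡-Reasoning

range-* : ∀ b a f → range (b * a) f ≡ range b (λ c → range a (λ x → f (x + c * a)))
range-* zero    a f = trans (∑ₙ-empty _) (sym (∑ₙ-empty _))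
range-* (suc b) a f = begin
  range (a + b * a) f ≡⟨ range-+ a (b * a) f ⟩
  range a f + range (b * a) (λ i → f (a + i))
    ≡⟨ cong₂ _+_ (range-cong a λ x _ → cong f (sym (ℕₚ.+-identityʳ x)))
                 (trans (range-* b a (λ i → f (a + i)))
                   (range-cong b λ c _ → range-cong a λ x _ → cong f (shift a x (c * a)))) ⟩
  range a (λ x → f (x + 0)) + range b (λ c → range a (λ x → f (x + suc c * a)))
    ≡⟨ range-suc b (λ c → range a (λ x → f (x + c * a))) ⟨
  range (suc b) (λ c → range a (λ x → f (x + c * a))) ∎
  where
  open ≡-Reasoning
  shift : ∀ a x y → a + (x + y) ≡ x + (a + y)
  shift = solve-∀ₙ

range-const : ∀ k c → range k (λ _ → c) ≡ k * c
range-const zero    c = ∑ₙ-empty _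
range-const (suc k) c = trans (range-suc k _) (cong (_+_ c) (range-const k c))

-- Counting by parametrisation: an indicator is replaced by the sum over its unique witness, after
-- which the double sum can be swapped.
∑ₙ-unique : ∀ {n} {P : Fin n → Set} {E : Set} (P? : ∀ i → Dec (P i)) (E? : Dec E) →
  (∀ {i j} → P i → P j → i ≡ j) → (E → ∃ P) → (∀ i → P i → E) → ∑ₙ (λ i → 𝟙 (P? i)) ≡ 𝟙 E?
∑ₙ-unique P? (no ¬e) unique to from = ∑ₙ-zero λ i → 𝟙-no (P? i) (¬e ∘ from i)
∑ₙ-unique {P = P} P? (yes e) unique to from with to e
... | k , pk = trans (∑ₙ-cong λ i → 𝟙-cong (P? i) (k ≟ i) (unique pk) (λ { refl → pk })) (∑ₙ-≟ k)

range-≟ : ∀ k a → a < k → range k (λ x → 𝟙 (x ℕ.≟ a)) ≡ 1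
range-≟ k a a<k = ∑ₙ-unique (λ i → toℕ i ℕ.≟ a) (yes a<k)
  (λ e e′ → toℕ-injective (trans e (sym e′))) (λ lt → fromℕ< lt , toℕ-fromℕ< lt) (λ _ _ → a<k)

range-residue : ∀ b s .{{_ : NonZero s}} a → a < s → range (b * s) (λ x → 𝟙 (x % s ℕ.≟ a)) ≡ b
range-residue b s a a<s = trans (range-* b s (λ x → 𝟙 (x % s ℕ.≟ a))) (trans (range-cong b λ c _ →
    trans (range-cong s λ x x<s → cong (λ r → 𝟙 (r ℕ.≟ a)) (trans ([m+kn]%n≡m%n x c s) (m<n⇒m%n≡m x<s))) (range-≟ s a a<s))
  (trans (range-const b 1) (ℕₚ.*-identityʳ b)))

length-filter-applyUpTo : ∀ {P : ℕ → Set} (P? : ∀ i → Dec (P i)) (f : ℕ → ℕ) k →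
  length (filter P? (applyUpTo f k)) ≡ range k (λ i → 𝟙 (P? (f i)))
length-filter-applyUpTo P? f zero    = sym (∑ₙ-empty _)
length-filter-applyUpTo P? f (suc k) = trans head (sym (range-suc k (λ i → 𝟙 (P? (f i)))))
  where
  head : length (filter P? (f 0 ∷ applyUpTo (f ∘ suc) k)) ≡ 𝟙 (P? (f 0)) + range k (λ i → 𝟙 (P? (f (suc i))))
  head with P? (f 0)
  ... | yes _ = cong suc (length-filter-applyUpTo P? (f ∘ suc) k)
  ... | no _  = length-filter-applyUpTo P? (f ∘ suc) k

prime∤⇒coprime : ∀ {p u} → Prime p → ¬ p ∣ u → Coprime u p
prime∤⇒coprime pr p∤u (d∣u , d∣p) with prime⇒irreducible pr d∣p
... | inj₁ d≡1 = d≡1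
... | inj₂ refl = ⊥-elim (p∤u d∣u)

coprime-^ : ∀ {u p} k → Coprime u p → Coprime u (p ^ k)
coprime-^ zero    c (_ , d∣1) = ∣1⇒≡1 d∣1
coprime-^ (suc k) c (d∣u , d∣) = coprime-^ k c (d∣u , coprime-divisor (λ (e∣d , e∣p) → c (∣-trans e∣d d∣u , e∣p)) d∣)

-- Each of 1, ..., q is either prime to q or one of the p^i multiples of p. The additive form avoids
-- truncated subtraction.
φ-prime-power : ∀ p i → Prime p → φ (p ^ suc i) + p ^ i ≡ p ^ suc i
φ-prime-power p i pr = begin
  φ q + p ^ i ≡⟨ cong₂ _+_ (length-filter-applyUpTo (λ s → gcd (suc s) q ℕ.≟ 1) id q) (sym multiples) ⟩
  range q (λ s → 𝟙 (gcd (suc s) q ℕ.≟ 1)) + range q (λ s → 𝟙 (p ∣? suc s)) ≡⟨ ∑ₙ-+ _ _ ⟨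
  range q (λ s → 𝟙 (gcd (suc s) q ℕ.≟ 1) + 𝟙 (p ∣? suc s))
    ≡⟨ range-cong q (λ s _ → 𝟙-⊎ (gcd (suc s) q ℕ.≟ 1) (p ∣? suc s) (yes tt) _ _ (λ _ → split s) (disjoint s)) ⟩
  range q (λ _ → 1) ≡⟨ range-const q 1 ⟩
  q * 1 ≡⟨ ℕₚ.*-identityʳ q ⟩
  q ∎
  where
  open ≡-Reasoning
  q = p ^ suc i
  instance
    p≢0 : NonZero p
    p≢0 = prime⇒nonZero pr
  split : ∀ s → gcd (suc s) q ≡ 1 ⊎ p ∣ suc s
  split s with p ∣? suc s
  ... | yes d = inj₂ d
  ... | no nd = inj₁ (coprime⇒gcd≡1 (coprime-^ (suc i) (prime∤⇒coprime pr nd)))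
  disjoint : ∀ s → gcd (suc s) q ≡ 1 → ¬ p ∣ suc s
  disjoint s e d = ℕ.nonTrivial⇒≢1 {{prime⇒nonTrivial pr}} (gcd≡1⇒coprime e (d , m∣m*n (p ^ i)))
  p-1<p : p ∸ 1 < p
  p-1<p = ℕₚ.≤-reflexive (ℕₚ.suc-pred p)
  -- `φ` tests `suc s`, so being a multiple of `p` is the residue p - 1, not 0, for the index `s`.
  multiple : ∀ s → p ∣ suc s → s % p ≡ p ∸ 1
  multiple s d = %-pred-≡0 {s} {p} (n∣m⇒m%n≡0 (suc s) p d)
  multiple⁻¹ : ∀ s → s % p ≡ p ∸ 1 → p ∣ suc s
  multiple⁻¹ s e = m%n≡0⇒n∣m (suc s) p (begin
    suc s % p              ≡⟨ %-distribˡ-+ 1 s p ⟩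
    (1 % p + s % p) % p    ≡⟨ cong (λ r → (1 % p + r) % p) (trans e (sym (m<n⇒m%n≡m p-1<p))) ⟩
    (1 % p + (p ∸ 1) % p) % p ≡⟨ %-distribˡ-+ 1 (p ∸ 1) p ⟨
    suc (p ∸ 1) % p        ≡⟨ cong (_% p) (ℕₚ.suc-pred p) ⟩
    p % p                  ≡⟨ n%n≡0 p ⟩
    0 ∎)
  multiples : range q (λ s → 𝟙 (p ∣? suc s)) ≡ p ^ i
  multiples = begin
    range (p * p ^ i) (λ s → 𝟙 (p ∣? suc s)) ≡⟨ cong (λ k → range k (λ s → 𝟙 (p ∣? suc s))) (ℕₚ.*-comm p (p ^ i)) ⟩
    range (p ^ i * p) (λ s → 𝟙 (p ∣? suc s)) ≡⟨ range-cong (p ^ i * p) (λ s _ → 𝟙-cong (p ∣? suc s) (s % p ℕ.≟ p ∸ 1) (multiple s) (multiple⁻¹ s)) ⟩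
    range (p ^ i * p) (λ s → 𝟙 (s % p ℕ.≟ p ∸ 1)) ≡⟨ range-residue (p ^ i) p (p ∸ 1) p-1<p ⟩
    p ^ i ∎

sumFromTo-range : ∀ a b f → sumFromTo a b f ≡ range (suc b ∸ a) (λ j → f (a + j))
sumFromTo-range a b f = by-length (suc b ∸ a) a b refl
  where
  by-length : ∀ r a b → suc b ∸ a ≡ r → sumFromTo a b f ≡ range r (λ j → f (a + j))
  by-length zero a b eq rewrite eq = sym (∑ₙ-empty _)
  by-length (suc r) a b eq = trans unfold
    (trans (cong₂ _+_ (cong f (sym (ℕₚ.+-identityʳ a)))
             (trans (by-length r (suc a) b shorter) (range-cong r λ j _ → cong f (sym (ℕₚ.+-suc a j)))))
           (sym (range-suc r (λ j → f (a + j)))))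
    where
    shorter : b ∸ a ≡ r
    shorter = trans (sym (ℕₚ.pred[m∸n]≡m∸[1+n] (suc b) a)) (cong ℕ.pred eq)
    -- The unfolding is definitional since the local loop of sumFromTo does not
    -- inspect its bounds.
    unfold : sumFromTo a b f ≡ f a + sumFromTo (suc a) b f
    unfold rewrite eq | shorter = refl

module Digits (q : ℕ) .{{q≢0 : NonZero q}} where

  modq-% : ∀ x → modq q x ≡ x % q
  modq-% = go q
    where
    go : ∀ q .{{_ : NonZero q}} x → modq q x ≡ x % q
    go (suc _) x = refl

  divq-/ : ∀ x → divq q x ≡ x / q
  divq-/ = go q
    where
    go : ∀ q .{{_ : NonZero q}} x → divq q x ≡ x / q
    go (suc _) x = refl

  digit-zero : ∀ x c → x < q → modq q (x + c * q) ≡ x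
  digit-zero x c x<q = trans (modq-% _) (trans ([m+kn]%n≡m%n x c q) (m<n⇒m%n≡m x<q))

  digit-rest : ∀ x c → x < q → divq q (x + c * q) ≡ c
  digit-rest x c x<q = trans (divq-/ _) (trans (+-distrib-/-∣ʳ x (n∣m*n c))
    (cong₂ _+_ (m<n⇒m/n≡0 x<q) (m*n/n≡m c q)))

  digit<q : ∀ d x → digit q d x < q
  digit<q zero    x = subst (_< q) (sym (modq-% x)) (m%n<n x q)
  digit<q (suc d) x = digit<q d (divq q x)

  encode : ∀ n → (Fin n → ℕ) → ℕ
  encode zero    f = 0
  encode (suc n) f = f zero % q + encode n (f ∘ suc) * q

  encode< : ∀ n f → encode n f < q ^ n
  encode< zero    f = s≤s z≤n
  encode< (suc n) f = begin-strict
    f zero % q + e * q <⟨ ℕₚ.+-monoˡ-< (e * q) (m%n<n (f zero) q) ⟩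
    q + e * q          ≡⟨⟩
    suc e * q          ≤⟨ ℕₚ.*-monoˡ-≤ q (encode< n (f ∘ suc)) ⟩
    q ^ n * q          ≡⟨ ℕₚ.*-comm (q ^ n) q ⟩
    q * q ^ n          ∎
    where
    open ℕₚ.≤-Reasoning
    e = encode n (f ∘ suc)

  digit-encode : ∀ n f (d : Fin n) → digit q (toℕ d) (encode n f) ≡ f d % q
  digit-encode (suc n) f zero    = digit-zero (f zero % q) (encode n (f ∘ suc)) (m%n<n (f zero) q)
  digit-encode (suc n) f (suc d) = trans (cong (digit q (toℕ d)) (digit-rest (f zero % q) (encode n (f ∘ suc)) (m%n<n (f zero) q)))
    (digit-encode n (f ∘ suc) d)

  digit-injective : ∀ n c c′ → c < q ^ n → c′ < q ^ n →
    (∀ (d : Fin n) → digit q (toℕ d) c ≡ digit q (toℕ d) c′) → c ≡ c′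
  digit-injective zero    c c′ (s≤s z≤n) (s≤s z≤n) eq = refl
  digit-injective (suc n) c c′ c< c′< eq = begin
    c                    ≡⟨ m≡m%n+[m/n]*n c q ⟩
    c % q + c / q * q    ≡⟨ cong₂ (λ x y → x + y * q) (trans (sym (modq-% c)) (trans (eq zero) (modq-% c′)))
                              (digit-injective n (c / q) (c′ / q) (bound c c<) (bound c′ c′<)
                                (λ d → trans (cong (digit q (toℕ d)) (sym (divq-/ c))) (trans (eq (suc d)) (cong (digit q (toℕ d)) (divq-/ c′))))) ⟩
    c′ % q + c′ / q * q  ≡⟨ m≡m%n+[m/n]*n c′ q ⟨
    c′ ∎
    where
    open ≡-Reasoning
    bound : ∀ c → c < q * q ^ n → c / q < q ^ n
    bound c c< = m<n*o⇒m/o<n (subst (c <_) (ℕₚ.*-comm q (q ^ n)) c<)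

  -- The digits vary independently, so the condition on the lowest one splits off as a factor `k`.
  count-digits : ∀ n (Q : Fin n → ℕ → Set) (Q? : ∀ d x → Dec (Q d x)) k →
    (∀ d → range q (λ x → 𝟙 (Q? d x)) ≡ k) →
    range (q ^ n) (λ c → 𝟙 (all? (λ d → Q? d (digit q (toℕ d) c)))) ≡ k ^ n
  count-digits zero Q Q? k count = trans (range-suc 0 _) (cong suc (∑ₙ-empty _))
  count-digits (suc n) Q Q? k count = begin
    range (q * q ^ n) full
      ≡⟨ cong (λ s → range s full) (ℕₚ.*-comm q (q ^ n)) ⟩
    range (q ^ n * q) full
      ≡⟨ range-* (q ^ n) q full ⟩
    range (q ^ n) (λ c → range q (λ x → full (x + c * q)))
      ≡⟨ range-cong (q ^ n) (λ c _ → trans (range-cong q (λ x x<q → factor c x x<q))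
           (trans (sym (∑ₙ-*ʳ (rest c) _)) (cong (_* rest c) (count zero)))) ⟩
    range (q ^ n) (λ c → k * rest c)
      ≡⟨ ∑ₙ-*ˡ k _ ⟨
    k * range (q ^ n) rest
      ≡⟨ cong (k *_) (count-digits n (Q ∘ suc) (Q? ∘ suc) k (count ∘ suc)) ⟩
    k * k ^ n ∎
    where
    open ≡-Reasoning
    full rest : ℕ → ℕ
    full c = 𝟙 (all? (λ (d : Fin (suc n)) → Q? d (digit q (toℕ d) c)))
    rest c = 𝟙 (all? (λ (d : Fin n) → Q? (suc d) (digit q (toℕ d) c)))
    factor : ∀ c x → x < q → full (x + c * q) ≡ 𝟙 (Q? zero x) * rest c
    factor c x x<q = trans (𝟙-cong (all? (λ (d : Fin (suc n)) → Q? d (digit q (toℕ d) (x + c * q))))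
        (Q? zero x ×-dec all? (λ (d : Fin n) → Q? (suc d) (digit q (toℕ d) c)))
        (λ h → subst (Q zero) (digit-zero x c x<q) (h zero) ,
               λ d → subst (λ y → Q (suc d) (digit q (toℕ d) y)) (digit-rest x c x<q) (h (suc d)))
        (λ { (h₀ , h) zero → subst (Q zero) (sym (digit-zero x c x<q)) h₀
           ; (h₀ , h) (suc d) → subst (λ y → Q (suc d) (digit q (toℕ d) y)) (sym (digit-rest x c x<q)) (h d) }))
      (sym (𝟙-* (Q? zero x) _))

-- The group ℤ_q^n for q = p^m

%-*ʳ : ∀ a b q .{{_ : NonZero q}} → (a * (b % q)) % q ≡ (a * b) % q
%-*ʳ a b q = trans (%-distribˡ-* a (b % q) q) (trans (cong (λ r → ((a % q) * r) % q) (m%n%n≡m%n b q)) (sym (%-distribˡ-* a b q)))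

%-*ˡ : ∀ a b q .{{_ : NonZero q}} → ((a % q) * b) % q ≡ (a * b) % q
%-*ˡ a b q = trans (cong (_% q) (ℕₚ.*-comm (a % q) b)) (trans (%-*ʳ b a q) (cong (_% q) (ℕₚ.*-comm b a)))

-- Once the common residue cancels, a truncated difference of multiples of `q` is left, which is
-- again a multiple of `q`; this includes the case `a` > `b`.
%-∸ : ∀ a b q .{{_ : NonZero q}} → a % q ≡ b % q → (b ∸ a) % q ≡ 0
%-∸ a b q eq = begin
  (b ∸ a) % q                                          ≡⟨ cong₂ (λ x y → (x ∸ y) % q) (m≡m%n+[m/n]*n b q) (m≡m%n+[m/n]*n a q) ⟩
  (b % q + b / q * q ∸ (a % q + a / q * q)) % q        ≡⟨ cong (λ r → (b % q + b / q * q ∸ (r + a / q * q)) % q) eq ⟩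
  (b % q + b / q * q ∸ (b % q + a / q * q)) % q        ≡⟨ cong (_% q) (ℕₚ.[m+n]∸[m+o]≡n∸o (b % q) (b / q * q) (a / q * q)) ⟩
  (b / q * q ∸ a / q * q) % q                          ≡⟨ cong (_% q) (ℕₚ.*-distribʳ-∸ q (b / q) (a / q)) ⟨
  ((b / q ∸ a / q) * q) % q                            ≡⟨ m*n%n≡0 (b / q ∸ a / q) q ⟩
  0 ∎
  where open ≡-Reasoning

scale-% : ∀ b s q .{{_ : NonZero b}} .{{_ : NonZero s}} .{{_ : NonZero q}} → q ≡ s * b → ∀ x → (b * x) % q ≡ x % s * b
scale-% b s .(s * b) refl x = trans (cong (_% (s * b)) (ℕₚ.*-comm b x)) (sym (m%n*o≡m*o%[n*o] x s b))

module PowerGroup (p m n : ℕ) (pr : Prime p) (1≤n : 1 ≤ n) where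

  q N : ℕ
  q = p ^ m
  N = q ^ n

  instance
    p≢0 : NonZero p
    p≢0 = prime⇒nonZero pr
    q≢0 : NonZero (p ^ m)
    q≢0 = ℕₚ.m^n≢0 p m

  open Digits q

  infixr 8 _•_

  -- Sealed so that codes, digits and remainders do not unfold in later goals; the group is handled
  -- through its coordinates.
  opaque
    coord : Fin N → Fin n → ℕ
    coord = elem q n

    coord<q : ∀ g d → coord g d < q
    coord<q g d = digit<q (toℕ d) (toℕ g)

    coord-injective : ∀ {g h} → (∀ d → coord g d ≡ coord h d) → g ≡ h
    coord-injective {g} {h} eq = toℕ-injective (digit-injective n (toℕ g) (toℕ h) (toℕ<n g) (toℕ<n h) eq)

    tuple : (Fin n → ℕ) → Fin N
    tuple f = fromℕ< (encode< n f)

    coord-tuple : ∀ f d → coord (tuple f) d ≡ f d % q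
    coord-tuple f d = trans (cong (digit q (toℕ d)) (toℕ-fromℕ< (encode< n f))) (digit-encode n f d)

    _•_ : ℕ → Fin N → Fin N
    k • g = tuple (λ d → k * coord g d)

    𝟎 : Fin N
    𝟎 = tuple (λ _ → 0)

    coord-• : ∀ k g d → coord (k • g) d ≡ (k * coord g d) % q
    coord-• k g = coord-tuple _

    coord-𝟎 : ∀ d → coord 𝟎 d ≡ 0
    coord-𝟎 d = trans (coord-tuple (λ _ → 0) d) (m*n%n≡0 0 q)

    coord-elem : ∀ g d → coord g d ≡ elem q n g d
    coord-elem g d = refl

    0• : ∀ g → 0 • g ≡ 𝟎
    0• g = refl

  •-• : ∀ k l g → k • l • g ≡ (k * l) • g
  •-• k l g = coord-injective λ d → begin
    coord (k • l • g) d            ≡⟨ coord-• k (l • g) d ⟩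
    (k * coord (l • g) d) % q      ≡⟨ cong (λ c → (k * c) % q) (coord-• l g d) ⟩
    (k * ((l * coord g d) % q)) % q ≡⟨ %-*ʳ k (l * coord g d) q ⟩
    (k * (l * coord g d)) % q      ≡⟨ cong (_% q) (ℕₚ.*-assoc k l (coord g d)) ⟨
    (k * l * coord g d) % q        ≡⟨ coord-• (k * l) g d ⟨
    coord ((k * l) • g) d ∎
    where open ≡-Reasoning

  1• : ∀ g → 1 • g ≡ g
  1• g = coord-injective λ d → trans (coord-• 1 g d)
    (trans (cong (_% q) (ℕₚ.*-identityˡ (coord g d))) (m<n⇒m%n≡m (coord<q g d)))

  •𝟎 : ∀ k → k • 𝟎 ≡ 𝟎
  •𝟎 k = coord-injective λ d → trans (coord-• k 𝟎 d)
    (trans (cong (λ c → (k * c) % q) (coord-𝟎 d)) (trans (cong (_% q) (ℕₚ.*-zeroʳ k)) (trans (m*n%n≡0 0 q) (sym (coord-𝟎 d)))))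

  •-cong-% : ∀ {k l} g → k % q ≡ l % q → k • g ≡ l • g
  •-cong-% {k} {l} g eq = coord-injective λ d → begin
    coord (k • g) d           ≡⟨ coord-• k g d ⟩
    (k * coord g d) % q       ≡⟨ %-*ˡ k (coord g d) q ⟨
    (k % q * coord g d) % q   ≡⟨ cong (λ r → (r * coord g d) % q) eq ⟩
    (l % q * coord g d) % q   ≡⟨ %-*ˡ l (coord g d) q ⟩
    (l * coord g d) % q       ≡⟨ coord-• l g d ⟨
    coord (l • g) d ∎
    where open ≡-Reasoning

  q• : ∀ g → q • g ≡ 𝟎
  q• g = trans (•-cong-% {q} {0} g (trans (n%n≡0 q) (sym (m*n%n≡0 0 q)))) (0• g)

  •-∸ : ∀ {k l} g → k • g ≡ l • g → (l ∸ k) • g ≡ 𝟎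
  •-∸ {k} {l} g eq = coord-injective λ d → begin
    coord ((l ∸ k) • g) d                   ≡⟨ coord-• (l ∸ k) g d ⟩
    ((l ∸ k) * coord g d) % q               ≡⟨ cong (_% q) (ℕₚ.*-distribʳ-∸ (coord g d) l k) ⟩
    (l * coord g d ∸ k * coord g d) % q     ≡⟨ %-∸ (k * coord g d) (l * coord g d) q
                                                 (trans (sym (coord-• k g d)) (trans (cong (λ h → coord h d) eq) (coord-• l g d))) ⟩
    0                                       ≡⟨ coord-𝟎 d ⟨
    coord 𝟎 d ∎
    where open ≡-Reasoning

  powZ-* : ∀ (f : Fin n → ℕ) k d → powZ q n f k d ≡ (k * f d) % q
  powZ-* f zero    d = sym (m*n%n≡0 0 q)
  powZ-* f (suc k) d = trans (modq-% (f d + powZ q n f k d)) (begin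
    (f d + powZ q n f k d) % q               ≡⟨ cong (λ r → (f d + r) % q) (powZ-* f k d) ⟩
    (f d + (k * f d) % q) % q                ≡⟨ %-distribˡ-+ (f d) ((k * f d) % q) q ⟩
    (f d % q + ((k * f d) % q) % q) % q      ≡⟨ cong (λ r → (f d % q + r) % q) (m%n%n≡m%n (k * f d) q) ⟩
    (f d % q + (k * f d) % q) % q            ≡⟨ %-distribˡ-+ (f d) (k * f d) q ⟨
    (f d + k * f d) % q ∎)
    where open ≡-Reasoning

  -- An unbounded factor makes transitivity a product of factors; the bounded exponent of
  -- `IsPowerOf` is recovered modulo `q`.
  record _≼_ (h g : Fin N) : Set where
    constructor multiple
    field
      factor   : ℕ
      equation : h ≡ factor • g

  •⇒≼ : ∀ k g → (k • g) ≼ g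
  •⇒≼ k g = multiple k refl

  powZ-• : ∀ k g d → powZ q n (elem q n g) k d ≡ elem q n (k • g) d
  powZ-• k g d = trans (powZ-* (elem q n g) k d)
    (trans (cong (λ c → (k * c) % q) (sym (coord-elem g d))) (trans (sym (coord-• k g d)) (coord-elem (k • g) d)))

  elem-injective : ∀ {g h} → (∀ d → elem q n g d ≡ elem q n h d) → g ≡ h
  elem-injective {g} {h} eq = coord-injective λ d → trans (coord-elem g d) (trans (eq d) (sym (coord-elem h d)))

  IsPowerOf⇒≼ : ∀ {h g} → IsPowerOf q n h g → h ≼ g
  IsPowerOf⇒≼ {h} {g} (k , eq) = multiple (toℕ k) (elem-injective λ d → trans (eq d) (powZ-• (toℕ k) g d))

  ≼⇒IsPowerOf : ∀ {h g} → h ≼ g → IsPowerOf q n h g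
  ≼⇒IsPowerOf {h} {g} (multiple k eq) = fromℕ< (m%n<n k q) , λ d →
    trans (cong (λ h → elem q n h d) (trans eq (trans (•-cong-% {k} {k % q} g (sym (m%n%n≡m%n k q)))
                                                    (cong (_• g) (sym (toℕ-fromℕ< (m%n<n k q)))))))
          (sym (powZ-• _ g d))

  _≼?_ : ∀ h g → Dec (h ≼ g)
  h ≼? g = map′ IsPowerOf⇒≼ ≼⇒IsPowerOf (isPowerOf? q n h g)

  ≼-refl : ∀ {g} → g ≼ g
  ≼-refl {g} = multiple 1 (sym (1• g))

  ≼-trans : ∀ {f g h} → f ≼ g → g ≼ h → f ≼ h
  ≼-trans {h = h} (multiple k refl) (multiple l refl) = multiple (k * l) (•-• k l h)

  unit-inverse : ∀ {u} → ¬ p ∣ u → ∃ λ w → ∀ g → w • u • g ≡ g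
  unit-inverse {u} p∤u with coprime-Bézout (coprime-^ m (prime∤⇒coprime pr p∤u))
  ... | Bézout.+- x y eq = x , λ g → trans (•-• x u g) (trans (•-cong-% {x * u} {1} g
        (trans (cong (_% q) (sym eq)) ([m+kn]%n≡m%n 1 y q))) (1• g))
  -- In this case x u ≡ -1 modulo q, and (q - 1) x represents the inverse -x.
  ... | Bézout.-+ x y eq = (q ∸ 1) * x , λ g → trans (•-• ((q ∸ 1) * x) u g) (trans (•-cong-% {(q ∸ 1) * x * u} {1} g inverse) (1• g))
    where
    open ≡-Reasoning
    r = q ∸ 1
    q≡ : suc r ≡ q
    q≡ = ℕₚ.suc-pred q
    rearrange : ∀ r x u → r * x * u + suc r ≡ 1 + r * (1 + x * u)
    rearrange = solve-∀ₙ
    inverse : (r * x * u) % q ≡ 1 % q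
    inverse = begin
      (r * x * u) % q              ≡⟨ [m+n]%n≡m%n (r * x * u) q ⟨
      (r * x * u + q) % q          ≡⟨ cong (λ s → (r * x * u + s) % q) q≡ ⟨
      (r * x * u + suc r) % q      ≡⟨ cong (_% q) (rearrange r x u) ⟩
      (1 + r * (1 + x * u)) % q    ≡⟨ cong (λ z → (1 + r * z) % q) eq ⟩
      (1 + r * (y * q)) % q        ≡⟨ cong (λ z → (1 + z) % q) (ℕₚ.*-assoc r y q) ⟨
      (1 + r * y * q) % q          ≡⟨ [m+kn]%n≡m%n 1 (r * y) q ⟩
      1 % q ∎

  p^+• : ∀ i j g → (p ^ i) • (p ^ j) • g ≡ (p ^ (i + j)) • g
  p^+• i j g = trans (•-• (p ^ i) (p ^ j) g) (cong (_• g) (sym (ℕₚ.^-distribˡ-+-* p i j)))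

  opaque
    order : ∀ g → ∃ (Least {suc m} (λ i → (p ^ toℕ i) • g ≡ 𝟎))
    order g = least (λ i → (p ^ toℕ i) • g ≟ 𝟎) (fromℕ m , trans (cong (λ k → (p ^ k) • g) (toℕ-fromℕ m)) (q• g))

    lev : Fin N → ℕ
    lev g = toℕ (proj₁ (order g))

    lev≤m : ∀ g → lev g ≤ m
    lev≤m g = ℕₚ.≤-pred (toℕ<n (proj₁ (order g)))

    lev-kills : ∀ {i g} → lev g ≤ i → (p ^ i) • g ≡ 𝟎
    lev-kills {i} {g} le = begin
      (p ^ i) • g                          ≡⟨ cong (λ k → (p ^ k) • g) (ℕₚ.m∸n+n≡m le) ⟨
      (p ^ (i ∸ lev g + lev g)) • g        ≡⟨ p^+• (i ∸ lev g) (lev g) g ⟨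
      (p ^ (i ∸ lev g)) • (p ^ lev g) • g  ≡⟨ cong ((p ^ (i ∸ lev g)) •_) (proj₁ (proj₂ (order g))) ⟩
      (p ^ (i ∸ lev g)) • 𝟎                ≡⟨ •𝟎 _ ⟩
      𝟎 ∎
      where open ≡-Reasoning

    lev-least : ∀ {i g} → (p ^ i) • g ≡ 𝟎 → lev g ≤ i
    lev-least {i} {g} eq with i ℕ.≤? m
    ... | no i≰m = ℕₚ.≤-trans (lev≤m g) (ℕₚ.<⇒≤ (ℕₚ.≰⇒> i≰m))
    ... | yes i≤m = subst (lev g ≤_) (toℕ-fromℕ< (s≤s i≤m))
      (proj₂ (proj₂ (order g)) (fromℕ< (s≤s i≤m)) (trans (cong (λ k → (p ^ k) • g) (toℕ-fromℕ< (s≤s i≤m))) eq))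

  -- `p ^ i` kills `(p ^ j) • g` exactly when `p ^ (i + j)` kills `g`; minimality of `lev` gives
  -- both inequalities.
  lev-• : ∀ j g → lev ((p ^ j) • g) ≡ lev g ∸ j
  lev-• j g = ℕₚ.≤-antisym
    (lev-least (trans (p^+• (lev g ∸ j) j g) (lev-kills (ℕₚ.≤-trans (ℕₚ.m≤n+m∸n (lev g) j) (ℕₚ.≤-reflexive (ℕₚ.+-comm j _))))))
    (ℕₚ.m≤n+o⇒m∸n≤o (lev g) j (subst (lev g ≤_) (ℕₚ.+-comm _ j)
      (lev-least (trans (sym (p^+• (lev ((p ^ j) • g)) j g)) (lev-kills ℕₚ.≤-refl)))))

  lev-p• : ∀ g → lev (p • g) ≡ lev g ∸ 1
  lev-p• g = trans (cong (λ k → lev (k • g)) (sym (ℕₚ.*-identityʳ p))) (lev-• 1 g)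

  -- If `p` did not divide `k`, multiplication by `k` would be invertible and `g` would be 0.
  -- Otherwise k / p kills `p • g`, whose level is one less.
  order-∣ : ∀ v {k g} → lev g ≡ v → k • g ≡ 𝟎 → p ^ v ∣ k
  order-∣ zero    lg eq = 1∣ _
  order-∣ (suc v) {k} {g} lg eq with p ∣? k
  ... | no p∤k with unit-inverse p∤k
  ...   | w , inverse = ⊥-elim (ℕₚ.1+n≰n (ℕₚ.≤-trans (subst (_≤ 0) lg (lev-least {0} {g} (trans (1• g) g≡𝟎))) z≤n))
    where
    g≡𝟎 : g ≡ 𝟎
    g≡𝟎 = trans (sym (inverse g)) (trans (cong (w •_) eq) (•𝟎 w))
  order-∣ (suc v) {k} {g} lg eq | yes (divides k′ refl) =
    subst (p ^ suc v ∣_) (ℕₚ.*-comm p k′) (*-monoʳ-∣ p (order-∣ v {k′} {p • g} (trans (lev-p• g) (cong (_∸ 1) lg)) (trans (•-• k′ p g) eq)))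

  ≼-lev : ∀ {h g} → h ≼ g → lev h ≤ lev g
  ≼-lev {h} {g} (multiple k refl) = lev-least (begin
    (p ^ lev g) • k • g    ≡⟨ •-• (p ^ lev g) k g ⟩
    (p ^ lev g * k) • g    ≡⟨ cong (_• g) (ℕₚ.*-comm (p ^ lev g) k) ⟩
    (k * p ^ lev g) • g    ≡⟨ •-• k (p ^ lev g) g ⟨
    k • (p ^ lev g) • g    ≡⟨ cong (k •_) (lev-kills ℕₚ.≤-refl) ⟩
    k • 𝟎                  ≡⟨ •𝟎 k ⟩
    𝟎 ∎)
    where open ≡-Reasoning

  anc : ℕ → Fin N → Fin N
  anc i g = (p ^ (lev g ∸ i)) • g

  anc-lev : ∀ i g → i ≤ lev g → lev (anc i g) ≡ i
  anc-lev i g le = trans (lev-• (lev g ∸ i) g) (ℕₚ.m∸[m∸n]≡n le)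

  lev-0 : ∀ {h} → lev h ≡ 0 → h ≡ 𝟎
  lev-0 {h} lh = trans (sym (1• h)) (lev-kills {0} (ℕₚ.≤-reflexive lh))

  root : ∀ {h} g → lev h ≡ 0 → h ≼ g
  root g lh = multiple 0 (trans (lev-0 lh) (sym (0• g)))

  -- h = s • anc (lev h) g, where s is prime to p unless h = 0.
  ≼-anc : ∀ {h g} → h ≼ g → h ≼ anc (lev h) g × anc (lev h) g ≼ h
  ≼-anc {h} {g} h≼g@(multiple k h≡) with *-cancelˡ-∣ (p ^ lev h) {{ℕₚ.m^n≢0 p (lev h)}} (subst (_∣ p ^ lev h * k) p^v (order-∣ (lev g) refl kills))
    where
    p^v : p ^ lev g ≡ p ^ lev h * p ^ (lev g ∸ lev h)
    p^v = trans (cong (p ^_) (sym (ℕₚ.m+[n∸m]≡n (≼-lev h≼g)))) (ℕₚ.^-distribˡ-+-* p (lev h) (lev g ∸ lev h))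
    kills : (p ^ lev h * k) • g ≡ 𝟎
    kills = trans (sym (•-• (p ^ lev h) k g)) (trans (cong ((p ^ lev h) •_) (sym h≡)) (lev-kills ℕₚ.≤-refl))
  ... | divides s k≡ = subst (_≼ a) (sym h≡s•a) (•⇒≼ s a) , a≼h (lev h) refl
    where
    open ≡-Reasoning
    a = anc (lev h) g
    h≡s•a : h ≡ s • a
    h≡s•a = trans h≡ (trans (cong (_• g) k≡) (sym (•-• s _ g)))
    la : lev a ≡ lev h
    la = anc-lev (lev h) g (≼-lev h≼g)
    a≼h : ∀ i → lev h ≡ i → a ≼ h
    a≼h zero    lh = root h (trans la lh)
    a≼h (suc i) lh with p ∣? s
    ... | no p∤s with unit-inverse p∤s
    ...   | w , inverse = subst (_≼ h) (trans (cong (w •_) h≡s•a) (inverse a)) (•⇒≼ w h)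
    -- If `p` divided `s`, then `p ^ i` would already kill `h`, against its level `suc i`.
    a≼h (suc i) lh | yes (divides s′ refl) = ⊥-elim (ℕₚ.1+n≰n (subst (_≤ i) lh (lev-least (begin
      (p ^ i) • h                    ≡⟨ cong ((p ^ i) •_) h≡s•a ⟩
      (p ^ i) • (s′ * p) • a         ≡⟨ •-• (p ^ i) (s′ * p) a ⟩
      (p ^ i * (s′ * p)) • a         ≡⟨ cong (_• a) (rearrange (p ^ i) s′ p) ⟩
      (s′ * p ^ suc i) • a           ≡⟨ •-• s′ (p ^ suc i) a ⟨
      s′ • (p ^ suc i) • a           ≡⟨ cong (s′ •_) (lev-kills (ℕₚ.≤-reflexive (trans la lh))) ⟩
      s′ • 𝟎                         ≡⟨ •𝟎 s′ ⟩
      𝟎 ∎))))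
      where
      rearrange : ∀ x s p → x * (s * p) ≡ s * (p * x)
      rearrange = solve-∀ₙ

  anc-≼ : ∀ i g → anc i g ≼ g
  anc-≼ i g = •⇒≼ _ g

  anc-mono : ∀ {i j} g → i ≤ j → anc i g ≼ anc j g
  anc-mono {i} {j} g i≤j = subst (_≼ anc j g) eq (•⇒≼ (p ^ ((lev g ∸ i) ∸ (lev g ∸ j))) (anc j g))
    where
    eq : (p ^ ((lev g ∸ i) ∸ (lev g ∸ j))) • anc j g ≡ anc i g
    eq = trans (p^+• ((lev g ∸ i) ∸ (lev g ∸ j)) (lev g ∸ j) g) (cong (λ k → (p ^ k) • g) (ℕₚ.m∸n+n≡m (ℕₚ.∸-monoʳ-≤ (lev g) i≤j)))

  -- A cyclic p-group has one subgroup of each order, and these form a chain: `≼-anc` replaces `h`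
  -- and `h′` by the ancestors of `g` at their levels.
  ≼-chain : ∀ {g h h′} → h ≼ g → h′ ≼ g → lev h ≤ lev h′ → h ≼ h′
  ≼-chain {g} hg h′g le = ≼-trans (proj₁ (≼-anc hg)) (≼-trans (anc-mono g le) (proj₂ (≼-anc h′g)))

  -- As p^i kills `g`, each coordinate is a multiple of p^(m-i); dividing coordinatewise yields `h`.
  divisible : ∀ i g → i ≤ m → lev g ≤ i → ∃ λ h → g ≡ (p ^ (m ∸ i)) • h
  divisible i g i≤m le = tuple b , coord-injective λ d → sym (begin
    coord (s • tuple b) d       ≡⟨ coord-• s (tuple b) d ⟩
    (s * coord (tuple b) d) % q ≡⟨ cong (λ c → (s * c) % q) (coord-tuple b d) ⟩
    (s * (b d % q)) % q         ≡⟨ %-*ʳ s (b d) q ⟩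
    (s * b d) % q               ≡⟨ cong (_% q) (m*[n/m]≡n (s∣ d)) ⟩
    coord g d % q               ≡⟨ m<n⇒m%n≡m (coord<q g d) ⟩
    coord g d ∎)
    where
    open ≡-Reasoning
    s = p ^ (m ∸ i)
    instance
      s≢0 : NonZero (p ^ (m ∸ i))
      s≢0 = ℕₚ.m^n≢0 p (m ∸ i)
    b : Fin n → ℕ
    b d = coord g d / s
    s∣ : ∀ d → s ∣ coord g d
    s∣ d = *-cancelˡ-∣ (p ^ i) {{ℕₚ.m^n≢0 p i}} (subst (_∣ p ^ i * coord g d)
      (trans (cong (p ^_) (sym (ℕₚ.m+[n∸m]≡n i≤m))) (ℕₚ.^-distribˡ-+-* p i (m ∸ i)))
      (m%n≡0⇒n∣m (p ^ i * coord g d) q (trans (sym (coord-• (p ^ i) g d)) (trans (cong (λ h → coord h d) (lev-kills le)) (coord-𝟎 d)))))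

  𝟏 : Fin N
  𝟏 = tuple (λ _ → 1)

  lev-𝟏 : lev 𝟏 ≡ m
  lev-𝟏 = ℕₚ.≤-antisym (lev≤m 𝟏) (ℕₚ.≮⇒≥ λ lt → ℕₚ.<⇒≱ (ℕₚ.^-monoʳ-< p (ℕ.nonTrivial⇒n>1 p {{prime⇒nonTrivial pr}}) lt)
      (∣⇒≤ {{ℕₚ.m^n≢0 p (lev 𝟏)}} (m%n≡0⇒n∣m (p ^ lev 𝟏) q (begin
        p ^ lev 𝟏 % q                    ≡⟨ cong (_% q) (ℕₚ.*-identityʳ (p ^ lev 𝟏)) ⟨
        (p ^ lev 𝟏 * 1) % q              ≡⟨ %-*ʳ (p ^ lev 𝟏) 1 q ⟨
        (p ^ lev 𝟏 * (1 % q)) % q        ≡⟨ cong (λ c → (p ^ lev 𝟏 * c) % q) (coord-tuple (λ _ → 1) d) ⟨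
        (p ^ lev 𝟏 * coord 𝟏 d) % q      ≡⟨ coord-• (p ^ lev 𝟏) 𝟏 d ⟨
        coord ((p ^ lev 𝟏) • 𝟏) d        ≡⟨ cong (λ h → coord h d) (lev-kills ℕₚ.≤-refl) ⟩
        coord 𝟎 d                        ≡⟨ coord-𝟎 d ⟩
        0 ∎))))
    where
    open ≡-Reasoning
    d : Fin n
    -- Any single coordinate shows that no power of `p` below p^m kills the tuple of ones; `n` ≥ 1
    -- supplies one.
    d = fromℕ< 1≤n

  -- Dividing `h` by p^(m - lev h) lifts it to level `m`. For the identity the quotient could have
  -- any level, so `𝟏` is used instead.
  top : ∀ h → ∃ λ g → lev g ≡ m × h ≼ g
  top h = by-level (lev h) refl
    where
    by-level : ∀ i → lev h ≡ i → ∃ λ g → lev g ≡ m × h ≼ g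
    by-level zero    lh = 𝟏 , lev-𝟏 , root 𝟏 lh
    by-level (suc i) lh with divisible (suc i) h i<m (ℕₚ.≤-reflexive lh)
      where i<m = subst (_≤ m) lh (lev≤m h)
    ... | g , refl = g , ℕₚ.≤-antisym (lev≤m g) m≤ , •⇒≼ _ g
      where
      open ℕₚ.≤-Reasoning
      i<m = subst (_≤ m) lh (lev≤m h)
      positive : m ∸ suc i < lev g
      positive = ℕₚ.m∸n≢0⇒n<m {lev g} {m ∸ suc i} λ e → ℕₚ.0≢1+n (trans (sym e) (trans (sym (lev-• (m ∸ suc i) g)) lh))
      m≤ : m ≤ lev g
      m≤ = begin
        m                          ≡⟨ ℕₚ.m+[n∸m]≡n i<m ⟨
        suc i + (m ∸ suc i)        ≡⟨ cong (_+ (m ∸ suc i)) (trans (sym lh) (lev-• (m ∸ suc i) g)) ⟩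
        lev g ∸ (m ∸ suc i) + (m ∸ suc i) ≡⟨ ℕₚ.m∸n+n≡m (ℕₚ.<⇒≤ positive) ⟩
        lev g ∎

  tree : Tree N m
  tree = record
    { _≼_ = _≼_ ; _≼?_ = _≼?_ ; lev = lev ; anc = anc
    ; ≼-refl = ≼-refl ; ≼-trans = ≼-trans ; ≼-lev = ≼-lev ; ≼-chain = ≼-chain
    ; lev≤m = lev≤m ; anc-≼ = λ i g _ → anc-≼ i g ; anc-lev = anc-lev
    ; root = root ; top = top
    }

-- Sizes of levels, classes and neighbourhoods

φ-prime-power-* : ∀ p i → Prime p → φ (p ^ suc i) ≡ p ^ i * (p ∸ 1)
φ-prime-power-* p i pr = begin
  φ (p ^ suc i)                    ≡⟨ ℕₚ.m+n∸n≡m (φ (p ^ suc i)) (p ^ i) ⟨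
  φ (p ^ suc i) + p ^ i ∸ p ^ i    ≡⟨ cong (_∸ p ^ i) (φ-prime-power p i pr) ⟩
  p * p ^ i ∸ p ^ i                ≡⟨ cong₂ _∸_ (ℕₚ.*-comm p (p ^ i)) (sym (ℕₚ.*-identityʳ (p ^ i))) ⟩
  p ^ i * p ∸ p ^ i * 1            ≡⟨ ℕₚ.*-distribˡ-∸ (p ^ i) p 1 ⟨
  p ^ i * (p ∸ 1)                  ∎
  where open ≡-Reasoning

-- `n` stands for n - 1 of the theorem; both sides are p^(i + (j+1)(n+1)) r.
^-rearrange : ∀ p i j n r →
  p ^ n * (p ^ (j * n) * (p ^ (suc i + j) * r)) ≡ p ^ i * r * (p ^ suc j) ^ suc n
^-rearrange p i j n r = begin
  p ^ n * (p ^ (j * n) * (p ^ (suc i + j) * r))   ≡⟨ assoc (p ^ n) (p ^ (j * n)) (p ^ (suc i + j)) r ⟩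
  p ^ n * p ^ (j * n) * p ^ (suc i + j) * r       ≡⟨ cong (λ z → z * p ^ (suc i + j) * r) (ℕₚ.^-distribˡ-+-* p n (j * n)) ⟨
  p ^ (n + j * n) * p ^ (suc i + j) * r           ≡⟨ cong (_* r) (ℕₚ.^-distribˡ-+-* p (n + j * n) (suc i + j)) ⟨
  p ^ (n + j * n + (suc i + j)) * r               ≡⟨ cong (λ e → p ^ e * r) (exponent n j i) ⟩
  p ^ (i + suc j * suc n) * r                     ≡⟨ cong (_* r) (ℕₚ.^-distribˡ-+-* p i (suc j * suc n)) ⟩
  p ^ i * p ^ (suc j * suc n) * r                 ≡⟨ cong (λ z → p ^ i * z * r) (ℕₚ.^-*-assoc p (suc j) (suc n)) ⟨
  p ^ i * (p ^ suc j) ^ suc n * r                 ≡⟨ swap (p ^ i) ((p ^ suc j) ^ suc n) r ⟩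
  p ^ i * r * (p ^ suc j) ^ suc n                 ∎
  where
  open ≡-Reasoning
  assoc : ∀ a b c r → a * (b * (c * r)) ≡ a * b * c * r
  assoc = solve-∀ₙ
  exponent : ∀ n j i → n + j * n + (suc i + j) ≡ i + suc j * suc n
  exponent = solve-∀ₙ
  swap : ∀ a b r → a * b * r ≡ a * r * b
  swap = solve-∀ₙ

module Counting (p m n : ℕ) (pr : Prime p) (1≤n : 1 ≤ n) where

  open PowerGroup p m n pr 1≤n
  open Digits q
  open Tree tree using (Comparable; comparable?; SameClass; sameClass?; level-size; rep-size; rep-size-class)

  -- Modulo q, p^j x determines x modulo p^(m-j) and nothing more, which leaves p^j choices for each
  -- coordinate.
  fibre-count : ∀ j h₀ → j ≤ m → ∑ₙ (λ h → 𝟙 ((p ^ j) • h ≟ (p ^ j) • h₀)) ≡ (p ^ j) ^ n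
  fibre-count j h₀ j≤m = trans
    (∑ₙ-cong λ h → 𝟙-cong ((p ^ j) • h ≟ (p ^ j) • h₀) (all? (λ d → Q? d (digit q (toℕ d) (toℕ h)))) (to h) (from h))
    (count-digits n Q Q? (p ^ j) one-coordinate)
    where
    open ≡-Reasoning
    s = p ^ (m ∸ j)
    instance
      s≢0 : NonZero (p ^ (m ∸ j))
      s≢0 = ℕₚ.m^n≢0 p (m ∸ j)
      p^j≢0 : NonZero (p ^ j)
      p^j≢0 = ℕₚ.m^n≢0 p j
    q≡ : q ≡ p ^ j * s
    q≡ = trans (cong (p ^_) (sym (ℕₚ.m+[n∸m]≡n j≤m))) (ℕₚ.^-distribˡ-+-* p j (m ∸ j))
    Q : Fin n → ℕ → Set
    Q d x = (p ^ j * x) % q ≡ (p ^ j * coord h₀ d) % q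
    Q? : ∀ d x → Dec (Q d x)
    Q? d x = (p ^ j * x) % q ℕ.≟ (p ^ j * coord h₀ d) % q
    coord-digit : ∀ h d → coord ((p ^ j) • h) d ≡ (p ^ j * digit q (toℕ d) (toℕ h)) % q
    coord-digit h d = trans (coord-• (p ^ j) h d) (cong (λ c → (p ^ j * c) % q) (coord-elem h d))
    to : ∀ h → (p ^ j) • h ≡ (p ^ j) • h₀ → ∀ d → Q d (digit q (toℕ d) (toℕ h))
    to h eq d = trans (sym (coord-digit h d)) (trans (cong (λ g → coord g d) eq) (coord-• (p ^ j) h₀ d))
    from : ∀ h → (∀ d → Q d (digit q (toℕ d) (toℕ h))) → (p ^ j) • h ≡ (p ^ j) • h₀
    from h eq = coord-injective λ d → trans (coord-digit h d) (trans (eq d) (sym (coord-• (p ^ j) h₀ d)))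
    scaled : ∀ x → (p ^ j * x) % q ≡ x % s * p ^ j
    scaled = scale-% (p ^ j) s q (trans q≡ (ℕₚ.*-comm (p ^ j) s))
    one-coordinate : ∀ d → range q (λ x → 𝟙 (Q? d x)) ≡ p ^ j
    one-coordinate d = begin
      range q (λ x → 𝟙 (Q? d x))
        ≡⟨ range-cong q (λ x _ → 𝟙-cong (Q? d x) (x % s ℕ.≟ a % s)
             (λ e → ℕₚ.*-cancelʳ-≡ (x % s) (a % s) (p ^ j) (trans (sym (scaled x)) (trans e (scaled a))))
             (λ e → trans (scaled x) (trans (cong (_* p ^ j) e) (sym (scaled a))))) ⟩
      range q (λ x → 𝟙 (x % s ℕ.≟ a % s))           ≡⟨ cong (λ k → range k (λ x → 𝟙 (x % s ℕ.≟ a % s))) q≡ ⟩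
      range (p ^ j * s) (λ x → 𝟙 (x % s ℕ.≟ a % s)) ≡⟨ range-residue (p ^ j) s (a % s) (m%n<n a s) ⟩
      p ^ j ∎
      where a = coord h₀ d

  level-count : ∀ i → i ≤ m → ∑ₙ (λ h → 𝟙 (lev h ℕ.≤? i)) ≡ (p ^ i) ^ n
  level-count i i≤m = trans (∑ₙ-cong λ h → 𝟙-cong (lev h ℕ.≤? i) ((p ^ i) • h ≟ (p ^ i) • 𝟎)
      (λ le → trans (lev-kills le) (sym (•𝟎 _))) (λ e → lev-least (trans e (•𝟎 _))))
    (fibre-count i 𝟎 i≤m)

  level-size-0 : level-size 0 ≡ 1
  level-size-0 = trans (∑ₙ-cong λ h → 𝟙-cong (lev h ℕ.≟ 0) (lev h ℕ.≤? 0) ℕₚ.≤-reflexive ℕₚ.n≤0⇒n≡0)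
    (trans (level-count 0 z≤n) (ℕₚ.^-zeroˡ n))

  level-size-suc : ∀ i → suc i ≤ m → level-size (suc i) + (p ^ i) ^ n ≡ (p ^ suc i) ^ n
  level-size-suc i i<m = begin
    level-size (suc i) + (p ^ i) ^ n
      ≡⟨ cong (_+_ (level-size (suc i))) (level-count i (ℕₚ.<⇒≤ i<m)) ⟨
    level-size (suc i) + ∑ₙ (λ h → 𝟙 (lev h ℕ.≤? i))
      ≡⟨ ∑ₙ-+ _ _ ⟨
    ∑ₙ (λ h → 𝟙 (lev h ℕ.≟ suc i) + 𝟙 (lev h ℕ.≤? i))
      ≡⟨ ∑ₙ-cong (λ h → 𝟙-⊎ (lev h ℕ.≟ suc i) (lev h ℕ.≤? i) (lev h ℕ.≤? suc i)
           ℕₚ.≤-reflexive ℕₚ.m≤n⇒m≤1+n (split h) (λ e le → ℕₚ.1+n≰n (subst (_≤ i) e le))) ⟩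
    ∑ₙ (λ h → 𝟙 (lev h ℕ.≤? suc i))
      ≡⟨ level-count (suc i) i<m ⟩
    (p ^ suc i) ^ n ∎
    where
    open ≡-Reasoning
    split : ∀ h → lev h ≤ suc i → lev h ≡ suc i ⊎ lev h ≤ i
    split h le with ℕₚ.m≤n⇒m<n∨m≡n le
    ... | inj₁ lt = inj₂ (ℕₚ.≤-pred lt)
    ... | inj₂ e = inj₁ e

  -- Truncated subtraction yields one inequality at a time: the order divides `l ∸ k`, which is
  -- smaller than the order and hence 0.
  •-injective : ∀ g {k l} → k < p ^ lev g → l < p ^ lev g → k • g ≡ l • g → k ≡ l
  •-injective g {k} {l} k< l< e = ℕₚ.≤-antisym (one-way (sym e) k<) (one-way e l<)
    where
    one-way : ∀ {k l} → k • g ≡ l • g → l < p ^ lev g → l ≤ k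
    one-way {k} {l} e l< with l ∸ k in eq | order-∣ (lev g) refl (•-∸ {k} {l} g e)
    ... | zero  | _ = ℕₚ.m∸n≡0⇒m≤n eq
    ... | suc r | d = ⊥-elim (ℕₚ.<⇒≱ l< (ℕₚ.≤-trans (∣⇒≤ d) (subst (_≤ l) eq (ℕₚ.m∸n≤m l k))))

  below-count : ∀ g → ∑ₙ (λ h → 𝟙 (h ≼? g)) ≡ p ^ lev g
  below-count g = begin
    ∑ₙ (λ h → 𝟙 (h ≼? g))
      ≡⟨ ∑ₙ-cong (λ h → ∑ₙ-unique (λ (k : Fin (p ^ lev g)) → (toℕ k • g) ≟ h) (h ≼? g)
           (λ {k} {l} e e′ → toℕ-injective (•-injective g (toℕ<n k) (toℕ<n l) (trans e (sym e′))))
           (to h) (λ k e → subst (_≼ g) e (•⇒≼ (toℕ k) g))) ⟨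
    ∑ₙ (λ h → ∑ₙ (λ (k : Fin (p ^ lev g)) → 𝟙 ((toℕ k • g) ≟ h)))
      ≡⟨ ∑ₙ-swap _ ⟩
    ∑ₙ (λ (k : Fin (p ^ lev g)) → ∑ₙ (λ h → 𝟙 ((toℕ k • g) ≟ h)))
      ≡⟨ ∑ₙ-cong (λ k → ∑ₙ-≟ (toℕ k • g)) ⟩
    range (p ^ lev g) (λ _ → 1)
      ≡⟨ trans (range-const (p ^ lev g) 1) (ℕₚ.*-identityʳ _) ⟩
    p ^ lev g ∎
    where
    open ≡-Reasoning
    instance
      p^v≢0 : NonZero (p ^ lev g)
      p^v≢0 = ℕₚ.m^n≢0 p (lev g)
    reduce : ∀ k → (k % p ^ lev g) • g ≡ k • g
    reduce k = sym (begin
      k • g                                        ≡⟨ cong (_• g) (m≡m%n+[m/n]*n k (p ^ lev g)) ⟩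
      (r + t * p ^ lev g) • g                      ≡⟨ coord-injective (λ d → kill d) ⟩
      r • g ∎)
      where
      r = k % p ^ lev g
      t = k / p ^ lev g
      multiple-kills : (t * p ^ lev g) • g ≡ 𝟎
      multiple-kills = trans (sym (•-• t _ g)) (trans (cong (t •_) (lev-kills ℕₚ.≤-refl)) (•𝟎 t))
      kill : ∀ d → coord ((r + t * p ^ lev g) • g) d ≡ coord (r • g) d
      kill d = begin
        coord ((r + t * p ^ lev g) • g) d         ≡⟨ coord-• _ g d ⟩
        ((r + t * p ^ lev g) * coord g d) % q     ≡⟨ cong (_% q) (ℕₚ.*-distribʳ-+ (coord g d) r _) ⟩
        (r * coord g d + t * p ^ lev g * coord g d) % q
          ≡⟨ %-remove-+ʳ (r * coord g d) (m%n≡0⇒n∣m _ q (trans (sym (coord-• _ g d)) (trans (cong (λ h → coord h d) multiple-kills) (coord-𝟎 d)))) ⟩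
        (r * coord g d) % q                       ≡⟨ coord-• r g d ⟨
        coord (r • g) d ∎
    to : ∀ h → h ≼ g → ∃ λ (k : Fin (p ^ lev g)) → toℕ k • g ≡ h
    to h (multiple k refl) = fromℕ< (m%n<n k (p ^ lev g)) ,
      trans (cong (_• g) (toℕ-fromℕ< (m%n<n k (p ^ lev g)))) (reduce k)

  -- The generators of ⟨g⟩ are its elements outside ⟨pg⟩, p^(i+1) - p^i in number; the trivial
  -- subgroup is covered by φ(1) = 1.
  class-count : ∀ g → ∑ₙ (λ h → 𝟙 (sameClass? g h)) ≡ φ (p ^ lev g)
  class-count g = by-level (lev g) refl
    where
    open ≡-Reasoning
    by-level : ∀ i → lev g ≡ i → ∑ₙ (λ h → 𝟙 (sameClass? g h)) ≡ φ (p ^ lev g)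
    by-level zero lg = begin
      ∑ₙ (λ h → 𝟙 (sameClass? g h)) ≡⟨ ∑ₙ-cong (λ h → 𝟙-cong (sameClass? g h) (h ≼? g) proj₁
                                          (λ h≼g → h≼g , trans (ℕₚ.n≤0⇒n≡0 (subst (lev h ≤_) lg (≼-lev h≼g))) (sym lg))) ⟩
      ∑ₙ (λ h → 𝟙 (h ≼? g))         ≡⟨ below-count g ⟩
      p ^ lev g                     ≡⟨ cong (p ^_) lg ⟩
      φ (p ^ 0)                     ≡⟨ cong (λ k → φ (p ^ k)) lg ⟨
      φ (p ^ lev g) ∎
    by-level (suc i) lg = ℕₚ.+-cancelʳ-≡ (p ^ i) _ _ (begin
      ∑ₙ (λ h → 𝟙 (sameClass? g h)) + p ^ i
        ≡⟨ cong (λ k → ∑ₙ (λ h → 𝟙 (sameClass? g h)) + p ^ k) (trans (lev-p• g) (cong (_∸ 1) lg)) ⟨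
      ∑ₙ (λ h → 𝟙 (sameClass? g h)) + p ^ lev (p • g)
        ≡⟨ cong (_+_ (∑ₙ (λ h → 𝟙 (sameClass? g h)))) (below-count (p • g)) ⟨
      ∑ₙ (λ h → 𝟙 (sameClass? g h)) + ∑ₙ (λ h → 𝟙 (h ≼? (p • g)))
        ≡⟨ ∑ₙ-+ _ _ ⟨
      ∑ₙ (λ h → 𝟙 (sameClass? g h) + 𝟙 (h ≼? (p • g)))
        ≡⟨ ∑ₙ-cong (λ h → 𝟙-⊎ (sameClass? g h) (h ≼? (p • g)) (h ≼? g) proj₁ (λ h≼ → ≼-trans h≼ (•⇒≼ p g)) (split h) (disjoint h)) ⟩
      ∑ₙ (λ h → 𝟙 (h ≼? g))
        ≡⟨ below-count g ⟩
      p ^ lev g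
        ≡⟨ cong (p ^_) lg ⟩
      p ^ suc i
        ≡⟨ φ-prime-power p i pr ⟨
      φ (p ^ suc i) + p ^ i
        ≡⟨ cong (λ k → φ (p ^ k) + p ^ i) lg ⟨
      φ (p ^ lev g) + p ^ i ∎)
      where
      lev-p•g : lev (p • g) ≡ i
      lev-p•g = trans (lev-p• g) (cong (_∸ 1) lg)
      split : ∀ h → h ≼ g → SameClass g h ⊎ h ≼ (p • g)
      split h h≼g with ℕₚ.m≤n⇒m<n∨m≡n (≼-lev h≼g)
      ... | inj₂ e = inj₁ (h≼g , e)
      ... | inj₁ lt = inj₂ (≼-chain h≼g (•⇒≼ p g) (subst (lev h ≤_) (sym lev-p•g) (ℕₚ.≤-pred (subst (lev h <_) lg lt))))
      disjoint : ∀ h → SameClass g h → ¬ h ≼ (p • g)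
      disjoint h (_ , e) h≼ = ℕₚ.1+n≰n (subst₂ _≤_ (trans e lg) lev-p•g (≼-lev h≼))

  -- Each generator of ⟨g⟩ is a multiple by p^j, because `lev g + j` ≤ `m`, and therefore has a full
  -- fibre.
  class-fibre-count : ∀ j g → lev g + j ≤ m → ∑ₙ (λ h → 𝟙 (sameClass? g ((p ^ j) • h))) ≡ φ (p ^ lev g) * (p ^ j) ^ n
  class-fibre-count j g le = begin
    ∑ₙ (λ h → 𝟙 (sameClass? g ((p ^ j) • h)))
      ≡⟨ ∑ₙ-cong (λ h → ∑ₙ-unique (λ g′ → sameClass? g g′ ×-dec ((p ^ j) • h ≟ g′)) (sameClass? g ((p ^ j) • h))
           (λ { (_ , e) (_ , e′) → trans (sym e) e′ }) (λ c → (p ^ j) • h , c , refl) (λ { .((p ^ j) • h) (c , refl) → c })) ⟨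
    ∑ₙ (λ h → ∑ₙ λ g′ → 𝟙 (sameClass? g g′ ×-dec ((p ^ j) • h ≟ g′)))
      ≡⟨ ∑ₙ-swap _ ⟩
    ∑ₙ (λ g′ → ∑ₙ λ h → 𝟙 (sameClass? g g′ ×-dec ((p ^ j) • h ≟ g′)))
      ≡⟨ ∑ₙ-cong (λ g′ → trans (∑ₙ-cong λ h → sym (𝟙-* (sameClass? g g′) ((p ^ j) • h ≟ g′)))
           (trans (sym (∑ₙ-*ˡ (𝟙 (sameClass? g g′)) _)) (fibre g′ (sameClass? g g′)))) ⟩
    ∑ₙ (λ g′ → 𝟙 (sameClass? g g′) * (p ^ j) ^ n)
      ≡⟨ ∑ₙ-*ʳ ((p ^ j) ^ n) _ ⟨
    ∑ₙ (λ g′ → 𝟙 (sameClass? g g′)) * (p ^ j) ^ n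
      ≡⟨ cong (_* (p ^ j) ^ n) (class-count g) ⟩
    φ (p ^ lev g) * (p ^ j) ^ n ∎
    where
    open ≡-Reasoning
    i = lev g
    j≤ : j ≤ m ∸ i
    j≤ = subst (_≤ m ∸ i) (ℕₚ.m+n∸m≡n i j) (ℕₚ.∸-monoˡ-≤ i le)
    fibre : ∀ g′ (d : Dec (SameClass g g′)) → 𝟙 d * ∑ₙ (λ h → 𝟙 ((p ^ j) • h ≟ g′)) ≡ 𝟙 d * (p ^ j) ^ n
    fibre g′ (no _) = refl
    fibre g′ (yes (_ , e)) with divisible i g′ (lev≤m g) (ℕₚ.≤-reflexive e)
    ... | h , refl = cong (1 *_) (trans
        (∑ₙ-cong λ h′ → cong (λ g → 𝟙 ((p ^ j) • h′ ≟ g)) (sym (trans (p^+• j (m ∸ i ∸ j) h) (cong (λ k → (p ^ k) • h) (ℕₚ.m+[n∸m]≡n j≤)))))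
        (fibre-count j ((p ^ (m ∸ i ∸ j)) • h) (ℕₚ.≤-trans j≤ (ℕₚ.m∸n≤m m i))))

  -- The order of the subgroup plus the number of elements strictly above it. Level 0 is separate:
  -- the identity has l subgroups of order p directly above it, every other class below the top has
  -- p^(n-1) classes directly above it.
  κ : ℕ → ℕ
  κ zero    = q ^ n
  κ (suc i) = p ^ suc i + p ^ (n ∸ 1) * Nj p m n (suc (suc i))

  -- The summand for k = i + 2 + j counts the elements `suc j` levels above a class of level
  -- `suc i`: each of its φ(p^(i+1)) members has (p^(j+1))^n preimages under multiplication by
  -- p^(j+1).
  Nj-range : ∀ i → p ^ (n ∸ 1) * Nj p m n (suc (suc i)) ≡ range (m ∸ suc i) (λ j → φ (p ^ suc i) * (p ^ suc j) ^ n)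
  Nj-range i = begin
    p ^ n′ * Nj p m n (suc (suc i))
      ≡⟨ cong (p ^ n′ *_) (sumFromTo-range (suc (suc i)) m f) ⟩
    p ^ n′ * range (m ∸ suc i) (λ j → f (suc (suc i) + j))
      ≡⟨ ∑ₙ-*ˡ (p ^ n′) _ ⟩
    range (m ∸ suc i) (λ j → p ^ n′ * f (suc (suc i) + j))
      ≡⟨ range-cong (m ∸ suc i) (λ j _ → term j) ⟩
    range (m ∸ suc i) (λ j → φ (p ^ suc i) * (p ^ suc j) ^ n) ∎
    where
    open ≡-Reasoning
    n′ = n ∸ 1
    f : ℕ → ℕ
    f k = p ^ ((k ∸ suc (suc i)) * n′) * φ (p ^ k)
    term : ∀ j → p ^ n′ * f (suc (suc i) + j) ≡ φ (p ^ suc i) * (p ^ suc j) ^ n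
    term j = begin
      p ^ n′ * (p ^ ((suc (suc i) + j ∸ suc (suc i)) * n′) * φ (p ^ suc (suc i + j)))
        ≡⟨ cong₂ (λ k z → p ^ n′ * (p ^ (k * n′) * z)) (ℕₚ.m+n∸m≡n (suc (suc i)) j) (φ-prime-power-* p (suc i + j) pr) ⟩
      p ^ n′ * (p ^ (j * n′) * (p ^ (suc i + j) * (p ∸ 1)))
        ≡⟨ ^-rearrange p i j n′ (p ∸ 1) ⟩
      p ^ i * (p ∸ 1) * (p ^ suc j) ^ suc n′
        ≡⟨ cong₂ (λ z k → z * (p ^ suc j) ^ k) (sym (φ-prime-power-* p i pr)) (ℕₚ.m+[n∸m]≡n 1≤n) ⟩
      φ (p ^ suc i) * (p ^ suc j) ^ n ∎

  -- The elements strictly above `g` are sorted by the level difference `suc j`; they are the `h`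
  -- for which `(p ^ suc j) • h` lies in the class of `g`.
  comparable-count : ∀ g → ∑ₙ (λ h → 𝟙 (comparable? g h)) ≡ κ (lev g)
  comparable-count g = by-level (lev g) refl
    where
    open ≡-Reasoning
    by-level : ∀ i → lev g ≡ i → ∑ₙ (λ h → 𝟙 (comparable? g h)) ≡ κ i
    by-level zero lg = trans (∑ₙ-cong λ h → 𝟙-yes (comparable? g h) (inj₁ (root h lg)))
      (trans (range-const N 1) (ℕₚ.*-identityʳ N))
    by-level (suc i) lg = begin
      ∑ₙ (λ h → 𝟙 (comparable? g h))
        ≡⟨ ∑ₙ-cong (λ h → 𝟙-⊎ (h ≼? g) (strictly h) (comparable? g h) inj₂ (inj₁ ∘ proj₁) (split h)
             (λ { h≼g (_ , lt) → ℕₚ.<⇒≱ lt (≼-lev h≼g) })) ⟨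
      ∑ₙ (λ h → 𝟙 (h ≼? g) + 𝟙 (strictly h))
        ≡⟨ ∑ₙ-+ _ _ ⟩
      ∑ₙ (λ h → 𝟙 (h ≼? g)) + ∑ₙ (λ h → 𝟙 (strictly h))
        ≡⟨ cong₂ _+_ (trans (below-count g) (cong (p ^_) lg)) strictly-count ⟩
      p ^ suc i + range (m ∸ suc i) (λ j → φ (p ^ suc i) * (p ^ suc j) ^ n)
        ≡⟨ cong (_+_ (p ^ suc i)) (Nj-range i) ⟨
      κ (suc i) ∎
      where
      Strictly : Fin N → Set
      Strictly h = g ≼ h × lev g < lev h
      strictly : ∀ h → Dec (Strictly h)
      strictly h = (g ≼? h) ×-dec (lev g ℕ.<? lev h)
      split : ∀ h → Comparable g h → h ≼ g ⊎ Strictly h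
      split h (inj₂ h≼g) = inj₁ h≼g
      split h (inj₁ g≼h) with lev g ℕ.<? lev h
      ... | yes lt = inj₂ (g≼h , lt)
      ... | no nlt = inj₁ (≼-chain ≼-refl g≼h (ℕₚ.≮⇒≥ nlt))
      lev-of : ∀ h j → SameClass g ((p ^ suc j) • h) → lev h ≡ suc i + suc j
      lev-of h j (_ , e) = begin
        lev h                         ≡⟨ ℕₚ.m∸n+n≡m (ℕₚ.<⇒≤ (ℕₚ.m∸n≢0⇒n<m {lev h} {suc j} λ z → ℕₚ.0≢1+n (trans (sym z) difference))) ⟨
        lev h ∸ suc j + suc j         ≡⟨ cong (_+ suc j) difference ⟩
        suc i + suc j ∎
        where
        difference : lev h ∸ suc j ≡ suc i
        difference = trans (sym (lev-• (suc j) h)) (trans e lg)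
      forth : ∀ h → Strictly h → ∃ λ (j : Fin (m ∸ suc i)) → SameClass g ((p ^ suc (toℕ j)) • h)
      forth h (g≼h , lt) = fromℕ< bound , subst (SameClass g) eq
          (proj₂ (≼-anc g≼h) , anc-lev (lev g) h (ℕₚ.<⇒≤ lt))
        where
        gap : suc (lev h ∸ suc (lev g)) ≡ lev h ∸ lev g
        gap = sym (ℕₚ.+-∸-assoc 1 lt)
        bound : lev h ∸ suc (lev g) < m ∸ suc i
        bound = subst₂ _≤_ (sym gap) (cong (m ∸_) lg) (ℕₚ.∸-monoˡ-≤ (lev g) (lev≤m h))
        eq : anc (lev g) h ≡ (p ^ suc (toℕ (fromℕ< bound))) • h
        eq = cong (λ k → (p ^ k) • h) (trans (sym gap) (cong suc (sym (toℕ-fromℕ< bound))))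
      back : ∀ h (j : Fin (m ∸ suc i)) → SameClass g ((p ^ suc (toℕ j)) • h) → Strictly h
      back h j c@(c≼g , e) = ≼-trans (≼-chain ≼-refl c≼g (ℕₚ.≤-reflexive (sym e))) (•⇒≼ _ h) ,
        subst₂ _<_ (sym lg) (sym (lev-of h (toℕ j) c)) (ℕₚ.m<m+n (suc i) (s≤s z≤n))
      strictly-count : ∑ₙ (λ h → 𝟙 (strictly h)) ≡ range (m ∸ suc i) (λ j → φ (p ^ suc i) * (p ^ suc j) ^ n)
      strictly-count = begin
        ∑ₙ (λ h → 𝟙 (strictly h))
          ≡⟨ ∑ₙ-cong (λ h → ∑ₙ-unique (λ (j : Fin (m ∸ suc i)) → sameClass? g ((p ^ suc (toℕ j)) • h)) (strictly h)
               (λ {j} {j′} c c′ → toℕ-injective (ℕₚ.suc-injective (ℕₚ.+-cancelˡ-≡ (suc i) _ _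
                 (trans (sym (lev-of h (toℕ j) c)) (lev-of h (toℕ j′) c′))))) (forth h) (back h)) ⟨
        ∑ₙ (λ h → ∑ₙ λ (j : Fin (m ∸ suc i)) → 𝟙 (sameClass? g ((p ^ suc (toℕ j)) • h)))
          ≡⟨ ∑ₙ-swap _ ⟩
        range (m ∸ suc i) (λ j → ∑ₙ λ h → 𝟙 (sameClass? g ((p ^ suc j) • h)))
          ≡⟨ range-cong (m ∸ suc i) (λ j j< → trans (class-fibre-count (suc j) g (room j j<)) (cong (λ k → φ (p ^ k) * (p ^ suc j) ^ n) lg)) ⟩
        range (m ∸ suc i) (λ j → φ (p ^ suc i) * (p ^ suc j) ^ n) ∎
        where
        room : ∀ j → j < m ∸ suc i → lev g + suc j ≤ m
        room j j< = subst₂ _≤_ (cong (_+ suc j) (sym lg)) (ℕₚ.m+[n∸m]≡n (subst (_≤ m) lg (lev≤m g))) (ℕₚ.+-monoʳ-≤ (suc i) j<)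

-- Evaluation of polynomials

eval : ℤ → Poly → ℤ
eval x []      = 0ℤ
eval x (a ∷ p) = a ℤ.+ x ℤ.* eval x p

eval-+ : ∀ x p r → eval x (p +P r) ≡ eval x p ℤ.+ eval x r
eval-+ x []      r       = sym (ℤₚ.+-identityˡ _)
eval-+ x (a ∷ p) []      = sym (ℤₚ.+-identityʳ _)
eval-+ x (a ∷ p) (b ∷ r) = trans (cong (λ z → a ℤ.+ b ℤ.+ x ℤ.* z) (eval-+ x p r)) (regroup a b x (eval x p) (eval x r))
  where
  regroup : ∀ a b x u v → a ℤ.+ b ℤ.+ x ℤ.* (u ℤ.+ v) ≡ a ℤ.+ x ℤ.* u ℤ.+ (b ℤ.+ x ℤ.* v)
  regroup = solve-∀

eval-scale : ∀ x c p → eval x (scaleP c p) ≡ c ℤ.* eval x p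
eval-scale x c []      = sym (ℤₚ.*-zeroʳ c)
eval-scale x c (a ∷ p) = trans (cong (λ z → c ℤ.* a ℤ.+ x ℤ.* z) (eval-scale x c p)) (regroup c a x (eval x p))
  where
  regroup : ∀ c a x u → c ℤ.* a ℤ.+ x ℤ.* (c ℤ.* u) ≡ c ℤ.* (a ℤ.+ x ℤ.* u)
  regroup = solve-∀

eval-neg : ∀ x p → eval x (negP p) ≡ ℤ.- eval x p
eval-neg x p = trans (eval-scale x (ℤ.- 1ℤ) p) (ℤₚ.-1*i≡-i (eval x p))

eval-- : ∀ x p r → eval x (p -P r) ≡ eval x p ℤ.- eval x r
eval-- x p r = trans (eval-+ x p (negP r)) (cong (ℤ._+_ (eval x p)) (eval-neg x r))

eval-* : ∀ x p r → eval x (p *P r) ≡ eval x p ℤ.* eval x r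
eval-* x []      r = sym (ℤₚ.*-zeroˡ (eval x r))
eval-* x (a ∷ p) r = trans (eval-+ x (scaleP a r) (0ℤ ∷ (p *P r)))
  (trans (cong₂ (λ u v → u ℤ.+ (0ℤ ℤ.+ x ℤ.* v)) (eval-scale x a r) (eval-* x p r)) (regroup a x (eval x p) (eval x r)))
  where
  regroup : ∀ a x u v → a ℤ.* v ℤ.+ (0ℤ ℤ.+ x ℤ.* (u ℤ.* v)) ≡ (a ℤ.+ x ℤ.* u) ℤ.* v
  regroup = solve-∀

eval-const : ∀ x c → eval x (constP c) ≡ c
eval-const x c = trans (cong (ℤ._+_ c) (ℤₚ.*-zeroʳ x)) (ℤₚ.+-identityʳ c)

eval-X : ∀ x → eval x X ≡ x
eval-X = identity
  where
  identity : ∀ x → 0ℤ ℤ.+ x ℤ.* (1ℤ ℤ.+ x ℤ.* 0ℤ) ≡ x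
  identity = solve-∀

eval-x- : ∀ x a → eval x (x- a) ≡ x ℤ.- + a
eval-x- x a = trans (eval-- x X (constP (+ a))) (cong₂ ℤ._-_ (eval-X x) (eval-const x (+ a)))

eval-^ : ∀ x p k → eval x (p ^P k) ≡ eval x p ℤ.^ k
eval-^ x p zero    = eval-const x 1ℤ
eval-^ x p (suc k) = trans (eval-* x p (p ^P k)) (cong (eval x p ℤ.*_) (eval-^ x p k))

eval-x-^ : ∀ x a k → eval x ((x- a) ^P k) ≡ (x ℤ.- + a) ℤ.^ k
eval-x-^ x a k = trans (eval-^ x (x- a) k) (cong (ℤ._^ k) (eval-x- x a))

eval-sum : ∀ x n (f : Fin n → Poly) → eval x (sumFinP n f) ≡ ∑ (λ i → eval x (f i))
eval-sum x zero    f = sym (∑-empty _)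
eval-sum x (suc n) f = trans (eval-+ x (f zero) (sumFinP n (f ∘ suc))) (trans (cong (ℤ._+_ (eval x (f zero))) (eval-sum x n (f ∘ suc))) (sym (∑-suc _)))

eval-alt : ∀ x {n} (j : Fin n) p → eval x (alt (toℕ j) p) ≡ sgn j ℤ.* eval x p
eval-alt x zero    p = sym (ℤₚ.*-identityˡ _)
eval-alt x (suc j) p = trans (eval-neg x (alt (toℕ j) p)) (trans (cong ℤ.-_ (eval-alt x j p)) (ℤₚ.neg-distribˡ-* (sgn j) (eval x p)))

eval-det : ∀ x n (M : Fin n → Fin n → Poly) → eval x (det n M) ≡ detℤ n (λ i j → eval x (M i j))
eval-det x zero    M = eval-const x 1ℤ
eval-det x (suc n) M = trans (eval-sum x (suc n) (λ j → alt (toℕ j) (M zero j *P D j))) (∑-cong λ j →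
  trans (eval-alt x j (M zero j *P D j)) (cong (sgn j ℤ.*_)
    (trans (eval-* x (M zero j) (D j)) (cong (eval x (M zero j) ℤ.*_) (eval-det x n (minors j))))))
  where
  minors : Fin (suc n) → Fin n → Fin n → Poly
  minors j r c = M (suc r) (punchIn j c)
  D : Fin (suc n) → Poly
  D j = det n (minors j)

prodFrom : ℕ → ℕ → (ℕ → ℤ) → ℤ
prodFrom zero    a g = 1ℤ
prodFrom (suc r) a g = g a ℤ.* prodFrom r (suc a) g

-- Reconciles two orders of multiplication: `factors` grows at the highest level, the products of
-- `rhs` peel off the lowest index.
prodFrom-snoc : ∀ r a g → prodFrom (suc r) a g ≡ prodFrom r a g ℤ.* g (a + r)
prodFrom-snoc zero    a g = trans (ℤₚ.*-comm (g a) 1ℤ) (cong (λ k → 1ℤ ℤ.* g k) (sym (ℕₚ.+-identityʳ a)))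
prodFrom-snoc (suc r) a g = trans (cong (g a ℤ.*_) (prodFrom-snoc r (suc a) g))
  (trans (sym (ℤₚ.*-assoc (g a) (prodFrom r (suc a) g) _)) (cong (λ k → g a ℤ.* prodFrom r (suc a) g ℤ.* g k) (sym (ℕₚ.+-suc a r))))

prodFrom-cong : ∀ r a {g h} → (∀ i → g i ≡ h i) → prodFrom r a g ≡ prodFrom r a h
prodFrom-cong zero    a eq = refl
prodFrom-cong (suc r) a eq = cong₂ ℤ._*_ (eq a) (prodFrom-cong r (suc a) eq)

eval-prod : ∀ x a b f → eval x (prodFromToP a b f) ≡ prodFrom (suc b ∸ a) a (eval x ∘ f)
eval-prod x a b f = by-length (suc b ∸ a) a b refl
  where
  by-length : ∀ r a b → suc b ∸ a ≡ r → eval x (prodFromToP a b f) ≡ prodFrom r a (eval x ∘ f)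
  by-length zero    a b eq rewrite eq = eval-const x 1ℤ
  by-length (suc r) a b eq = trans (cong (eval x) unfold)
    (trans (eval-* x (f a) (prodFromToP (suc a) b f)) (cong (eval x (f a) ℤ.*_) (by-length r (suc a) b shorter)))
    where
    shorter : b ∸ a ≡ r
    shorter = trans (sym (ℕₚ.pred[m∸n]≡m∸[1+n] (suc b) a)) (cong ℕ.pred eq)
    unfold : prodFromToP a b f ≡ f a *P prodFromToP (suc a) b f
    unfold rewrite eq | shorter = refl

coeff-+ : ∀ p r k → coeff (p +P r) k ≡ coeff p k ℤ.+ coeff r k
coeff-+ []      r       k       = sym (ℤₚ.+-identityˡ _)
coeff-+ (a ∷ p) []      k       = sym (ℤₚ.+-identityʳ _)
coeff-+ (a ∷ p) (b ∷ r) zero    = refl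
coeff-+ (a ∷ p) (b ∷ r) (suc k) = coeff-+ p r k

coeff-scale : ∀ c p k → coeff (scaleP c p) k ≡ c ℤ.* coeff p k
coeff-scale c []      k       = sym (ℤₚ.*-zeroʳ c)
coeff-scale c (a ∷ p) zero    = refl
coeff-scale c (a ∷ p) (suc k) = coeff-scale c p k

-- Evaluating at x = |a| + 1 shows that the constant coefficient a, a multiple
-- of x, is zero.
vanishing⇒coeff≡0 : ∀ p → (∀ x → x ≢ 0ℤ → eval x p ≡ 0ℤ) → ∀ k → coeff p k ≡ 0ℤ
vanishing⇒coeff≡0 []      _     k = refl
vanishing⇒coeff≡0 (a ∷ p) roots = λ { zero → a≡0 ; (suc k) → vanishing⇒coeff≡0 p roots′ k }
  where
  x = + suc ℤ.∣ a ∣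
  size : ℤ.∣ a ∣ ≡ suc ℤ.∣ a ∣ * ℤ.∣ eval x p ∣
  size = trans (cong ℤ.∣_∣ (trans (isolate a (x ℤ.* eval x p)) (cong (ℤ._- x ℤ.* eval x p) (roots x λ ()))))
    (trans (cong ℤ.∣_∣ (ℤₚ.+-identityˡ (ℤ.- (x ℤ.* eval x p)))) (trans (ℤₚ.∣-i∣≡∣i∣ (x ℤ.* eval x p)) (ℤₚ.abs-* x (eval x p))))
    where
    isolate : ∀ a y → a ≡ a ℤ.+ y ℤ.- y
    isolate = solve-∀
  a≡0 : a ≡ 0ℤ
  a≡0 = ℤₚ.∣i∣≡0⇒i≡0 (by-size ℤ.∣ eval x p ∣ size)
    where
    by-size : ∀ e → ℤ.∣ a ∣ ≡ suc ℤ.∣ a ∣ * e → ℤ.∣ a ∣ ≡ 0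
    by-size zero    eq = trans eq (ℕₚ.*-zeroʳ ℤ.∣ a ∣)
    by-size (suc e) eq = ⊥-elim (ℕₚ.1+n≰n (subst (suc ℤ.∣ a ∣ ≤_) (sym eq) (ℕₚ.m≤m*n (suc ℤ.∣ a ∣) (suc e))))
  -- With a = 0 the hypothesis yields y p(y) = 0, which says nothing at y = 0; this is why that
  -- point is excluded from the induction.
  roots′ : ∀ y → y ≢ 0ℤ → eval y p ≡ 0ℤ
  roots′ y y≢0 with ℤₚ.i*j≡0⇒i≡0∨j≡0 y (trans (sym (ℤₚ.+-identityˡ _)) (trans (cong (ℤ._+ y ℤ.* eval y p) (sym a≡0)) (roots y y≢0)))
  ... | inj₁ y≡0 = ⊥-elim (y≢0 y≡0)
  ... | inj₂ e≡0 = e≡0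

eval-injective : ∀ p r → (∀ x → eval x p ≡ eval x r) → p ≈P r
eval-injective p r eq k = ℤₚ.i-j≡0⇒i≡j (coeff p k) (coeff r k) (begin
  coeff p k ℤ.- coeff r k                ≡⟨ cong (ℤ._+_ (coeff p k)) (trans (coeff-scale -1ℤ r k) (ℤₚ.-1*i≡-i (coeff r k))) ⟨
  coeff p k ℤ.+ coeff (negP r) k         ≡⟨ coeff-+ p (negP r) k ⟨
  coeff (p -P r) k                       ≡⟨ vanishing⇒coeff≡0 (p -P r) (λ x _ → trans (eval-- x p r) (ℤₚ.i≡j⇒i-j≡0 (eq x))) k ⟩
  0ℤ ∎)
  where open ≡-Reasoning

-- Multiplicities and assembly of the Laplacian polynomial

sumFin-∑ₙ : ∀ n (f : Fin n → ℕ) → sumFin n f ≡ ∑ₙ f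
sumFin-∑ₙ zero    f = sym (∑ₙ-empty f)
sumFin-∑ₙ (suc n) f = trans (cong (_+_ (f zero)) (sumFin-∑ₙ n (f ∘ suc))) (sym (∑ₙ-suc f))

^-distribʳ-* : ∀ a b n → (a * b) ^ n ≡ a ^ n * b ^ n
^-distribʳ-* a b zero    = refl
^-distribʳ-* a b (suc n) = trans (cong (a * b *_) (^-distribʳ-* a b n)) (interchange a b (a ^ n) (b ^ n))
  where
  interchange : ∀ a b c d → a * b * (c * d) ≡ a * c * (b * d)
  interchange = solve-∀ₙ

ell-spec : ∀ p n → Prime p → ell p n * (p ∸ 1) + 1 ≡ p ^ n
ell-spec zero          n pr = ⊥-elim (ℕ.≢-nonZero⁻¹ 0 {{prime⇒nonZero pr}} refl)
ell-spec (suc zero)    n pr = ⊥-elim (ℕ.nonTrivial⇒≢1 {{prime⇒nonTrivial pr}} refl)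
ell-spec (suc (suc k)) n pr with geometric n
  where
  geometric : ∀ n → ∃ λ l → l * suc k + 1 ≡ suc (suc k) ^ n
  geometric zero    = 0 , refl
  geometric (suc n) with geometric n
  -- Horner step for 1 + p + ... + p^n; the geometric sum shows that the division in `ell` is exact.
  ... | l , eq = 1 + suc (suc k) * l , trans (step k l) (cong (suc (suc k) *_) eq)
    where
    step : ∀ k l → (1 + suc (suc k) * l) * suc k + 1 ≡ suc (suc k) * (l * suc k + 1)
    step = solve-∀ₙ
... | l , eq = trans (cong (λ z → z * suc k + 1) (begin
    (suc (suc k) ^ n ∸ 1) / suc k     ≡⟨ cong (λ z → (z ∸ 1) / suc k) eq ⟨
    (l * suc k + 1 ∸ 1) / suc k       ≡⟨ cong (_/ suc k) (ℕₚ.m+n∸n≡m (l * suc k) 1) ⟩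
    l * suc k / suc k                 ≡⟨ m*n/n≡m l (suc k) ⟩
    l ∎)) eq
  where open ≡-Reasoning

module Spectrum (p m n : ℕ) (pr : Prime p) (1≤n : 1 ≤ n) where

  open PowerGroup p m n pr 1≤n
  open Counting p m n pr 1≤n
  open Tree tree using (Comparable; comparable?; level-size; rep-size; rep-size-class)

  n′ l : ℕ
  n′ = n ∸ 1
  l = ell p n

  n≡ : suc n′ ≡ n
  n≡ = ℕₚ.m+[n∸m]≡n 1≤n

  rep-size-φ : ∀ i → i ≤ m → rep-size i * φ (p ^ i) ≡ level-size i
  rep-size-φ i i≤m = rep-size-class i (φ (p ^ i)) i≤m (λ g lg → trans (class-count g) (cong (λ k → φ (p ^ k)) lg))

  rep-size-0 : rep-size 0 ≡ 1
  rep-size-0 = trans (sym (ℕₚ.*-identityʳ _)) (trans (rep-size-φ 0 z≤n) level-size-0)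

  -- The number of cyclic subgroups of order p^(i+1): the p^((i+1)n) - p^(in) elements of that
  -- order, divided among classes of size p^i (p - 1).
  rep-size-suc : ∀ i → suc i ≤ m → rep-size (suc i) ≡ l * p ^ (i * n′)
  rep-size-suc i i<m = ℕₚ.*-cancelʳ-≡ _ _ (p ^ i * (p ∸ 1)) (begin
    rep-size (suc i) * (p ^ i * (p ∸ 1))          ≡⟨ cong (rep-size (suc i) *_) (φ-prime-power-* p i pr) ⟨
    rep-size (suc i) * φ (p ^ suc i)              ≡⟨ rep-size-φ (suc i) i<m ⟩
    level-size (suc i)                            ≡⟨ ℕₚ.+-cancelʳ-≡ ((p ^ i) ^ n) _ _ sizes ⟩
    l * (p ∸ 1) * (p ^ i) ^ n                     ≡⟨ cong (λ k → l * (p ∸ 1) * (p ^ i) ^ k) n≡ ⟨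
    l * (p ∸ 1) * (p ^ i * (p ^ i) ^ n′)          ≡⟨ cong (λ z → l * (p ∸ 1) * (p ^ i * z)) (ℕₚ.^-*-assoc p i n′) ⟩
    l * (p ∸ 1) * (p ^ i * p ^ (i * n′))          ≡⟨ regroup l (p ∸ 1) (p ^ i) (p ^ (i * n′)) ⟩
    l * p ^ (i * n′) * (p ^ i * (p ∸ 1))          ∎)
    where
    open ≡-Reasoning
    instance
      p-1≢0 : NonZero (p ∸ 1)
      p-1≢0 = ℕ.>-nonZero (ℕₚ.m<n⇒0<n∸m (ℕ.nonTrivial⇒n>1 p {{prime⇒nonTrivial pr}}))
      unit≢0 : NonZero (p ^ i * (p ∸ 1))
      unit≢0 = ℕₚ.m*n≢0 (p ^ i) (p ∸ 1) {{ℕₚ.m^n≢0 p i}}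
    sizes : level-size (suc i) + (p ^ i) ^ n ≡ l * (p ∸ 1) * (p ^ i) ^ n + (p ^ i) ^ n
    sizes = begin
      level-size (suc i) + (p ^ i) ^ n              ≡⟨ level-size-suc i i<m ⟩
      (p * p ^ i) ^ n                               ≡⟨ ^-distribʳ-* p (p ^ i) n ⟩
      p ^ n * (p ^ i) ^ n                           ≡⟨ cong (_* (p ^ i) ^ n) (ell-spec p n pr) ⟨
      (l * (p ∸ 1) + 1) * (p ^ i) ^ n               ≡⟨ expand (l * (p ∸ 1)) ((p ^ i) ^ n) ⟩
      l * (p ∸ 1) * (p ^ i) ^ n + (p ^ i) ^ n       ∎
      where
      expand : ∀ a b → (a + 1) * b ≡ a * b + b
      expand = solve-∀ₙ
    regroup : ∀ a b c d → a * b * (c * d) ≡ a * d * (c * b)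
    regroup = solve-∀ₙ

  level-size-φ : ∀ i → suc i ≤ m → level-size (suc i) ≡ l * p ^ (i * n′) * φ (p ^ suc i)
  level-size-φ i i<m = trans (sym (rep-size-φ (suc i) i<m)) (cong (_* φ (p ^ suc i)) (rep-size-suc i i<m))

  top-multiplicity : ∀ i → suc i ≤ m →
    level-size (suc i) ∸ rep-size (suc i) ≡ l * p ^ (i * n′) * (φ (p ^ suc i) ∸ 1)
  top-multiplicity i i<m = trans (cong₂ _∸_ (level-size-φ i i<m) (trans (rep-size-suc i i<m) (sym (ℕₚ.*-identityʳ _))))
    (sym (ℕₚ.*-distribˡ-∸ (l * p ^ (i * n′)) (φ (p ^ suc i)) 1))

  join-multiplicity : ∀ i → suc (suc i) ≤ m →
    rep-size (suc (suc i)) ∸ rep-size (suc i) ≡ l * p ^ (i * n′) * (p ^ n′ ∸ 1)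
  join-multiplicity i i<m = begin
    rep-size (suc (suc i)) ∸ rep-size (suc i)            ≡⟨ cong₂ _∸_ (rep-size-suc (suc i) i<m) (rep-size-suc i (ℕₚ.<⇒≤ i<m)) ⟩
    l * p ^ (n′ + i * n′) ∸ l * p ^ (i * n′)             ≡⟨ cong₂ _∸_ (trans (cong (l *_) (ℕₚ.^-distribˡ-+-* p n′ (i * n′))) (regroup l (p ^ n′) (p ^ (i * n′)))) (sym (ℕₚ.*-identityʳ (l * p ^ (i * n′)))) ⟩
    l * p ^ (i * n′) * p ^ n′ ∸ l * p ^ (i * n′) * 1     ≡⟨ ℕₚ.*-distribˡ-∸ (l * p ^ (i * n′)) (p ^ n′) 1 ⟨
    l * p ^ (i * n′) * (p ^ n′ ∸ 1)                      ∎
    where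
    open ≡-Reasoning
    regroup : ∀ a b c → a * (b * c) ≡ a * c * b
    regroup = solve-∀ₙ

  root-multiplicity : 1 ≤ m → rep-size 1 ∸ rep-size 0 ≡ l ∸ 1
  root-multiplicity 1≤m = cong₂ _∸_ (trans (rep-size-suc 0 1≤m) (ℕₚ.*-identityʳ l)) rep-size-0

  module _ (x : ℤ) where

    open Tree.Determinant tree x κ (p ^_) comparable-count below-count

    A : Graph N
    A = powerGraphZ q n

    adjacent? : ∀ g h → Dec (g ≢ h × (IsPowerOf q n g h ⊎ IsPowerOf q n h g))
    adjacent? g h = ¬? (g ≟ h) ×-dec (isPowerOf? q n g h ⊎-dec isPowerOf? q n h g)

    adjacent⇒comparable : ∀ {g h} → IsPowerOf q n g h ⊎ IsPowerOf q n h g → Comparable g h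
    adjacent⇒comparable (inj₁ r) = inj₁ (IsPowerOf⇒≼ r)
    adjacent⇒comparable (inj₂ r) = inj₂ (IsPowerOf⇒≼ r)

    comparable⇒adjacent : ∀ {g h} → Comparable g h → IsPowerOf q n g h ⊎ IsPowerOf q n h g
    comparable⇒adjacent (inj₁ r) = inj₁ (≼⇒IsPowerOf r)
    comparable⇒adjacent (inj₂ r) = inj₂ (≼⇒IsPowerOf r)

    κ-degree : ∀ g → κ (lev g) ≡ 1 + degree A g
    κ-degree g = begin
      κ (lev g)                                          ≡⟨ comparable-count g ⟨
      ∑ₙ (λ h → 𝟙 (comparable? g h))                     ≡⟨ ∑ₙ-cong (λ h → 𝟙-⊎ (g ≟ h) (adjacent? g h) (comparable? g h)
                                                              (λ { refl → inj₁ ≼-refl }) (adjacent⇒comparable ∘ proj₂) (split h)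
                                                              (λ e (ne , _) → ne e)) ⟨
      ∑ₙ (λ h → 𝟙 (g ≟ h) + 𝟙 (adjacent? g h))           ≡⟨ ∑ₙ-+ _ _ ⟩
      ∑ₙ (λ h → 𝟙 (g ≟ h)) + ∑ₙ (λ h → 𝟙 (adjacent? g h)) ≡⟨ cong₂ _+_ (∑ₙ-≟ g) (sym (sumFin-∑ₙ N (λ h → b2ℕ (A g h)))) ⟩
      1 + degree A g ∎
      where
      open ≡-Reasoning
      split : ∀ h → Comparable g h → g ≡ h ⊎ (g ≢ h × (IsPowerOf q n g h ⊎ IsPowerOf q n h g))
      split h c with g ≟ h
      ... | yes e = inj₁ e
      ... | no ne = inj₂ (ne , comparable⇒adjacent c)

    eval-entry : ∀ g h → eval x ((if ⌊ g ≟ h ⌋ then X else []) -P constP (laplacian A g h)) ≡ M g h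
    eval-entry g h = trans (eval-- x (if ⌊ g ≟ h ⌋ then X else []) (constP (laplacian A g h)))
      (trans (cong (ℤ._-_ (eval x (if ⌊ g ≟ h ⌋ then X else []))) (eval-const x (laplacian A g h))) (by-cases (g ≟ h)))
      where
      by-cases : (d : Dec (g ≡ h)) →
        eval x (if ⌊ d ⌋ then X else []) ℤ.- ((if ⌊ d ⌋ then + degree A g else 0ℤ) ℤ.- + 𝟙 (adjacent? g h)) ≡
        (if ⌊ d ⌋ then 1ℤ else 0ℤ) ℤ.* (x ℤ.- + κ (lev g)) ℤ.+ + 𝟙 (comparable? g h)
      by-cases (yes refl) = trans (cong₂ (λ u v → u ℤ.- (+ degree A g ℤ.- + v)) (eval-X x) (𝟙-no (adjacent? g g) λ (ne , _) → ne refl))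
        (trans (simplify x (+ degree A g)) (cong₂ (λ u v → 1ℤ ℤ.* (x ℤ.- u) ℤ.+ + v)
          (trans (sym (ℤₚ.pos-+ 1 (degree A g))) (cong +_ (sym (κ-degree g)))) (sym (𝟙-yes (comparable? g g) (inj₁ ≼-refl)))))
        where
        simplify : ∀ x d → x ℤ.- (d ℤ.- 0ℤ) ≡ 1ℤ ℤ.* (x ℤ.- (1ℤ ℤ.+ d)) ℤ.+ 1ℤ
        simplify = solve-∀
      by-cases (no ne) = trans (cong (λ u → 0ℤ ℤ.- (0ℤ ℤ.- + u)) (𝟙-cong (adjacent? g h) (comparable? g h)
          (adjacent⇒comparable ∘ proj₂) (λ c → ne , comparable⇒adjacent c)))
        (simplify (+ 𝟙 (comparable? g h)) (x ℤ.- + κ (lev g)))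
        where
        simplify : ∀ u z → 0ℤ ℤ.- (0ℤ ℤ.- u) ≡ 0ℤ ℤ.* z ℤ.+ u
        simplify = solve-∀

    eval-laplacian : eval x (laplacianPoly N A) ≡ (x ℤ.- + κ m) ℤ.^ (level-size m ∸ rep-size m) ℤ.* factors m
    eval-laplacian = trans (eval-det x N (λ g h → (if ⌊ g ≟ h ⌋ then X else []) -P constP (laplacian A g h))) (trans (det-cong N eval-entry) (det-M 𝟎))

    joinFactor classFactor : ℕ → ℤ
    joinFactor i = (x ℤ.- + (p ^ i)) ℤ.^ (l * p ^ ((i ∸ 1) * n′) * (p ^ n′ ∸ 1))
    classFactor i = (x ℤ.- + (p ^ i + p ^ n′ * Nj p m n (suc i))) ℤ.^ (l * p ^ ((i ∸ 1) * n′) * φ (p ^ i))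

    -- Level 0 gives the isolated factors: the identity is absorbed once, the l subgroups of order p
    -- are joined, and the final block contributes x. Each further level adds one factor to either
    -- product.
    factors-product : ∀ i → suc i ≤ m → factors (suc i) ≡
      x ℤ.* (x ℤ.- + (p ^ (m * n))) ℤ.* (x ℤ.- + 1) ℤ.^ (l ∸ 1) ℤ.* prodFrom i 1 joinFactor ℤ.* prodFrom i 1 classFactor
    factors-product zero 1≤m = trans
      (cong₂ (λ e z → (x ℤ.- + 1) ℤ.^ e ℤ.* (z ℤ.* x)) (root-multiplicity 1≤m)
        (trans (cong₂ (λ k e → (x ℤ.- + k) ℤ.^ e) (ℕₚ.^-*-assoc p m n) level-size-0) (ℤₚ.^-identityʳ (x ℤ.- + (p ^ (m * n))))))
      (regroup ((x ℤ.- + 1) ℤ.^ (l ∸ 1)) (x ℤ.- + (p ^ (m * n))) x)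
      where
      regroup : ∀ a b x → a ℤ.* (b ℤ.* x) ≡ x ℤ.* b ℤ.* a ℤ.* 1ℤ ℤ.* 1ℤ
      regroup = solve-∀
    factors-product (suc i) i<m = begin
      factors (suc (suc i))
        ≡⟨ cong₂ (λ e z → (x ℤ.- + (p ^ suc i)) ℤ.^ e ℤ.* z) (join-multiplicity i i<m)
             (cong₂ (λ e z → (x ℤ.- + κ (suc i)) ℤ.^ e ℤ.* z) (level-size-φ i (ℕₚ.<⇒≤ i<m)) (factors-product i (ℕₚ.<⇒≤ i<m))) ⟩
      joinFactor (suc i) ℤ.* (classFactor (suc i) ℤ.* (C ℤ.* prodFrom i 1 joinFactor ℤ.* prodFrom i 1 classFactor))
        ≡⟨ regroup (joinFactor (suc i)) (classFactor (suc i)) C (prodFrom i 1 joinFactor) (prodFrom i 1 classFactor) ⟩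
      C ℤ.* (prodFrom i 1 joinFactor ℤ.* joinFactor (suc i)) ℤ.* (prodFrom i 1 classFactor ℤ.* classFactor (suc i))
        ≡⟨ cong₂ (λ u v → C ℤ.* u ℤ.* v) (prodFrom-snoc i 1 joinFactor) (prodFrom-snoc i 1 classFactor) ⟨
      C ℤ.* prodFrom (suc i) 1 joinFactor ℤ.* prodFrom (suc i) 1 classFactor ∎
      where
      open ≡-Reasoning
      C = x ℤ.* (x ℤ.- + (p ^ (m * n))) ℤ.* (x ℤ.- + 1) ℤ.^ (l ∸ 1)
      regroup : ∀ a b c u v → a ℤ.* (b ℤ.* (c ℤ.* u ℤ.* v)) ≡ c ℤ.* (u ℤ.* a) ℤ.* (v ℤ.* b)
      regroup = solve-∀

    eval-rhs : eval x (rhs p m n) ≡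
      x ℤ.* (x ℤ.- + (p ^ (m * n))) ℤ.* (x ℤ.- + 1) ℤ.^ (l ∸ 1) ℤ.*
      (x ℤ.- + (p ^ m)) ℤ.^ (l * p ^ ((m ∸ 1) * n′) * (φ (p ^ m) ∸ 1)) ℤ.*
      prodFrom (m ∸ 1) 1 joinFactor ℤ.* prodFrom (m ∸ 1) 1 classFactor
    eval-rhs =
      times (f₁ *P f₂ *P f₃ *P f₄ *P f₅) f₆
        (times (f₁ *P f₂ *P f₃ *P f₄) f₅
          (times (f₁ *P f₂ *P f₃) f₄
            (times (f₁ *P f₂) f₃
              (times f₁ f₂ (eval-X x) (eval-x- x (p ^ (m * n))))
              (eval-x-^ x 1 (l ∸ 1)))
            (eval-x-^ x (p ^ m) (l * p ^ ((m ∸ 1) * n′) * (φ (p ^ m) ∸ 1))))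
          (trans (eval-prod x 1 (m ∸ 1) joinPoly) (prodFrom-cong (m ∸ 1) 1 λ i → eval-x-^ x (p ^ i) (l * p ^ ((i ∸ 1) * n′) * (p ^ n′ ∸ 1)))))
        (trans (eval-prod x 1 (m ∸ 1) classPoly) (prodFrom-cong (m ∸ 1) 1 λ i →
          eval-x-^ x (p ^ i + p ^ n′ * Nj p m n (suc i)) (l * p ^ ((i ∸ 1) * n′) * φ (p ^ i))))
      where
      joinPoly classPoly : ℕ → Poly
      joinPoly i = (x- (p ^ i)) ^P (l * p ^ ((i ∸ 1) * n′) * (p ^ n′ ∸ 1))
      classPoly i = (x- (p ^ i + p ^ n′ * Nj p m n (suc i))) ^P (l * p ^ ((i ∸ 1) * n′) * φ (p ^ i))
      f₁ f₂ f₃ f₄ f₅ f₆ : Poly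
      f₁ = X
      f₂ = x- (p ^ (m * n))
      f₃ = (x- 1) ^P (l ∸ 1)
      f₄ = (x- (p ^ m)) ^P (l * p ^ ((m ∸ 1) * n′) * (φ (p ^ m) ∸ 1))
      f₅ = prodFromToP 1 (m ∸ 1) joinPoly
      f₆ = prodFromToP 1 (m ∸ 1) classPoly
      times : ∀ f g {u v} → eval x f ≡ u → eval x g ≡ v → eval x (f *P g) ≡ u ℤ.* v
      times f g ef eg = trans (eval-* x f g) (cong₂ ℤ._*_ ef eg)

laplacian-rhs : ∀ p m n (pr : Prime p) (1≤n : 1 ≤ n) x →
  eval x (laplacianPoly ((p ^ suc m) ^ n) (powerGraphZ (p ^ suc m) n)) ≡ eval x (rhs p (suc m) n)
laplacian-rhs p m n pr 1≤n x = begin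
  eval x (laplacianPoly ((p ^ suc m) ^ n) (powerGraphZ (p ^ suc m) n))
    ≡⟨ eval-laplacian x ⟩
  (x ℤ.- + κ (suc m)) ℤ.^ (level-size (suc m) ∸ rep-size (suc m)) ℤ.* factors (suc m)
    ≡⟨ cong₂ ℤ._*_ (cong₂ (λ k e → (x ℤ.- + k) ℤ.^ e) κ-top (top-multiplicity m ℕₚ.≤-refl)) (factors-product x m ℕₚ.≤-refl) ⟩
  T ℤ.* (C ℤ.* P ℤ.* K)
    ≡⟨ regroup T C P K ⟩
  C ℤ.* T ℤ.* P ℤ.* K
    ≡⟨ eval-rhs x ⟨
  eval x (rhs p (suc m) n) ∎
  where
  open ≡-Reasoning
  open Spectrum p (suc m) n pr 1≤n
  open PowerGroup p (suc m) n pr 1≤n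
  open Counting p (suc m) n pr 1≤n
  open Tree tree using (level-size; rep-size)
  open Tree.Determinant tree x κ (p ^_) comparable-count below-count using (factors)
  C = x ℤ.* (x ℤ.- + (p ^ (suc m * n))) ℤ.* (x ℤ.- + 1) ℤ.^ (l ∸ 1)
  T = (x ℤ.- + (p ^ suc m)) ℤ.^ (l * p ^ (m * n′) * (φ (p ^ suc m) ∸ 1))
  P = prodFrom m 1 (joinFactor x)
  K = prodFrom m 1 (classFactor x)
  -- Nothing lies above the top level: the sum defining `Nj` beyond it is empty.
  κ-top : κ (suc m) ≡ p ^ suc m
  κ-top = begin
    p ^ suc m + p ^ n′ * Nj p (suc m) n (suc (suc m))
      ≡⟨ cong (_+_ (p ^ suc m)) (trans (Nj-range m) (trans (cong (λ k → range k (λ j → φ (p ^ suc m) * (p ^ suc j) ^ n)) (ℕₚ.n∸n≡0 m)) (∑ₙ-empty _))) ⟩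
    p ^ suc m + 0
      ≡⟨ ℕₚ.+-identityʳ _ ⟩
    p ^ suc m ∎
  regroup : ∀ t c j k → t ℤ.* (c ℤ.* j ℤ.* k) ≡ c ℤ.* t ℤ.* j ℤ.* k
  regroup = solve-∀

theorem3p3 : (p m n : ℕ) → Prime p → 1 ≤ m → 1 ≤ n →
    laplacianPoly ((p ^ m) ^ n) (powerGraphZ (p ^ m) n) ≈P rhs p m n
theorem3p3 p (suc m) n pr _ 1≤n =
  eval-injective (laplacianPoly ((p ^ suc m) ^ n) (powerGraphZ (p ^ suc m) n)) (rhs p (suc m) n) (laplacian-rhs p m n pr 1≤n)
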